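{- Let $n$ be a nonnegative integer. Then $b_9(n)$ is divisible by $3$ if and only if at least one of the following conditions holds (where $p$ ranges over prime numbers): \begin{itemize} \item $\#\{p : p\equiv 2\pmod 3,\ \mathrm{ord}_p(3n+1)\text{ is odd}\}\neq 0$; \item $\#\{p : p\equiv 1\pmod 3,\ \mathrm{ord}_p(3n+1)\equiv 2\pmod 3\}\neq 0$. \end{itemize}
   Context: A partition of a positive integer $n$ is a non-increasing sequence of positive integers (called parts) whose sum is $n$. For an integer $l\ge 2$, a partition is $l$-regular if none of its parts is divisible by $l$. $b_l(n)$ denotes the number of $l$-regular partitions of $n$, with the convention $b_l(0)=1$; equivalently, $\sum_{n\ge 0} b_l(n)q^n=\prod_{m\ge 1}\frac{1-q^{lm}}{1-q^m}$. For a prime $p$ and a positive integer $N$, $\mathrm{ord}_p(N)$ denotes the exponent of the highest power of $p$ dividing $N$. -}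

module Defs where

open import Data.List using (List; []; _∷_; length; filter; upTo; cartesianProductWith)
open import Data.List.Extrema.Nat using (max; argmax-all; xs≤max)
open import Data.List.Membership.Propositional using (_∈_)
open import Data.List.Membership.Propositional.Properties using (∈-filter⁺; ∈-filter⁻; ∈-upTo⁺; ∈-cartesianProductWith⁺; ∈-cartesianProductWith⁻)
open import Data.List.Properties using (∷-injective)
open import Data.List.Relation.Unary.All as All using (All; []; _∷_)
open import Data.List.Relation.Unary.All.Properties using (all-filter)
open import Data.List.Relation.Unary.AllPairs using ([]; _∷_)
open import Data.List.Relation.Unary.Any using (here; there)
open import Data.List.Relation.Unary.Linked using (Linked; linked?)
open import Data.List.Relation.Unary.Unique.Propositional using (Unique)
import Data.List.Relation.Unary.Unique.Propositional.Properties as Unique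
open import Data.Nat using (ℕ; zero; suc; _+_; _*_; _^_; _≤_; _<_; _≥_; _>_; _≟_; _≥?_; _>?_; z≤n; s≤s; NonZero; >-nonZero)
open import Data.Nat.DivMod using (_%_)
open import Data.Nat.Divisibility using (_∣_; _∣?_; ∣-trans; ∣⇒≤; 1∣_; m∣m*n)
open import Data.Nat.ListAction using (sum)
open import Data.Nat.Primality using (Prime; prime?)
open import Data.Nat.Properties using (≤-trans; m≤m+n; m≤n+m; m<n+m; +-mono-≤; +-identityʳ; *-monoˡ-≤; module ≤-Reasoning)
open import Data.Product using (_×_; _,_; proj₂)
open import Function using (id)
open import Function.Bundles using (_⇔_; mk⇔)
open import Relation.Binary.PropositionalEquality using (_≡_; _≢_; refl; cong; subst)
open import Relation.Nullary using (¬_; contradiction)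
open import Relation.Nullary.Decidable using (_×-dec_; ¬?)
open import Relation.Unary using (Decidable)

record Finite {A : Set} (P : A → Set) : Set where
  field
    elements : List A
    unique   : Unique elements
    complete : ∀ {x} → x ∈ elements ⇔ P x

-- The cardinality of { x | P x }; by uniqueness and completeness it does not
-- depend on the enumeration.
# : {A : Set} (P : A → Set) → Finite P → ℕ
# P fin = length (Finite.elements fin)

finite : {A : Set} {P : A → Set} (P? : Decidable P) (xs : List A) →
         Unique xs → (∀ {x} → P x → x ∈ xs) → Finite P
finite P? xs xs! bound = record
  { elements = filter P? xs
  ; unique   = Unique.filter⁺ P? xs!
  ; complete = mk⇔ (λ x∈ → proj₂ (∈-filter⁻ P? {xs = xs} x∈)) (λ px → ∈-filter⁺ P? (bound px) px)
  }

-- For n ≡ 0 the empty list is the only partition.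
IsPartition : ℕ → List ℕ → Set
IsPartition n xs = Linked _≥_ xs × All (_> 0) xs × sum xs ≡ n

IsRegular : ℕ → List ℕ → Set
IsRegular l xs = All (λ x → ¬ (l ∣ x)) xs

IsRegularPartition : ℕ → ℕ → List ℕ → Set
IsRegularPartition l n xs = IsPartition n xs × IsRegular l xs

isRegularPartition? : ∀ l n → Decidable (IsRegularPartition l n)
isRegularPartition? l n xs =
  (linked? _≥?_ xs ×-dec All.all? (_>? 0) xs ×-dec (sum xs ≟ n))
  ×-dec All.all? (λ x → ¬? (l ∣? x)) xs

-- All lists of length at most k with entries in as.
words : ℕ → List ℕ → List (List ℕ)
words zero    as = [] ∷ []
words (suc k) as = [] ∷ cartesianProductWith _∷_ as (words k as)

words! : ∀ k {as} → Unique as → Unique (words k as)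
words! zero    as! = [] ∷ []
words! (suc k) {as} as! =
  All.tabulate []≢ ∷ Unique.cartesianProductWith⁺ _∷_ ∷-injective as! (words! k as!)
  where
  []≢ : ∀ {ys} → ys ∈ cartesianProductWith _∷_ as (words k as) → [] ≢ ys
  []≢ ys∈ refl with ∈-cartesianProductWith⁻ _∷_ as (words k as) ys∈
  ... | _ , _ , _ , _ , ()

∈-words : ∀ k {as} xs → length xs ≤ k → All (_∈ as) xs → xs ∈ words k as
∈-words zero    []       _         _          = here refl
∈-words (suc k) []       _         _          = here refl
∈-words (suc k) (x ∷ xs) (s≤s len) (x∈ ∷ xs∈) =
  there (∈-cartesianProductWith⁺ _∷_ x∈ (∈-words k xs len xs∈))

length≤sum : ∀ {xs} → All (_> 0) xs → length xs ≤ sum xs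
length≤sum []         = z≤n
length≤sum (x>0 ∷ xs) = +-mono-≤ x>0 (length≤sum xs)

all≤sum : ∀ xs → All (_≤ sum xs) xs
all≤sum []       = []
all≤sum (x ∷ xs) =
  m≤m+n x (sum xs) ∷ All.map (λ y≤ → ≤-trans y≤ (m≤n+m (sum xs) x)) (all≤sum xs)

finite-regularPartitions : ∀ l n → Finite (IsRegularPartition l n)
finite-regularPartitions l n =
  finite (isRegularPartition? l n) (words n (upTo (suc n))) (words! n (Unique.upTo⁺ (suc n))) bound
  where
  bound : ∀ {xs} → IsRegularPartition l n xs → xs ∈ words n (upTo (suc n))
  bound {xs} ((_ , xs>0 , refl) , _) =
    ∈-words n xs (length≤sum xs>0) (All.map (λ x≤ → ∈-upTo⁺ (s≤s x≤)) (all≤sum xs))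

b : ℕ → ℕ → ℕ
b l n = # (IsRegularPartition l n) (finite-regularPartitions l n)

-- The largest k with p ^ k ∣ N, for p ≥ 2 and N ≥ 1; the bound k < N loses
-- nothing because k < p ^ k ≤ N. The other values of p and N are irrelevant.
ord : ℕ → ℕ → ℕ
ord p N = max 0 (filter (λ k → p ^ k ∣? N) (upTo N))

p^ord∣ : ∀ p N → p ^ ord p N ∣ N
p^ord∣ p N = argmax-all id {P = λ k → p ^ k ∣ N} (1∣ N) (all-filter (λ k → p ^ k ∣? N) (upTo N))

n<p^n : ∀ p n → 2 ≤ p → n < p ^ n
n<p^n p zero    _   = s≤s z≤n
n<p^n p (suc n) 2≤p = begin-strict
  suc n         ≤⟨ n<p^n p n 2≤p ⟩
  p ^ n         <⟨ m<n+m (p ^ n) (≤-trans (s≤s z≤n) (n<p^n p n 2≤p)) ⟩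
  p ^ n + p ^ n ≡⟨ cong (p ^ n +_) (+-identityʳ (p ^ n)) ⟨
  2 * p ^ n     ≤⟨ *-monoˡ-≤ (p ^ n) 2≤p ⟩
  p * p ^ n     ∎
  where open ≤-Reasoning

p^k∣⇒k≤ord : ∀ p N .{{_ : NonZero N}} {k} → 2 ≤ p → p ^ k ∣ N → k ≤ ord p N
p^k∣⇒k≤ord p N {k} 2≤p p^k∣N = All.lookup (xs≤max 0 _)
  (∈-filter⁺ (λ k → p ^ k ∣? N) (∈-upTo⁺ (≤-trans (n<p^n p k 2≤p) (∣⇒≤ p^k∣N))) p^k∣N)

ord≢0⇒p∣N : ∀ p N → ord p N ≢ 0 → p ∣ N
ord≢0⇒p∣N p N ord≢0 with ord p N | p^ord∣ p N
... | zero  | _     = contradiction refl ord≢0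
... | suc k | p^k∣N = ∣-trans (m∣m*n (p ^ k)) p^k∣N

-- Since 0 is not in the class s modulo m, these primes all divide N.
finite-primes : ∀ N .{{_ : NonZero N}} r m .{{_ : NonZero m}} s → 0 % m ≢ s →
                Finite (λ p → Prime p × p % 3 ≡ r × ord p N % m ≡ s)
finite-primes N r m s 0≢s =
  finite (λ p → prime? p ×-dec (p % 3 ≟ r) ×-dec (ord p N % m ≟ s))
         (upTo (suc N)) (Unique.upTo⁺ (suc N)) bound
  where
  bound : ∀ {p} → Prime p × p % 3 ≡ r × ord p N % m ≡ s → p ∈ upTo (suc N)
  bound {p} (_ , _ , ord≡s) = ∈-upTo⁺ (s≤s (∣⇒≤ (ord≢0⇒p∣N p N λ ord≡0 →
    0≢s (subst (λ e → e % m ≡ s) ord≡0 ord≡s))))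

3n+1≢0 : ∀ n → NonZero (3 * n + 1)
3n+1≢0 n = >-nonZero (m≤n+m 1 (3 * n))

finite₂ : ∀ n → Finite (λ p → Prime p × p % 3 ≡ 2 × ord p (3 * n + 1) % 2 ≡ 1)
finite₂ n = finite-primes (3 * n + 1) {{3n+1≢0 n}} 2 2 1 (λ ())

finite₁ : ∀ n → Finite (λ p → Prime p × p % 3 ≡ 1 × ord p (3 * n + 1) % 3 ≡ 2)
finite₁ n = finite-primes (3 * n + 1) {{3n+1≢0 n}} 1 3 2 (λ ())

{-# OPTIONS --safe #-}

-- Let P = ∏ (1 - q ^ m), S = ∑ σ(n) q ^ n and ϑ = q d/dq. Modulo 3 the condition on the primes says
-- that σ(3n + 1) vanishes, since σ is multiplicative, so it suffices that b₉(n) ≡ σ(3n + 1), that is,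
-- ϑ S ≡ q B(q³) for B = ∑ b₉(n) q ^ n = P(q⁹) / P. Both sides are multiplied by the unit P³ ≡ P(q³).
-- As P S = - ϑ P, the left-hand side becomes P ((ϑ P)² - P ϑ² P), and the right-hand side becomes
-- q P(q²⁷) ≡ q P(q⁹)³. By Euler's theorem P = ∑ (-1) ^ k q ^ (k (3k - 1) / 2), whose exponents are
-- ≡ k modulo 3, so with P = P₀ + P₁ + P₂ split accordingly, P ((ϑ P)² - P ϑ² P) is congruent to
-- - (P₀² P₁ + P₁² P₂ + P₂² P₀) - (P₀² P₂ + P₁² P₀ + P₂² P₁). These are theta series over triples of
-- integers k; in s = 6k - 1 the exponent is a multiple of |s|² up to a constant, so the reflection
-- s ↦ s - (2/3) (s₁ + s₂ + s₃) (1, 1, 1) acts on the terms. It cancels the terms of the second sum in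
-- pairs and turns the first sum into - q P(q⁹)³.

module Submission where

-- Everything is proved modulo `q ^ (N + 1)` as well as modulo 3, for one `N` at a time. Infinite
-- products and theta series can then be replaced by finite ones over ranges long enough for `N`, no
-- limits occur, and congruence is the equality of a commutative ring, open to the ring solver. The
-- operator ϑ singles out a residue class: it multiplies the coefficient of `q ^ m` by `m`, so
-- modulo 3 it kills the exponents divisible by 3 and leaves those of the form 3n + 1 alone. The
-- series congruence also contains that 3 divides every σ(3n + 2). The reflection has denominator 3,
-- and k₁ + k₂ + k₃ modulo 3 decides what it does to s = 6 k - 1. In the second sum this total is ≡
-- 2 and the reflected entries are again ≡ -1 modulo 6, so terms of one series meet each other. In
-- the first sum it is ≡ 1 and the entries become odd multiples of 3; this leads to another theta
-- series, with exponent 3 u (u - 1) / 2, in which the symmetry u ↦ 1 - u leaves only one of the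
-- three products of classes modulo 3.

-- Formal power series over the integers, and their truncated congruence modulo 3.

module PowerSeries where

  open import Algebra.Bundles using (CommutativeRing)
  open import Algebra.Structures using (IsCommutativeRing)
  import Algebra.Consequences.Setoid as Consequences
  open import Relation.Binary using (IsEquivalence; Setoid)
  open import Data.Integer using (ℤ; +-*-rawRing; +_; 0ℤ; 1ℤ; _+_; _*_; -_; _-_)
  open import Data.Integer.Divisibility.Signed using (_∣_; divides; ∣m∣n⇒∣m+n; ∣n⇒∣m*n; ∣m⇒∣m*n; ∣m⇒∣-m)
  import Data.Integer.Properties as ℤ
  open import Data.Integer.Tactic.RingSolver using (solve-∀)
  open import Data.Nat as ℕ using (ℕ; zero; suc; z≤n; s≤s)
  import Data.Nat.Properties as ℕ
  open import Function using (_∘_; _∘′_)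
  open import Relation.Binary.PropositionalEquality
  import Relation.Binary.Reasoning.Setoid as SetoidReasoning
  open import Relation.Nullary using (yes; no; contradiction)

  Series : Set
  Series = ℕ → ℤ

  infixl 6 _⊕_
  infixl 7 _⊛_
  infix  8 ⊝_

  -- Opaque, as unification would otherwise unfold sums of series pointwise.
  opaque

    _⊕_ : Series → Series → Series
    (f ⊕ g) n = f n + g n

    ⊝_ : Series → Series
    (⊝ f) n = - f n

    ⊕-coeff : ∀ f g n → (f ⊕ g) n ≡ f n + g n
    ⊕-coeff f g n = refl

    ⊝-coeff : ∀ f n → (⊝ f) n ≡ - f n
    ⊝-coeff f n = refl

  -- The Cauchy product through `f = f 0 + q f⁺`: peeling off the constant term of the left factor
  -- lets the ring laws be proved by induction on the index, without finite sums.
  _⊛_ : Series → Series → Series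
  (f ⊛ g) zero    = f 0 * g 0
  (f ⊛ g) (suc n) = f 0 * g (suc n) + ((f ∘′ suc) ⊛ g) n

  const : ℤ → Series
  const c zero    = c
  const c (suc _) = 0ℤ

  const-0 : ∀ n → const 0ℤ n ≡ 0ℤ
  const-0 zero    = refl
  const-0 (suc n) = refl

  mono : ℕ → Series
  mono zero            = const 1ℤ
  mono (suc m) zero    = 0ℤ
  mono (suc m) (suc n) = mono m n

  ϑ : Series → Series
  ϑ f n = + n * f n

  ⊛-cong-≗ : ∀ {f f′ g g′} → f ≗ f′ → g ≗ g′ → f ⊛ g ≗ f′ ⊛ g′
  ⊛-cong-≗ p q zero    = cong₂ _*_ (p 0) (q 0)
  ⊛-cong-≗ p q (suc n) = cong₂ _+_ (cong₂ _*_ (p 0) (q (suc n))) (⊛-cong-≗ (p ∘ suc) q n)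

  ⊛-distribʳ-≗ : ∀ h f g → (λ i → f i + g i) ⊛ h ≗ (λ i → (f ⊛ h) i + (g ⊛ h) i)
  ⊛-distribʳ-≗ h f g zero    = ℤ.*-distribʳ-+ (h 0) (f 0) (g 0)
  ⊛-distribʳ-≗ h f g (suc n)
    rewrite ⊛-distribʳ-≗ h (f ∘ suc) (g ∘ suc) n =
    lemma (f 0) (g 0) (h (suc n)) (((f ∘ suc) ⊛ h) n) (((g ∘ suc) ⊛ h) n)
    where
    lemma : ∀ a b c x y → (a + b) * c + (x + y) ≡ a * c + x + (b * c + y)
    lemma = solve-∀

  ⊛-scale-≗ : ∀ c f g → (λ n → c * f n) ⊛ g ≗ (λ n → c * (f ⊛ g) n)
  ⊛-scale-≗ c f g zero    = ℤ.*-assoc c (f 0) (g 0)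
  ⊛-scale-≗ c f g (suc n) rewrite ⊛-scale-≗ c (f ∘ suc) g n =
    lemma c (f 0) (g (suc n)) (((f ∘ suc) ⊛ g) n)
    where
    lemma : ∀ c a b x → c * a * b + c * x ≡ c * (a * b + x)
    lemma = solve-∀

  -- The mirror image of the defining recursion, splitting the convolution at its other end;
  -- commutativity follows by playing the two against each other.
  ⊛-last : ∀ f g n → (f ⊛ g) (suc n) ≡ (f ⊛ (g ∘ suc)) n + f (suc n) * g 0
  ⊛-last f g zero    = refl
  ⊛-last f g (suc n) rewrite ⊛-last (f ∘ suc) g n = sym (ℤ.+-assoc (f 0 * g (2 ℕ.+ n)) _ _)

  ⊛-comm-≗ : ∀ f g → f ⊛ g ≗ g ⊛ f
  ⊛-comm-≗ f g zero    = ℤ.*-comm (f 0) (g 0)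
  ⊛-comm-≗ f g (suc n) rewrite ⊛-last g f n | ⊛-comm-≗ (f ∘ suc) g n =
    lemma (f 0) (g (suc n)) ((g ⊛ (f ∘ suc)) n)
    where
    lemma : ∀ a b x → a * b + x ≡ x + b * a
    lemma = solve-∀

  ⊛-assoc-≗ : ∀ f g h → (f ⊛ g) ⊛ h ≗ f ⊛ (g ⊛ h)
  ⊛-assoc-≗ f g h zero    = ℤ.*-assoc (f 0) (g 0) (h 0)
  ⊛-assoc-≗ f g h (suc n)
    rewrite ⊛-distribʳ-≗ h (λ i → f 0 * g (suc i)) ((f ∘ suc) ⊛ g) n
          | ⊛-scale-≗ (f 0) (g ∘ suc) h n
          | ⊛-assoc-≗ (f ∘ suc) g h n =
    lemma (f 0) (g 0) (h (suc n)) (((g ∘ suc) ⊛ h) n) (((f ∘ suc) ⊛ (g ⊛ h)) n)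
    where
    lemma : ∀ a b c x y → a * b * c + (a * x + y) ≡ a * (b * c + x) + y
    lemma = solve-∀

  ⊛-zeroˡ-≗ : ∀ f → (λ _ → 0ℤ) ⊛ f ≗ (λ _ → 0ℤ)
  ⊛-zeroˡ-≗ f zero    = refl
  ⊛-zeroˡ-≗ f (suc n) rewrite ⊛-zeroˡ-≗ f n = refl

  const-⊛ : ∀ c f n → (const c ⊛ f) n ≡ c * f n
  const-⊛ c f zero    = refl
  const-⊛ c f (suc n) rewrite ⊛-zeroˡ-≗ f n = ℤ.+-identityʳ _

  mono-⊛-mono : ∀ a b → mono a ⊛ mono b ≗ mono (a ℕ.+ b)
  mono-⊛-mono zero    b n       = trans (const-⊛ 1ℤ (mono b) n) (ℤ.*-identityˡ _)
  mono-⊛-mono (suc a) b zero    = refl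
  mono-⊛-mono (suc a) b (suc n) = trans (ℤ.+-identityˡ _) (mono-⊛-mono a b n)

  mono-≡ : ∀ n → mono n n ≡ 1ℤ
  mono-≡ zero    = refl
  mono-≡ (suc n) = mono-≡ n

  mono-≢ : ∀ {m n} → m ≢ n → mono m n ≡ 0ℤ
  mono-≢ {zero}  {zero}  m≢n = contradiction refl m≢n
  mono-≢ {zero}  {suc n} m≢n = refl
  mono-≢ {suc m} {zero}  m≢n = refl
  mono-≢ {suc m} {suc n} m≢n = mono-≢ (m≢n ∘ cong suc)

  -- Shifting does not commute with `ϑ`: `ϑ f ∘ suc` is `f⁺ + ϑ f⁺`, and the extra `f⁺` accounts for
  -- the lone `X` in the induction.
  ϑ-⊛ : ∀ f g → ϑ (f ⊛ g) ≗ (λ i → (ϑ f ⊛ g) i + (f ⊛ ϑ g) i)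
  ϑ-⊛ f g zero    = lemma (f 0) (g 0)
    where
    lemma : ∀ a b → 0ℤ * (a * b) ≡ 0ℤ * a * b + a * (0ℤ * b)
    lemma = solve-∀
  ϑ-⊛ f g (suc n) = begin
    + suc n * (f 0 * g (suc n) + X)                  ≡⟨ lemma (+ n) (f 0) (g (suc n)) X ⟩
    f 0 * (+ suc n * g (suc n)) + (X + + n * X)      ≡⟨ cong (λ z → f 0 * (+ suc n * g (suc n)) + (X + z)) (ϑ-⊛ f⁺ g n) ⟩
    f 0 * (+ suc n * g (suc n)) + (X + (Y + Z))      ≡⟨ lemma′ (f 0) (f 0 * (+ suc n * g (suc n))) X Y Z (g (suc n)) ⟩
    0ℤ * f 0 * g (suc n) + (X + Y) + (f 0 * (+ suc n * g (suc n)) + Z)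
      ≡⟨ cong (λ z → 0ℤ * f 0 * g (suc n) + z + (f 0 * (+ suc n * g (suc n)) + Z)) (sym (trans
           (⊛-cong-≗ (λ i → ℤ.suc-* (+ i) (f⁺ i)) (λ _ → refl) n) (⊛-distribʳ-≗ g f⁺ (ϑ f⁺) n))) ⟩
    0ℤ * f 0 * g (suc n) + ((ϑ f ∘ suc) ⊛ g) n + (f 0 * (+ suc n * g (suc n)) + Z) ∎
    where
    open ≡-Reasoning
    f⁺ = f ∘′ suc
    X = (f⁺ ⊛ g) n
    Y = (ϑ f⁺ ⊛ g) n
    Z = (f⁺ ⊛ ϑ g) n
    lemma : ∀ k a b x → (1ℤ + k) * (a * b + x) ≡ a * ((1ℤ + k) * b) + (x + k * x)
    lemma = solve-∀
    lemma′ : ∀ a b x y z c → b + (x + (y + z)) ≡ 0ℤ * a * c + (x + y) + (b + z)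
    lemma′ = solve-∀

  ϑ-mono : ∀ m n → ϑ (mono m) n ≡ + m * mono m n
  ϑ-mono m n with m ℕ.≟ n
  ... | yes refl = refl
  ... | no m≢n rewrite mono-≢ m≢n = trans (ℤ.*-zeroʳ (+ n)) (sym (ℤ.*-zeroʳ (+ m)))

  opaque
    unfolding _⊕_

    ⊕-assoc-≗ : ∀ f g h → (f ⊕ g) ⊕ h ≗ f ⊕ (g ⊕ h)
    ⊕-assoc-≗ f g h i = ℤ.+-assoc (f i) (g i) (h i)

    ⊕-comm-≗ : ∀ f g → f ⊕ g ≗ g ⊕ f
    ⊕-comm-≗ f g i = ℤ.+-comm (f i) (g i)

    ⊕-identityˡ-≗ : ∀ f → const 0ℤ ⊕ f ≗ f
    ⊕-identityˡ-≗ f zero    = ℤ.+-identityˡ (f 0)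
    ⊕-identityˡ-≗ f (suc i) = ℤ.+-identityˡ (f (suc i))

    ⊝-inverseˡ-≗ : ∀ f → ⊝ f ⊕ f ≗ const 0ℤ
    ⊝-inverseˡ-≗ f zero    = ℤ.+-inverseˡ (f 0)
    ⊝-inverseˡ-≗ f (suc i) = ℤ.+-inverseˡ (f (suc i))

    ⊛-distribʳ-⊕-≗ : ∀ h f g → (f ⊕ g) ⊛ h ≗ f ⊛ h ⊕ g ⊛ h
    ⊛-distribʳ-⊕-≗ = ⊛-distribʳ-≗

    ϑ-⊛-⊕ : ∀ f g → ϑ (f ⊛ g) ≗ ϑ f ⊛ g ⊕ f ⊛ ϑ g
    ϑ-⊛-⊕ = ϑ-⊛

    const-+-≗ : ∀ a b → const (a + b) ≗ const a ⊕ const b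
    const-+-≗ a b zero    = refl
    const-+-≗ a b (suc i) = refl

    const-neg-≗ : ∀ a → const (- a) ≗ ⊝ const a
    const-neg-≗ a zero    = refl
    const-neg-≗ a (suc i) = refl

  infix 4 _≡₃_

  _≡₃_ : ℤ → ℤ → Set
  a ≡₃ b = + 3 ∣ a - b

  ≡₃-reflexive : ∀ {a b} → a ≡ b → a ≡₃ b
  ≡₃-reflexive {a} refl = divides 0ℤ (ℤ.+-inverseʳ a)

  ≡₃-sym : ∀ {a b} → a ≡₃ b → b ≡₃ a
  ≡₃-sym {a} {b} p = subst (+ 3 ∣_) (lemma a b) (∣m⇒∣-m p)
    where
    lemma : ∀ a b → - (a - b) ≡ b - a
    lemma = solve-∀

  ≡₃-trans : ∀ {a b c} → a ≡₃ b → b ≡₃ c → a ≡₃ c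
  ≡₃-trans {a} {b} {c} p q = subst (+ 3 ∣_) (lemma a b c) (∣m∣n⇒∣m+n p q)
    where
    lemma : ∀ a b c → (a - b) + (b - c) ≡ a - c
    lemma = solve-∀

  +-cong₃ : ∀ {a b c d} → a ≡₃ b → c ≡₃ d → a + c ≡₃ b + d
  +-cong₃ {a} {b} {c} {d} p q = subst (+ 3 ∣_) (lemma a b c d) (∣m∣n⇒∣m+n p q)
    where
    lemma : ∀ a b c d → (a - b) + (c - d) ≡ (a + c) - (b + d)
    lemma = solve-∀

  neg-cong₃ : ∀ {a b} → a ≡₃ b → - a ≡₃ - b
  neg-cong₃ {a} {b} p = subst (+ 3 ∣_) (lemma a b) (∣m⇒∣-m p)
    where
    lemma : ∀ a b → - (a - b) ≡ - a - - b
    lemma = solve-∀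

  *-cong₃ : ∀ {a b c d} → a ≡₃ b → c ≡₃ d → a * c ≡₃ b * d
  *-cong₃ {a} {b} {c} {d} p q =
    subst (+ 3 ∣_) (lemma a b c d) (∣m∣n⇒∣m+n (∣m⇒∣m*n c p) (∣n⇒∣m*n b q))
    where
    lemma : ∀ a b c d → (a - b) * c + b * (c - d) ≡ a * c - b * d
    lemma = solve-∀

  module Truncated (N : ℕ) where

    infix 4 _≈_

    -- Congruence modulo 3 and q ^ (N + 1).
    record _≈_ (f g : Series) : Set where
      constructor coefficients
      field at : ∀ {i} → i ℕ.≤ N → f i ≡₃ g i
    open _≈_ public

    from-≗ : ∀ {f g} → f ≗ g → f ≈ g
    from-≗ p = coefficients λ {i} _ → ≡₃-reflexive (p i)

    -- The coefficient of a product at `i` involves only coefficients of the factors at indices up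
    -- to `i`, so cutting off above `N` respects products.
    ⊛-cong : ∀ {f f′ g g′} → f ≈ f′ → g ≈ g′ → f ⊛ g ≈ f′ ⊛ g′
    ⊛-cong {g = g} {g′} (coefficients p) (coefficients q) = coefficients λ {i} i≤ → go i (λ j≤ → p (ℕ.≤-trans j≤ i≤)) (λ j≤ → q (ℕ.≤-trans j≤ i≤))
      where
      go : ∀ i {f f′} → (∀ {j} → j ℕ.≤ i → f j ≡₃ f′ j) → (∀ {j} → j ℕ.≤ i → g j ≡₃ g′ j) → (f ⊛ g) i ≡₃ (f′ ⊛ g′) i
      go zero    {f} {f′} p q = *-cong₃ {f 0} (p z≤n) (q z≤n)
      go (suc i) {f} {f′} p q = +-cong₃ {f 0 * g (suc i)} (*-cong₃ {f 0} (p z≤n) (q ℕ.≤-refl)) (go i (p ∘ s≤s) (q ∘ ℕ.m≤n⇒m≤1+n))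

    ⊕-cong : ∀ {f f′ g g′} → f ≈ f′ → g ≈ g′ → f ⊕ g ≈ f′ ⊕ g′
    ⊕-cong {f} {f′} {g} {g′} (coefficients p) (coefficients q) = coefficients λ {i} i≤ →
      subst₂ _≡₃_ (sym (⊕-coeff f g i)) (sym (⊕-coeff f′ g′ i)) (+-cong₃ {f i} {f′ i} {g i} {g′ i} (p i≤) (q i≤))

    ⊝-cong : ∀ {f f′} → f ≈ f′ → ⊝ f ≈ ⊝ f′
    ⊝-cong {f} {f′} (coefficients p) = coefficients λ {i} i≤ →
      subst₂ _≡₃_ (sym (⊝-coeff f i)) (sym (⊝-coeff f′ i)) (neg-cong₃ {f i} {f′ i} (p i≤))

    ≈-isEquivalence : IsEquivalence _≈_
    ≈-isEquivalence = record
      { refl  = λ {f} → from-≗ λ _ → refl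
      ; sym   = λ {f} {g} p → coefficients λ {i} i≤ → ≡₃-sym {f i} {g i} (at p i≤)
      ; trans = λ {f} {g} {h} p q → coefficients λ {i} i≤ → ≡₃-trans {f i} {g i} {h i} (at p i≤) (at q i≤)
      }

    ≈-setoid : Setoid _ _
    ≈-setoid = record { isEquivalence = ≈-isEquivalence }

    isCommutativeRing : IsCommutativeRing _≈_ _⊕_ _⊛_ ⊝_ (const 0ℤ) (const 1ℤ)
    isCommutativeRing = record
      { isRing = record
        { +-isAbelianGroup = record
          { isGroup = record
            { isMonoid = record
              { isSemigroup = record
                { isMagma = record { isEquivalence = ≈-isEquivalence ; ∙-cong = ⊕-cong }
                ; assoc = λ f g h → from-≗ (⊕-assoc-≗ f g h)
                }
              ; identity = comm∧idˡ⇒id ⊕-comm (λ f → from-≗ (⊕-identityˡ-≗ f))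
              }
            ; inverse = comm∧invˡ⇒inv ⊕-comm (λ f → from-≗ (⊝-inverseˡ-≗ f))
            ; ⁻¹-cong = ⊝-cong
            }
          ; comm = ⊕-comm
          }
        ; *-cong = ⊛-cong
        ; *-assoc = λ f g h → from-≗ (⊛-assoc-≗ f g h)
        ; *-identity = comm∧idˡ⇒id ⊛-comm (λ f → from-≗ λ i → trans (const-⊛ 1ℤ f i) (ℤ.*-identityˡ (f i)))
        ; distrib = comm∧distrʳ⇒distr ⊕-cong ⊛-comm (λ h f g → from-≗ (⊛-distribʳ-⊕-≗ h f g))
        }
      ; *-comm = ⊛-comm
      }
      where
      ⊕-comm : ∀ f g → f ⊕ g ≈ g ⊕ f
      ⊕-comm f g = from-≗ (⊕-comm-≗ f g)
      ⊛-comm : ∀ f g → f ⊛ g ≈ g ⊛ f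
      ⊛-comm f g = from-≗ (⊛-comm-≗ f g)
      open Consequences ≈-setoid

    commutativeRing : CommutativeRing _ _
    commutativeRing = record { isCommutativeRing = isCommutativeRing }

    module ≈-Reasoning = SetoidReasoning ≈-setoid

    open CommutativeRing commutativeRing public
      using ()
      renaming (zeroˡ to ⊛-zeroˡ; zeroʳ to ⊛-zeroʳ; +-identityʳ to ⊕-identityʳ; *-identityˡ to ⊛-identityˡ; *-identityʳ to ⊛-identityʳ; refl to ≈-refl; sym to ≈-sym; trans to ≈-trans; reflexive to ≈-reflexive)

    open import Algebra.Solver.Ring.AlmostCommutativeRing using (fromCommutativeRing; _-Raw-AlmostCommutative⟶_)

    const-homomorphism : +-*-rawRing -Raw-AlmostCommutative⟶ fromCommutativeRing commutativeRing
    const-homomorphism = record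
      { ⟦_⟧    = const
      ; +-homo = λ a b → from-≗ (const-+-≗ a b)
      ; *-homo = λ a b → from-≗ λ i → sym (trans (const-⊛ a (const b) i) (c*const a b i))
      ; -‿homo = λ a → from-≗ (const-neg-≗ a)
      ; 0-homo = ≈-refl
      ; 1-homo = ≈-refl
      }
      where
      c*const : ∀ a b i → a * const b i ≡ const (a * b) i
      c*const a b zero    = refl
      c*const a b (suc i) = ℤ.*-zeroʳ a

    open import Data.Maybe using (Maybe; just; nothing)

    -- Compares the integers themselves and not their residues. The solver therefore never reduces
    -- modulo 3, and each use of characteristic 3 appears as an explicit multiple of `const (+ 3)`.
    coeff≟ : ∀ a b → Maybe (const a ≈ const b)
    coeff≟ a b with a ℤ.≟ b
    ... | yes refl = just ≈-refl
    ... | no  _    = nothing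

    open import Algebra.Solver.Ring +-*-rawRing (fromCommutativeRing commutativeRing) const-homomorphism coeff≟ public
      using (solve; _:=_; _:+_; _:*_; :-_; _:-_; con)

-- Euler's pentagonal number theorem for finite products.

module PentagonalNumbers where

  open import Data.Integer using (ℤ; +_; -[1+_]; 0ℤ; 1ℤ; ∣_∣)
  import Data.Integer as ℤ
  import Data.Integer.Properties as ℤ
  open import Data.List using (List; []; _∷_)
  open import Data.Nat
  open import Data.Sum using (inj₁; inj₂)
  open import Data.Nat.Properties
  open import Data.Nat.Tactic.RingSolver using (solve-∀)
  open import Relation.Binary.PropositionalEquality
  open import Relation.Nullary using (yes; no; contradiction)
  open PowerSeries using (Series; _⊕_; _⊛_; ⊝_; const; mono; mono-⊛-mono; mono-≢; const-0; const-neg-≗; ≡₃-reflexive; module Truncated)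

  sg : ℕ → ℤ
  sg zero    = 1ℤ
  sg (suc n) = ℤ.- sg n

  tri : ℕ → ℕ
  tri zero    = 0
  tri (suc n) = tri n + suc n

  -- The pentagonal numbers k (3 k - 1) / 2 for k ∈ ℤ.
  pent : ℤ → ℕ
  pent (+ zero)  = 0
  pent (+ suc n) = suc n * n + tri (suc n)
  pent -[1+ n ]  = suc n * suc n + tri (suc n)

  box : ℕ → List ℤ
  box zero    = + 0 ∷ []
  box (suc n) = + suc n ∷ -[1+ n ] ∷ box n

  sumOver : {A : Set} → List A → (A → Series) → Series
  sumOver []       F = const 0ℤ
  sumOver (x ∷ xs) F = F x ⊕ sumOver xs F

  signed : ℤ → ℕ → Series
  signed k m = const (sg ∣ k ∣) ⊛ mono m

  -- (1 - x) ⋯ (1 - x ^ K) for x = q ^ r.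
  eulerProduct : ℕ → ℕ → Series
  eulerProduct r zero    = const 1ℤ
  eulerProduct r (suc K) = eulerProduct r K ⊛ (const 1ℤ ⊕ ⊝ mono (r * suc K))

  module _ (N : ℕ) where

    open Truncated N

    mono-⊛-high : ∀ {m} f → N < m → mono m ⊛ f ≈ const 0ℤ
    mono-⊛-high {m} f N<m = ≈-trans (⊛-cong {mono m} {const 0ℤ} vanish ≈-refl) (⊛-zeroˡ f)
      where
      vanish : mono m ≈ const 0ℤ
      vanish = record { at = λ {i} i≤N → ≡₃-reflexive (trans (mono-≢ λ m≡i → <⇒≢ (≤-<-trans i≤N N<m) (sym m≡i)) (sym (const-0 i))) }

  -- Shanks' finite form of Euler's pentagonal number theorem: the sum of c s n over s ≤ n is a partial sum
  -- of Euler's series, because c s (n + 1) - c s n telescopes, and c 0 n is the only term that is not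
  -- divisible by x ^ (n + 1). Here x = q ^ r.
  module Shanks (N r : ℕ) .{{_ : NonZero r}} where

    open Truncated N
    open ≈-Reasoning

    e : ℕ → Series
    e m = mono (r * m)

    e-+ : ∀ a b → e (a + b) ≈ e a ⊛ e b
    e-+ a b = from-≗ λ i → sym (trans (mono-⊛-mono (r * a) (r * b) i) (cong (λ m → mono m i) (sym (*-distribˡ-+ r a b))))

    -- (1 - x ^ (s + 1)) ⋯ (1 - x ^ n), and 1 for n ≤ s.
    A : ℕ → ℕ → Series
    A s zero    = const 1ℤ
    A s (suc n) with s ≤? n
    ... | yes _ = A s n ⊛ (const 1ℤ ⊕ ⊝ e (suc n))
    ... | no  _ = A s n

    A-suc : ∀ {s n} → s ≤ n → A s (suc n) ≈ A s n ⊛ (const 1ℤ ⊕ ⊝ e (suc n))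
    A-suc {s} {n} s≤n with s ≤? n
    ... | yes _   = ≈-refl
    ... | no  s≰n = contradiction s≤n s≰n

    A-one : ∀ {s n} → n ≤ s → A s n ≈ const 1ℤ
    A-one {s} {zero}  _ = ≈-refl
    A-one {s} {suc n} n<s with s ≤? n
    ... | yes s≤n = contradiction s≤n (<⇒≱ n<s)
    ... | no  _   = A-one (<⇒≤ n<s)

    A-first : ∀ {s} n → suc s ≤ n → A s n ≈ (const 1ℤ ⊕ ⊝ e (suc s)) ⊛ A (suc s) n
    A-first {s} (suc n) (s≤s s≤n) with m≤n⇒m<n∨m≡n s≤n
    ... | inj₂ refl = begin
      A s (suc s)                              ≈⟨ A-suc ≤-refl ⟩
      A s s ⊛ (const 1ℤ ⊕ ⊝ e (suc s))         ≈⟨ ⊛-cong (A-one {s} {s} ≤-refl) ≈-refl ⟩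
      const 1ℤ ⊛ (const 1ℤ ⊕ ⊝ e (suc s))      ≈⟨ solve 1 (λ x → con 1ℤ :* (con 1ℤ :- x) := (con 1ℤ :- x) :* con 1ℤ) ≈-refl (e (suc s)) ⟩
      (const 1ℤ ⊕ ⊝ e (suc s)) ⊛ const 1ℤ      ≈⟨ ⊛-cong ≈-refl (≈-sym (A-one {suc s} {suc s} ≤-refl)) ⟩
      (const 1ℤ ⊕ ⊝ e (suc s)) ⊛ A (suc s) (suc s) ∎
    ... | inj₁ s<n = begin
      A s (suc n)                                      ≈⟨ A-suc s≤n ⟩
      A s n ⊛ (const 1ℤ ⊕ ⊝ e (suc n))                 ≈⟨ ⊛-cong (A-first n s<n) ≈-refl ⟩
      (const 1ℤ ⊕ ⊝ e (suc s)) ⊛ A (suc s) n ⊛ (const 1ℤ ⊕ ⊝ e (suc n))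
        ≈⟨ solve 3 (λ x a y → x :* a :* y := x :* (a :* y)) ≈-refl _ _ _ ⟩
      (const 1ℤ ⊕ ⊝ e (suc s)) ⊛ (A (suc s) n ⊛ (const 1ℤ ⊕ ⊝ e (suc n))) ≈⟨ ⊛-cong ≈-refl (≈-sym (A-suc s<n)) ⟩
      (const 1ℤ ⊕ ⊝ e (suc s)) ⊛ A (suc s) (suc n)     ∎

    sign : ℕ → Series
    sign s = const (sg s)

    -- The summands and the boundary terms of their telescoping. `D s n` has the monomial of `c s n`
    -- but the product `A (s - 1) n`, which amounts to one further factor `1 - x ^ s`; at `s = 0`
    -- this factor is zero, hence `const 0ℤ`.
    c D : ℕ → ℕ → Series
    c s n       = sign s ⊛ e (s * n + tri s) ⊛ A s n
    D zero    n = const 0ℤ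
    D (suc s) n = sign (suc s) ⊛ e (suc s * n + tri (suc s)) ⊛ A s n

    sign-suc : ∀ s → sign (suc s) ≈ ⊝ sign s
    sign-suc s = from-≗ (const-neg-≗ (sg s))

    D-suc : ∀ s n → D (suc s) n ≈ ⊝ (sign s ⊛ (e (s * n + tri s) ⊛ e s ⊛ e (suc n)) ⊛ A s n)
    D-suc s n = begin
      sign (suc s) ⊛ e (suc s * n + tri (suc s)) ⊛ A s n
        ≈⟨ ⊛-cong (⊛-cong (sign-suc s) (≈-reflexive (cong e (lemma s n (tri s))))) ≈-refl ⟩
      ⊝ sign s ⊛ e (s * n + tri s + s + suc n) ⊛ A s n
        ≈⟨ ⊛-cong (⊛-cong ≈-refl (≈-trans (e-+ _ (suc n)) (⊛-cong (e-+ _ s) ≈-refl))) ≈-refl ⟩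
      ⊝ sign s ⊛ (e (s * n + tri s) ⊛ e s ⊛ e (suc n)) ⊛ A s n
        ≈⟨ solve 5 (λ g x y z a → :- g :* (x :* y :* z) :* a := :- (g :* (x :* y :* z) :* a)) ≈-refl _ _ _ _ _ ⟩
      ⊝ (sign s ⊛ (e (s * n + tri s) ⊛ e s ⊛ e (suc n)) ⊛ A s n) ∎
      where
      lemma : ∀ s n t → suc s * n + (t + suc s) ≡ s * n + t + s + suc n
      lemma = solve-∀

    D-pred : ∀ {s n} → s ≤ n → D s n ≈ sign s ⊛ e (s * n + tri s) ⊛ ((const 1ℤ ⊕ ⊝ e s) ⊛ A s n)
    D-pred {zero}  {n} _   = begin
      const 0ℤ ≈⟨ solve 2 (λ g a → con 0ℤ := g :* ((con 1ℤ :- con 1ℤ) :* a)) ≈-refl (sign 0 ⊛ e 0) (A 0 n) ⟩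
      sign 0 ⊛ e 0 ⊛ ((const 1ℤ ⊕ ⊝ const 1ℤ) ⊛ A 0 n)
        ≈⟨ ⊛-cong ≈-refl (⊛-cong (⊕-cong ≈-refl (⊝-cong (≈-reflexive (cong mono (sym (*-zeroʳ r)))))) ≈-refl) ⟩
      sign 0 ⊛ e 0 ⊛ ((const 1ℤ ⊕ ⊝ e 0) ⊛ A 0 n) ∎
    D-pred {suc s} {n} s<n = ⊛-cong ≈-refl (A-first n s<n)

    -- With `y = x ^ s` and `z = x ^ (n + 1)`, passing from `n` to `n + 1` multiplies `c s n` by
    -- `y (1 - z) = 1 - (1 - y) - y z`. The part `1 - y` is `D s n` by `D-pred`, and the part
    -- `- y z` is `D (suc s) n` by `D-suc`.
    c-suc : ∀ {s n} → s ≤ n → c s (suc n) ≈ c s n ⊕ ⊝ D s n ⊕ D (suc s) n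
    c-suc {s} {n} s≤n = begin
      sign s ⊛ e (s * suc n + tri s) ⊛ A s (suc n)
        ≈⟨ ⊛-cong (⊛-cong ≈-refl (≈-trans (≈-reflexive (cong e (lemma s n (tri s)))) (e-+ _ s))) (A-suc s≤n) ⟩
      sign s ⊛ (e (s * n + tri s) ⊛ e s) ⊛ (A s n ⊛ (const 1ℤ ⊕ ⊝ e (suc n)))
        ≈⟨ solve 5 (λ g x y z a → g :* (x :* y) :* (a :* (con 1ℤ :- z)) :=
              g :* x :* a :+ :- (g :* x :* ((con 1ℤ :- y) :* a)) :+ :- (g :* (x :* y :* z) :* a)) ≈-refl _ _ _ _ _ ⟩
      c s n ⊕ ⊝ (sign s ⊛ e (s * n + tri s) ⊛ ((const 1ℤ ⊕ ⊝ e s) ⊛ A s n)) ⊕ ⊝ (sign s ⊛ (e (s * n + tri s) ⊛ e s ⊛ e (suc n)) ⊛ A s n)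
        ≈⟨ ⊕-cong (⊕-cong ≈-refl (⊝-cong (≈-sym (D-pred s≤n)))) (≈-sym (D-suc s n)) ⟩
      c s n ⊕ ⊝ D s n ⊕ D (suc s) n ∎
      where
      lemma : ∀ s n t → s * suc n + t ≡ s * n + t + s
      lemma = solve-∀

    sumTo : (ℕ → Series) → ℕ → Series
    sumTo F zero    = F 0
    sumTo F (suc n) = sumTo F n ⊕ F (suc n)

    sumTo-c-suc : ∀ {k n} → k ≤ n → sumTo (λ s → c s (suc n)) k ≈ sumTo (λ s → c s n) k ⊕ D (suc k) n
    sumTo-c-suc {zero}  {n} k≤n = ≈-trans (c-suc {0} {n} z≤n) (solve 2 (λ x d → x :+ :- con 0ℤ :+ d := x :+ d) ≈-refl _ _)
    sumTo-c-suc {suc k} {n} k<n = begin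
      sumTo (λ s → c s (suc n)) k ⊕ c (suc k) (suc n)
        ≈⟨ ⊕-cong (sumTo-c-suc (<⇒≤ k<n)) (c-suc k<n) ⟩
      sumTo (λ s → c s n) k ⊕ D (suc k) n ⊕ (c (suc k) n ⊕ ⊝ D (suc k) n ⊕ D (2 + k) n)
        ≈⟨ solve 4 (λ x d y d′ → x :+ d :+ (y :+ :- d :+ d′) := x :+ y :+ d′) ≈-refl _ _ _ _ ⟩
      sumTo (λ s → c s n) k ⊕ c (suc k) n ⊕ D (2 + k) n ∎

    -- From `n` to `n + 1` the sum gains the boundary term `D (suc n) n` and the new summand
    -- `c (suc n) (suc n)`. Their products `A` are empty, and their exponents are the pentagonal
    -- numbers of `n + 1` and of `- (n + 1)`.
    shanks : ∀ n → sumTo (λ s → c s n) n ≈ sumOver (box n) (λ k → signed k (r * pent k))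
    shanks zero    = solve 2 (λ g x → g :* x :* con 1ℤ := g :* x :+ con 0ℤ) ≈-refl _ _
    shanks (suc n) = begin
      sumTo (λ s → c s (suc n)) n ⊕ c (suc n) (suc n)
        ≈⟨ ⊕-cong (sumTo-c-suc {n} {n} ≤-refl) (⊛-cong ≈-refl (A-one {suc n} {suc n} ≤-refl)) ⟩
      sumTo (λ s → c s n) n ⊕ sign (suc n) ⊛ e (suc n * n + tri (suc n)) ⊛ A n n ⊕ sign (suc n) ⊛ e (suc n * suc n + tri (suc n)) ⊛ const 1ℤ
        ≈⟨ ⊕-cong (⊕-cong (shanks n) (⊛-cong ≈-refl (A-one {n} {n} ≤-refl))) ≈-refl ⟩
      sumOver (box n) (λ k → signed k (r * pent k)) ⊕ sign (suc n) ⊛ e (suc n * n + tri (suc n)) ⊛ const 1ℤ ⊕ sign (suc n) ⊛ e (suc n * suc n + tri (suc n)) ⊛ const 1ℤ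
        ≈⟨ solve 3 (λ s x y → s :+ x :* con 1ℤ :+ y :* con 1ℤ := x :+ (y :+ s)) ≈-refl _ _ _ ⟩
      sumOver (box (suc n)) (λ k → signed k (r * pent k)) ∎

    A-zero : ∀ n → A 0 n ≈ eulerProduct r n
    A-zero zero    = ≈-refl
    A-zero (suc n) = ≈-trans (A-suc {0} {n} z≤n) (⊛-cong (A-zero n) ≈-refl)

    c-suc-≈0 : ∀ s {n} → N ≤ n → c (suc s) n ≈ const 0ℤ
    c-suc-≈0 s {n} N≤n = begin
      sign (suc s) ⊛ e (suc s * n + tri (suc s)) ⊛ A (suc s) n
        ≈⟨ solve 3 (λ g x a → g :* x :* a := x :* (g :* a)) ≈-refl _ _ _ ⟩
      e (suc s * n + tri (suc s)) ⊛ (sign (suc s) ⊛ A (suc s) n)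
        ≈⟨ mono-⊛-high N _ (begin-strict
             N                                 ≤⟨ N≤n ⟩
             n                                 ≤⟨ m≤m+n n (s * n) ⟩
             suc s * n                         <⟨ m<m+n (suc s * n) (subst (0 <_) (sym (+-suc (tri s) s)) z<s) ⟩
             suc s * n + tri (suc s)           ≤⟨ m≤n*m _ r ⟩
             r * (suc s * n + tri (suc s))     ∎′) ⟩
      const 0ℤ ∎
      where open ≤-Reasoning using (begin-strict_; step-<; step-≤) renaming (_∎ to _∎′)

    pentagonal : ∀ {n} → N ≤ n → eulerProduct r n ≈ sumOver (box n) (λ k → signed k (r * pent k))
    pentagonal {n} N≤n = begin
      eulerProduct r n                              ≈⟨ ≈-sym (tail n) ⟩
      sumTo (λ s → c s n) n                         ≈⟨ shanks n ⟩
      sumOver (box n) (λ k → signed k (r * pent k)) ∎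
      where
      tail : ∀ k → sumTo (λ s → c s n) k ≈ eulerProduct r n
      tail zero    = begin
        const 1ℤ ⊛ e 0 ⊛ A 0 n       ≈⟨ ⊛-cong (⊛-cong ≈-refl (≈-reflexive (cong mono (*-zeroʳ r)))) (A-zero n) ⟩
        const 1ℤ ⊛ const 1ℤ ⊛ eulerProduct r n ≈⟨ solve 1 (λ x → con 1ℤ :* con 1ℤ :* x := x) ≈-refl _ ⟩
        eulerProduct r n             ∎
      tail (suc k) = ≈-trans (⊕-cong (tail k) (c-suc-≈0 k N≤n)) (⊕-identityʳ _)

-- Theta series, their triple products, and the reflection.

module ThetaSeries where

  open import Data.Integer using (ℤ; +_; -[1+_]; 0ℤ; 1ℤ; -1ℤ; ∣_∣; _+_; _*_; -_; _-_)
  import Data.Integer.Properties as ℤ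
  open import Data.Integer.Tactic.RingSolver using (solve-∀)
  open import Data.List using (List; []; _∷_; map; filter; cartesianProduct; _++_)
  open import Data.List.Membership.Propositional using (_∈_)
  open import Data.List.Membership.Propositional.Properties using (∈-filter⁺; ∈-filter⁻; ∈-map⁺; ∈-map⁻; ∈-cartesianProduct⁺)
  open import Data.List.Membership.Propositional.Properties.WithK using (unique∧set⇒bag)
  open import Data.List.Relation.Binary.BagAndSetEquality using (∼bag⇒↭)
  open import Data.List.Relation.Binary.Permutation.Propositional using (_↭_)
  import Data.List.Relation.Binary.Permutation.Propositional as ↭
  open import Data.List.Relation.Unary.All as All using (All; []; _∷_)
  open import Data.List.Relation.Unary.AllPairs using ([]; _∷_)
  open import Data.List.Relation.Unary.Any using (here; there)
  open import Data.List.Relation.Unary.Unique.Propositional using (Unique)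
  import Data.List.Relation.Unary.Unique.Propositional.Properties as Unique
  open import Data.Nat as ℕ using (ℕ; zero; suc; z≤n; s≤s; _≤_)
  import Data.Nat.Properties as ℕ
  open import Data.Product using (_×_; _,_; proj₂)
  open import Data.Sum using (inj₁; inj₂)
  open import Function using (_∘_)
  open import Function.Bundles using (mk⇔)
  open import Relation.Binary.PropositionalEquality
  open import Relation.Nullary using (yes; no; contradiction)
  open import Relation.Nullary.Decidable using (¬?)
  open PowerSeries
  open PentagonalNumbers

  -- Finite sums of integers and changes of the summation variable.

  Σ : {A : Set} → List A → (A → ℤ) → ℤ
  Σ []       f = 0ℤ
  Σ (x ∷ xs) f = f x + Σ xs f

  module _ {A : Set} where

    Σ-cong : ∀ (xs : List A) {f g : A → ℤ} → f ≗ g → Σ xs f ≡ Σ xs g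
    Σ-cong []       p = refl
    Σ-cong (x ∷ xs) p = cong₂ _+_ (p x) (Σ-cong xs p)

    Σ-++ : ∀ xs ys (f : A → ℤ) → Σ (xs ++ ys) f ≡ Σ xs f + Σ ys f
    Σ-++ []       ys f = sym (ℤ.+-identityˡ _)
    Σ-++ (x ∷ xs) ys f = trans (cong (_+_ (f x)) (Σ-++ xs ys f)) (sym (ℤ.+-assoc (f x) _ _))

    Σ-*ˡ : ∀ (xs : List A) f c → Σ xs (λ x → c * f x) ≡ c * Σ xs f
    Σ-*ˡ []       f c = sym (ℤ.*-zeroʳ c)
    Σ-*ˡ (x ∷ xs) f c = trans (cong (_+_ (c * f x)) (Σ-*ˡ xs f c)) (sym (ℤ.*-distribˡ-+ c (f x) _))

    Σ-neg : ∀ (xs : List A) f → Σ xs (λ x → - f x) ≡ - Σ xs f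
    Σ-neg []       f = refl
    Σ-neg (x ∷ xs) f = trans (cong (_+_ (- f x)) (Σ-neg xs f)) (sym (ℤ.neg-distrib-+ (f x) _))

    Σ-+ : ∀ (xs : List A) f g → Σ xs (λ x → f x + g x) ≡ Σ xs f + Σ xs g
    Σ-+ []       f g = refl
    Σ-+ (x ∷ xs) f g rewrite Σ-+ xs f g = lemma (f x) (g x) (Σ xs f) (Σ xs g)
      where
      lemma : ∀ a b c d → a + b + (c + d) ≡ a + c + (b + d)
      lemma = solve-∀

    Σ-↭ : ∀ {xs ys} (f : A → ℤ) → xs ↭ ys → Σ xs f ≡ Σ ys f
    Σ-↭ f ↭.refl         = refl
    Σ-↭ f (↭.prep x p)   = cong (_+_ (f x)) (Σ-↭ f p)
    Σ-↭ f (↭.swap {xs} {ys} x y p) = trans (cong (λ z → f x + (f y + z)) (Σ-↭ f p)) (lemma (f x) (f y) (Σ ys f))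
      where
      lemma : ∀ a b c → a + (b + c) ≡ b + (a + c)
      lemma = solve-∀
    Σ-↭ f (↭.trans p q)  = trans (Σ-↭ f p) (Σ-↭ f q)

    support? : (f : A → ℤ) (xs : List A) → List A
    support? f = filter (λ x → ¬? (f x ℤ.≟ 0ℤ))

    Σ-support : ∀ (f : A → ℤ) xs → Σ (support? f xs) f ≡ Σ xs f
    Σ-support f []       = refl
    Σ-support f (x ∷ xs) with f x ℤ.≟ 0ℤ
    ... | yes fx≡0 = trans (Σ-support f xs) (trans (sym (ℤ.+-identityˡ _)) (cong (_+ Σ xs f) (sym fx≡0)))
    ... | no  _    = cong (_+_ (f x)) (Σ-support f xs)

    unique∧⇔⇒↭ : ∀ {xs ys : List A} → Unique xs → Unique ys → (∀ {x} → x ∈ xs → x ∈ ys) → (∀ {x} → x ∈ ys → x ∈ xs) → xs ↭ ys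
    unique∧⇔⇒↭ xs! ys! p q = ∼bag⇒↭ (unique∧set⇒bag xs! ys! (mk⇔ p q))

  Σ-zero : ∀ {A : Set} (xs : List A) → Σ xs (λ _ → 0ℤ) ≡ 0ℤ
  Σ-zero []       = refl
  Σ-zero (x ∷ xs) = trans (ℤ.+-identityˡ _) (Σ-zero xs)

  Σ-swap : ∀ {A B : Set} (xs : List A) (ys : List B) (f : A → B → ℤ) →
           (Σ xs λ x → Σ ys λ y → f x y) ≡ (Σ ys λ y → Σ xs λ x → f x y)
  Σ-swap []       ys f = sym (Σ-zero ys)
  Σ-swap (x ∷ xs) ys f = trans (cong (_+_ (Σ ys (f x))) (Σ-swap xs ys f)) (sym (Σ-+ ys (f x) (λ y → Σ xs λ x → f x y)))

  Σ-map : ∀ {A B : Set} (τ : A → B) f xs → Σ (map τ xs) f ≡ Σ xs (f ∘ τ)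
  Σ-map τ f []       = refl
  Σ-map τ f (x ∷ xs) = cong (_+_ (f (τ x))) (Σ-map τ f xs)

  Σ-cartesianProduct : ∀ {A B : Set} (xs : List A) (ys : List B) f →
                       Σ (cartesianProduct xs ys) f ≡ Σ xs λ x → Σ ys λ y → f (x , y)
  Σ-cartesianProduct []       ys f = refl
  Σ-cartesianProduct (x ∷ xs) ys f = trans (Σ-++ (map (x ,_) ys) _ f) (cong₂ _+_ (Σ-map (x ,_) f ys) (Σ-cartesianProduct xs ys f))

  -- `τ` need not carry one list to the other. Both sums are first reduced to the supports of `f`
  -- and `g`, which the lists contain by hypothesis and which `τ` does match; finite ranges thus
  -- behave like all of ℤ.
  Σ-bijection : ∀ {A B : Set} {xs ys} {f : A → ℤ} {g : B → ℤ} (τ : A → B) (σ : B → A) →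
    Unique xs → Unique ys →
    (∀ x → f x ≢ 0ℤ → x ∈ xs) → (∀ y → g y ≢ 0ℤ → y ∈ ys) →
    (∀ x → σ (τ x) ≡ x) → (∀ y → τ (σ y) ≡ y) → (∀ x → g (τ x) ≡ f x) →
    Σ xs f ≡ Σ ys g
  Σ-bijection {xs = xs} {ys} {f} {g} τ σ xs! ys! f⊆ g⊆ στ τσ gτ = begin
    Σ xs f                         ≡⟨ Σ-support f xs ⟨
    Σ (support? f xs) f            ≡⟨ Σ-cong (support? f xs) (sym ∘ gτ) ⟩
    Σ (support? f xs) (g ∘ τ)      ≡⟨ Σ-map τ g (support? f xs) ⟨
    Σ (map τ (support? f xs)) g    ≡⟨ Σ-↭ g (unique∧⇔⇒↭ (Unique.map⁺ τ-injective (Unique.filter⁺ _ xs!)) (Unique.filter⁺ _ ys!) to from) ⟩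
    Σ (support? g ys) g            ≡⟨ Σ-support g ys ⟩
    Σ ys g                         ∎
    where
    open ≡-Reasoning
    τ-injective : ∀ {x x′} → τ x ≡ τ x′ → x ≡ x′
    τ-injective {x} {x′} eq = trans (sym (στ x)) (trans (cong σ eq) (στ x′))
    to : ∀ {y} → y ∈ map τ (support? f xs) → y ∈ support? g ys
    to y∈ with ∈-map⁻ τ y∈
    ... | x , x∈ , refl = ∈-filter⁺ _ (g⊆ (τ x) gτx≢0) gτx≢0
      where
      gτx≢0 : g (τ x) ≢ 0ℤ
      gτx≢0 eq = proj₂ (∈-filter⁻ (λ x → ¬? (f x ℤ.≟ 0ℤ)) {xs = xs} x∈) (trans (sym (gτ x)) eq)
    from : ∀ {y} → y ∈ support? g ys → y ∈ map τ (support? f xs)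
    from {y} y∈ = subst (_∈ _) (τσ y) (∈-map⁺ τ (∈-filter⁺ _ (f⊆ (σ y) fσy≢0) fσy≢0))
      where
      fσy≢0 : f (σ y) ≢ 0ℤ
      fσy≢0 eq = proj₂ (∈-filter⁻ (λ y → ¬? (g y ℤ.≟ 0ℤ)) {xs = ys} y∈)
        (trans (sym (cong g (τσ y))) (trans (gτ (σ y)) eq))

  -- Symmetric intervals of integers, and the parity sign.

  ∈-box⁺ : ∀ {n} k → ∣ k ∣ ≤ n → k ∈ box n
  ∈-box⁺ {zero}  (+ zero)  _ = here refl
  ∈-box⁺ {suc n} k k≤ with ℕ.m≤n⇒m<n∨m≡n k≤
  ... | inj₁ (s≤s k≤n) = there (there (∈-box⁺ k k≤n))
  ∈-box⁺ {suc n} (+ _)    k≤ | inj₂ refl = here refl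
  ∈-box⁺ {suc n} -[1+ _ ] k≤ | inj₂ refl = there (here refl)

  box-bound : ∀ n → All (λ k → ∣ k ∣ ≤ n) (box n)
  box-bound zero    = z≤n ∷ []
  box-bound (suc n) = ℕ.≤-refl ∷ ℕ.≤-refl ∷ All.map ℕ.m≤n⇒m≤1+n (box-bound n)

  box-unique : ∀ n → Unique (box n)
  box-unique zero    = [] ∷ []
  box-unique (suc n) = ((λ ()) ∷ All.map (λ {k} k≤n eq → ℕ.<⇒≱ ℕ.≤-refl (subst (λ k → ∣ k ∣ ≤ n) (sym eq) k≤n)) (box-bound n))
                     ∷ All.map (λ {k} k≤n eq → ℕ.<⇒≱ ℕ.≤-refl (subst (λ k → ∣ k ∣ ≤ n) (sym eq) k≤n)) (box-bound n)
                     ∷ box-unique n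

  -- The integers of absolute value at most `3 n + 1` are exactly `3 k`, `3 k + 1` and `3 k - 1` for
  -- `k` of absolute value at most `n`: the residues 0, 1, -1 and this bound make the decomposition
  -- exact.
  Σ-box-mod3 : ∀ n (f : ℤ → ℤ) → Σ (box (suc (n ℕ.* 3))) f ≡
    Σ (box n) (λ k → f (+ 3 * k + + 0)) + Σ (box n) (λ k → f (+ 3 * k + + 1)) + Σ (box n) (λ k → f (+ 3 * k + -1ℤ))
  Σ-box-mod3 zero    f = lemma (f (+ 1)) (f -1ℤ) (f (+ 0))
    where
    lemma : ∀ a b c → a + (b + (c + 0ℤ)) ≡ (c + 0ℤ) + (a + 0ℤ) + (b + 0ℤ)
    lemma = solve-∀
  Σ-box-mod3 (suc n) f = begin
    f₁ + (f₂ + (f₃ + (f₄ + (f₅ + (f₆ + Σ (box (suc (n ℕ.* 3))) f)))))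
      ≡⟨ cong (λ z → f₁ + (f₂ + (f₃ + (f₄ + (f₅ + (f₆ + z)))))) (Σ-box-mod3 n f) ⟩
    f₁ + (f₂ + (f₃ + (f₄ + (f₅ + (f₆ + (S₀ + S₁ + S₂))))))
      ≡⟨ lemma f₁ f₂ f₃ f₄ f₅ f₆ S₀ S₁ S₂ ⟩
    (f₃ + (f₄ + S₀)) + (f₁ + (f₆ + S₁)) + (f₅ + (f₂ + S₂))
      ≡⟨ cong₂ _+_ (cong₂ _+_ (cong₂ (λ a b → f a + (f b + S₀)) e₃ e₄) (cong₂ (λ a b → f a + (f b + S₁)) e₁ e₆))
                   (cong₂ (λ a b → f a + (f b + S₂)) e₅ e₂) ⟩
    Σ (box (suc n)) (λ k → f (+ 3 * k + + 0)) + Σ (box (suc n)) (λ k → f (+ 3 * k + + 1)) + Σ (box (suc n)) (λ k → f (+ 3 * k + -1ℤ)) ∎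
    where
    open ≡-Reasoning
    m = n ℕ.* 3
    f₁ = f (+ (4 ℕ.+ m)) ; f₂ = f -[1+ 3 ℕ.+ m ] ; f₃ = f (+ (3 ℕ.+ m)) ; f₄ = f -[1+ 2 ℕ.+ m ]
    f₅ = f (+ (2 ℕ.+ m)) ; f₆ = f -[1+ 1 ℕ.+ m ]
    S₀ = Σ (box n) (λ k → f (+ 3 * k + + 0))
    S₁ = Σ (box n) (λ k → f (+ 3 * k + + 1))
    S₂ = Σ (box n) (λ k → f (+ 3 * k + -1ℤ))
    lemma : ∀ a b c d e f x y z → a + (b + (c + (d + (e + (f + (x + y + z)))))) ≡ (c + (d + x)) + (a + (f + y)) + (e + (b + z))
    lemma = solve-∀
    cast : ∀ j → + (j ℕ.+ m) ≡ + j + + n * + 3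
    cast j = trans (ℤ.pos-+ j m) (cong (_+_ (+ j)) (ℤ.pos-* n 3))
    e₁ : + (4 ℕ.+ m) ≡ + 3 * + suc n + + 1
    e₁ = trans (cast 4) (l (+ n))
      where
      l : ∀ x → + 4 + x * + 3 ≡ + 3 * (+ 1 + x) + + 1
      l = solve-∀
    e₂ : -[1+ 3 ℕ.+ m ] ≡ + 3 * -[1+ n ] + -1ℤ
    e₂ = trans (cong -_ (cast 4)) (l (+ n))
      where
      l : ∀ x → - (+ 4 + x * + 3) ≡ + 3 * - (+ 1 + x) + -1ℤ
      l = solve-∀
    e₃ : + (3 ℕ.+ m) ≡ + 3 * + suc n + + 0
    e₃ = trans (cast 3) (l (+ n))
      where
      l : ∀ x → + 3 + x * + 3 ≡ + 3 * (+ 1 + x) + + 0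
      l = solve-∀
    e₄ : -[1+ 2 ℕ.+ m ] ≡ + 3 * -[1+ n ] + + 0
    e₄ = trans (cong -_ (cast 3)) (l (+ n))
      where
      l : ∀ x → - (+ 3 + x * + 3) ≡ + 3 * - (+ 1 + x) + + 0
      l = solve-∀
    e₅ : + (2 ℕ.+ m) ≡ + 3 * + suc n + -1ℤ
    e₅ = trans (cast 2) (l (+ n))
      where
      l : ∀ x → + 2 + x * + 3 ≡ + 3 * (+ 1 + x) + -1ℤ
      l = solve-∀
    e₆ : -[1+ 1 ℕ.+ m ] ≡ + 3 * -[1+ n ] + + 1
    e₆ = trans (cong -_ (cast 2)) (l (+ n))
      where
      l : ∀ x → - (+ 2 + x * + 3) ≡ + 3 * - (+ 1 + x) + + 1
      l = solve-∀

  sgn : ℤ → ℤ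
  sgn k = sg ∣ k ∣

  sgn-suc : ∀ k → sgn (+ 1 + k) ≡ - sgn k
  sgn-suc (+ n)          = refl
  sgn-suc -[1+ zero ]    = refl
  sgn-suc -[1+ suc n ]   = sym (ℤ.neg-involutive _)

  sgn-neg : ∀ k → sgn (- k) ≡ sgn k
  sgn-neg k = cong sg (ℤ.∣-i∣≡∣i∣ k)

  sgn-+ : ∀ j k → sgn (j + k) ≡ sgn j * sgn k
  sgn-+ (+ n) k = go n k
    where
    go : ∀ n k → sgn (+ n + k) ≡ sg n * sgn k
    go zero    k = trans (cong sgn (ℤ.+-identityˡ k)) (sym (ℤ.*-identityˡ (sgn k)))
    go (suc n) k = begin
      sgn (+ 1 + + n + k)   ≡⟨ cong sgn (ℤ.+-assoc (+ 1) (+ n) k) ⟩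
      sgn (+ 1 + (+ n + k)) ≡⟨ sgn-suc (+ n + k) ⟩
      - sgn (+ n + k)       ≡⟨ cong -_ (go n k) ⟩
      - (sg n * sgn k)      ≡⟨ ℤ.neg-distribˡ-* (sg n) (sgn k) ⟩
      - sg n * sgn k        ∎
      where open ≡-Reasoning
  sgn-+ -[1+ n ] k = begin
    sgn (-[1+ n ] + k)      ≡⟨ cong sgn (lemma (+ suc n) k) ⟩
    sgn (- (+ suc n + - k)) ≡⟨ sgn-neg (+ suc n + - k) ⟩
    sgn (+ suc n + - k)     ≡⟨ sgn-+ (+ suc n) (- k) ⟩
    sgn (+ suc n) * sgn (- k) ≡⟨ cong (_*_ (sgn (+ suc n))) (sgn-neg k) ⟩
    sgn (+ suc n) * sgn k   ∎
    where
    open ≡-Reasoning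
    lemma : ∀ m k → - m + k ≡ - (m + - k)
    lemma = solve-∀

  sgn-flip : ∀ k → sgn (+ 1 - k) ≡ - sgn k
  sgn-flip k = trans (sgn-suc (- k)) (cong -_ (sgn-neg k))

  sgn-double : ∀ j k → sgn (j + (k + k)) ≡ sgn j
  sgn-double j k = trans (sgn-+ j (k + k)) (trans (cong (_*_ (sgn j)) (trans (sgn-+ k k) (sgn² k))) (ℤ.*-identityʳ (sgn j)))
    where
    sg² : ∀ n → sg n * sg n ≡ 1ℤ
    sg² zero    = refl
    sg² (suc n) = trans (lemma (sg n)) (sg² n)
      where
      lemma : ∀ x → - x * - x ≡ x * x
      lemma = solve-∀
    sgn² : ∀ k → sgn k * sgn k ≡ 1ℤ
    sgn² k = sg² ∣ k ∣

  sumOver-coeff : ∀ {A : Set} (xs : List A) F n → sumOver xs F n ≡ Σ xs (λ x → F x n)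
  sumOver-coeff []       F n = const-0 n
  sumOver-coeff (x ∷ xs) F n = trans (⊕-coeff (F x) (sumOver xs F) n) (cong (_+_ (F x n)) (sumOver-coeff xs F n))

  sumOver-⊛ : ∀ {A : Set} (xs : List A) F g n → (sumOver xs F ⊛ g) n ≡ Σ xs (λ x → (F x ⊛ g) n)
  sumOver-⊛ []       F g n = const-⊛ 0ℤ g n
  sumOver-⊛ (x ∷ xs) F g n = trans (⊛-distribʳ-⊕-≗ g (F x) (sumOver xs F) n)
    (trans (⊕-coeff (F x ⊛ g) (sumOver xs F ⊛ g) n) (cong (_+_ ((F x ⊛ g) n)) (sumOver-⊛ xs F g n)))

  ⊛-sumOver : ∀ {A : Set} (xs : List A) F g n → (g ⊛ sumOver xs F) n ≡ Σ xs (λ x → (g ⊛ F x) n)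
  ⊛-sumOver xs F g n = trans (⊛-comm-≗ g (sumOver xs F) n)
    (trans (sumOver-⊛ xs F g n) (Σ-cong xs λ x → ⊛-comm-≗ (F x) g n))

  signed-coeff : ∀ k m → signed k m ≗ (λ i → sgn k * mono m i)
  signed-coeff k m = const-⊛ (sgn k) (mono m)

  scaled-⊛ : ∀ a b l m → (λ i → a * mono l i) ⊛ (λ i → b * mono m i) ≗ (λ i → a * b * mono (l ℕ.+ m) i)
  scaled-⊛ a b l m i = begin
    ((λ i → a * mono l i) ⊛ g) i  ≡⟨ ⊛-scale-≗ a (mono l) g i ⟩
    a * (mono l ⊛ g) i            ≡⟨ cong (a *_) (⊛-comm-≗ (mono l) g i) ⟩
    a * (g ⊛ mono l) i            ≡⟨ cong (a *_) (⊛-scale-≗ b (mono m) (mono l) i) ⟩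
    a * (b * (mono m ⊛ mono l) i) ≡⟨ ℤ.*-assoc a b _ ⟨
    a * b * (mono m ⊛ mono l) i   ≡⟨ cong (a * b *_) (trans (mono-⊛-mono m l i) (cong (λ e → mono e i) (ℕ.+-comm m l))) ⟩
    a * b * mono (l ℕ.+ m) i      ∎
    where
    open ≡-Reasoning
    g = λ i → b * mono m i

  third-bound : ∀ x j → ∣ x ∣ ≤ ∣ + 3 * x + j ∣ ℕ.+ ∣ j ∣
  third-bound x j = begin
    ∣ x ∣                        ≤⟨ ℕ.m≤n*m ∣ x ∣ 3 ⟩
    3 ℕ.* ∣ x ∣                  ≡⟨ ℤ.abs-* (+ 3) x ⟨
    ∣ + 3 * x ∣                  ≡⟨ cong ∣_∣ (lemma (+ 3 * x) j) ⟩
    ∣ (+ 3 * x + j) - j ∣        ≤⟨ ℤ.∣i-j∣≤∣i∣+∣j∣ (+ 3 * x + j) j ⟩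
    ∣ + 3 * x + j ∣ ℕ.+ ∣ j ∣    ∎
    where
    open ℕ.≤-Reasoning
    lemma : ∀ y j → y ≡ (y + j) - j
    lemma = solve-∀

  *≢0⇒mono≢0 : ∀ a {m n} → a * mono m n ≢ 0ℤ → m ≡ n
  *≢0⇒mono≢0 a {m} {n} p with m ℕ.≟ n
  ... | yes m≡n = m≡n
  ... | no  m≢n = contradiction (trans (cong (a *_) (mono-≢ m≢n)) (ℤ.*-zeroʳ a)) p

  -- Generic in the exponent, because the reflection links the theta series of `pent` with that of
  -- `trig`. The bound makes only finitely many indices contribute to a coefficient; its `suc` is
  -- forced by `trig (+ 1)`, which is 0.
  module Theta (ε : ℤ → ℕ) (ε-bound : ∀ k → ∣ k ∣ ≤ suc (ε k)) where

    coset : ℤ → ℕ → Series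
    coset i M = sumOver (box M) (λ x → signed (+ 3 * x + i) (ε (+ 3 * x + i)))

    theta : ℕ → Series
    theta K = sumOver (box K) (λ k → signed k (ε k))

    theta-cosets : ∀ M → theta (suc (M ℕ.* 3)) ≗ coset (+ 0) M ⊕ coset (+ 1) M ⊕ coset -1ℤ M
    theta-cosets M c = begin
      theta (suc (M ℕ.* 3)) c                    ≡⟨ sumOver-coeff (box (suc (M ℕ.* 3))) _ c ⟩
      Σ (box (suc (M ℕ.* 3))) (λ k → signed k (ε k) c) ≡⟨ Σ-box-mod3 M (λ k → signed k (ε k) c) ⟩
      Σ′ (+ 0) + Σ′ (+ 1) + Σ′ -1ℤ               ≡⟨ cong₂ _+_ (cong₂ _+_ (e (+ 0)) (e (+ 1))) (e -1ℤ) ⟩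
      coset (+ 0) M c + coset (+ 1) M c + coset -1ℤ M c ≡⟨ cong (_+ coset -1ℤ M c) (⊕-coeff (coset (+ 0) M) _ c) ⟨
      (coset (+ 0) M ⊕ coset (+ 1) M) c + coset -1ℤ M c ≡⟨ ⊕-coeff _ (coset -1ℤ M) c ⟨
      (coset (+ 0) M ⊕ coset (+ 1) M ⊕ coset -1ℤ M) c ∎
      where
      open ≡-Reasoning
      Σ′ : ℤ → ℤ
      Σ′ i = Σ (box M) (λ x → signed (+ 3 * x + i) (ε (+ 3 * x + i)) c)
      e : ∀ i → Σ′ i ≡ coset i M c
      e i = sym (sumOver-coeff (box M) (λ x → signed (+ 3 * x + i) (ε (+ 3 * x + i))) c)

    size : ℤ → ℤ → ℤ → ℕ
    size u v w = ε u ℕ.+ ε v ℕ.+ ε w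

    term : ℤ → ℤ → ℤ → Series
    term u v w c = sgn u * sgn v * sgn w * mono (size u v w) c

    size-bounds : ∀ u v w {c} → size u v w ≡ c → ∣ u ∣ ≤ suc c × ∣ v ∣ ≤ suc c × ∣ w ∣ ≤ suc c
    size-bounds u v w refl =
      ℕ.≤-trans (ε-bound u) (s≤s (ℕ.≤-trans (ℕ.m≤m+n (ε u) (ε v)) (ℕ.m≤m+n _ (ε w)))) ,
      ℕ.≤-trans (ε-bound v) (s≤s (ℕ.≤-trans (ℕ.m≤n+m (ε v) (ε u)) (ℕ.m≤m+n _ (ε w)))) ,
      ℕ.≤-trans (ε-bound w) (s≤s (ℕ.m≤n+m (ε w) (ε u ℕ.+ ε v)))

    signed³ : ∀ u v w c → (signed u (ε u) ⊛ signed v (ε v) ⊛ signed w (ε w)) c ≡ term u v w c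
    signed³ u v w c = trans
      (⊛-cong-≗ (λ i → trans (⊛-cong-≗ (signed-coeff u (ε u)) (signed-coeff v (ε v)) i) (scaled-⊛ (sgn u) (sgn v) (ε u) (ε v) i))
                (signed-coeff w (ε w)) c)
      (scaled-⊛ (sgn u * sgn v) (sgn w) (ε u ℕ.+ ε v) (ε w) c)

    cosets³ : ∀ i j k M c → (coset i M ⊛ coset j M ⊛ coset k M) c ≡
      Σ (cartesianProduct (box M) (cartesianProduct (box M) (box M))) λ (x , y , z) → term (+ 3 * x + i) (+ 3 * y + j) (+ 3 * z + k) c
    cosets³ i j k M c = begin
      (coset i M ⊛ coset j M ⊛ coset k M) c     ≡⟨ ⊛-assoc-≗ (coset i M) (coset j M) (coset k M) c ⟩
      (coset i M ⊛ (coset j M ⊛ coset k M)) c   ≡⟨ sumOver-⊛ (box M) (F i) (coset j M ⊛ coset k M) c ⟩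
      (Σ (box M) λ x → (F i x ⊛ (coset j M ⊛ coset k M)) c)
        ≡⟨ (Σ-cong (box M) λ x → begin
          (F i x ⊛ (coset j M ⊛ coset k M)) c   ≡⟨ ⊛-assoc-≗ (F i x) (coset j M) (coset k M) c ⟨
          (F i x ⊛ coset j M ⊛ coset k M) c     ≡⟨ ⊛-sumOver (box M) (F k) (F i x ⊛ coset j M) c ⟩
          -- Only an outer factor can be expanded, so the middle one is rotated to the outside; the
          -- sums over `z` and `y` then come in the wrong order and are swapped afterwards.
          (Σ (box M) λ z → (F i x ⊛ coset j M ⊛ F k z) c) ≡⟨ (Σ-cong (box M) λ z → begin
            (F i x ⊛ coset j M ⊛ F k z) c       ≡⟨ ⊛-comm-≗ (F i x ⊛ coset j M) (F k z) c ⟩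
            (F k z ⊛ (F i x ⊛ coset j M)) c     ≡⟨ ⊛-assoc-≗ (F k z) (F i x) (coset j M) c ⟨
            (F k z ⊛ F i x ⊛ coset j M) c       ≡⟨ ⊛-sumOver (box M) (F j) (F k z ⊛ F i x) c ⟩
            (Σ (box M) λ y → (F k z ⊛ F i x ⊛ F j y) c) ∎) ⟩
          (Σ (box M) λ z → Σ (box M) λ y → (F k z ⊛ F i x ⊛ F j y) c) ≡⟨ Σ-swap (box M) (box M) (λ z y → (F k z ⊛ F i x ⊛ F j y) c) ⟩
          (Σ (box M) λ y → Σ (box M) λ z → (F k z ⊛ F i x ⊛ F j y) c) ∎) ⟩
      (Σ (box M) λ x → Σ (box M) λ y → Σ (box M) λ z → (F k z ⊛ F i x ⊛ F j y) c)
        ≡⟨ (Σ-cong (box M) λ x → Σ-cong (box M) λ y → Σ-cong (box M) λ z →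
             trans (⊛-assoc-≗ (F k z) (F i x) (F j y) c) (trans (⊛-comm-≗ (F k z) (F i x ⊛ F j y) c)
               (signed³ (+ 3 * x + i) (+ 3 * y + j) (+ 3 * z + k) c))) ⟩
      (Σ (box M) λ x → Σ (box M) λ y → Σ (box M) λ z → term (+ 3 * x + i) (+ 3 * y + j) (+ 3 * z + k) c)
        ≡⟨ (Σ-cong (box M) λ x → sym (Σ-cartesianProduct (box M) (box M) λ (y , z) → term (+ 3 * x + i) (+ 3 * y + j) (+ 3 * z + k) c)) ⟩
      (Σ (box M) λ x → Σ (cartesianProduct (box M) (box M)) λ (y , z) → term (+ 3 * x + i) (+ 3 * y + j) (+ 3 * z + k) c)
        ≡⟨ Σ-cartesianProduct (box M) (cartesianProduct (box M) (box M)) (λ (x , y , z) → term (+ 3 * x + i) (+ 3 * y + j) (+ 3 * z + k) c) ⟨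
      (Σ (cartesianProduct (box M) (cartesianProduct (box M) (box M))) λ (x , y , z) → term (+ 3 * x + i) (+ 3 * y + j) (+ 3 * z + k) c) ∎
      where
      open ≡-Reasoning
      F : ℤ → ℤ → Series
      F i x = signed (+ 3 * x + i) (ε (+ 3 * x + i))

    -- Coordinates adapted to the reflection: it adds a multiple of (1, 1, 1) to the triple of
    -- indices, so it fixes the differences, that is `a` and `b`, and moves only `k`.
    progression : ℤ → ℤ × ℤ × ℤ → Series
    progression d (k , a , b) = term k (k + + 3 * a) (k + d + + 3 * b)

    range : ℕ → ℕ → List (ℤ × ℤ × ℤ)
    range K W = cartesianProduct (box K) (cartesianProduct (box W) (box W))

    range-unique : ∀ K W → Unique (range K W)
    range-unique K W = Unique.cartesianProduct⁺ (box-unique K) (Unique.cartesianProduct⁺ (box-unique W) (box-unique W))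

    ∈-range : ∀ {K W} k a b → ∣ k ∣ ≤ K → ∣ a ∣ ≤ W → ∣ b ∣ ≤ W → (k , a , b) ∈ range K W
    ∈-range k a b k≤ a≤ b≤ = ∈-cartesianProduct⁺ (∈-box⁺ k k≤) (∈-cartesianProduct⁺ (∈-box⁺ a a≤) (∈-box⁺ b b≤))

    -- A bound for `a` and `b` wherever the coefficient at `c` is nonzero: two indices of absolute
    -- value at most `c + 1`, and 1 for the shift `d`.
    width : ℕ → ℕ
    width c = suc c ℕ.+ suc c ℕ.+ 1

    progression-bounds : ∀ {d} k a b {c} → ∣ d ∣ ≤ 1 → progression d (k , a , b) c ≢ 0ℤ →
      ∣ k ∣ ≤ suc c × ∣ a ∣ ≤ width c × ∣ b ∣ ≤ width c
    progression-bounds {d} k a b {c} d≤1 ≢0 with size-bounds _ _ _ (*≢0⇒mono≢0 (sgn k * sgn (k + + 3 * a) * sgn (k + d + + 3 * b)) ≢0)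
    ... | k≤ , k+3a≤ , k+d+3b≤ = k≤ , a≤ , b≤
      where
      open ℕ.≤-Reasoning
      a≤ : ∣ a ∣ ≤ width c
      a≤ = begin
        ∣ a ∣                          ≤⟨ third-bound a k ⟩
        ∣ + 3 * a + k ∣ ℕ.+ ∣ k ∣      ≡⟨ cong (λ x → ∣ x ∣ ℕ.+ ∣ k ∣) (ℤ.+-comm (+ 3 * a) k) ⟩
        ∣ k + + 3 * a ∣ ℕ.+ ∣ k ∣      ≤⟨ ℕ.+-mono-≤ k+3a≤ k≤ ⟩
        suc c ℕ.+ suc c                ≤⟨ ℕ.m≤m+n _ 1 ⟩
        width c                        ∎
      b≤ : ∣ b ∣ ≤ width c
      b≤ = begin
        ∣ b ∣                                  ≤⟨ third-bound b (k + d) ⟩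
        ∣ + 3 * b + (k + d) ∣ ℕ.+ ∣ k + d ∣    ≡⟨ cong (λ x → ∣ x ∣ ℕ.+ ∣ k + d ∣) (ℤ.+-comm (+ 3 * b) (k + d)) ⟩
        ∣ k + d + + 3 * b ∣ ℕ.+ ∣ k + d ∣      ≤⟨ ℕ.+-mono-≤ k+d+3b≤ (ℕ.≤-trans (ℤ.∣i+j∣≤∣i∣+∣j∣ k d) (ℕ.+-mono-≤ k≤ d≤1)) ⟩
        suc c ℕ.+ (suc c ℕ.+ 1)                ≡⟨ ℕ.+-assoc (suc c) (suc c) 1 ⟨
        width c                                ∎

    shifted-bound : ∀ x i {c M} → ∣ i ∣ ≤ 2 → 3 ℕ.+ c ≤ M → ∣ + 3 * x + i ∣ ≤ suc c → ∣ x ∣ ≤ M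
    shifted-bound x i {c} {M} i≤2 c≤M b = begin
      ∣ x ∣                       ≤⟨ third-bound x i ⟩
      ∣ + 3 * x + i ∣ ℕ.+ ∣ i ∣   ≤⟨ ℕ.+-mono-≤ b i≤2 ⟩
      suc c ℕ.+ 2                 ≡⟨ ℕ.+-comm (suc c) 2 ⟩
      3 ℕ.+ c                     ≤⟨ c≤M ⟩
      M                           ∎
      where open ℕ.≤-Reasoning

    cosets-progression : ∀ {i d M c} → ∣ i ∣ ≤ 1 → ∣ d ∣ ≤ 1 → 3 ℕ.+ c ≤ M →
      (coset i M ⊛ coset i M ⊛ coset (i + d) M) c ≡ Σ (range M (width c)) λ (x , a , b) → progression d (+ 3 * x + i , a , b) c
    cosets-progression {i} {d} {M} {c} i≤1 d≤1 c≤M = trans (cosets³ i i (i + d) M c)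
      (Σ-bijection (λ (x , y , z) → x , y - x , z - x) (λ (x , a , b) → x , x + a , x + b)
        (range-unique M M) (range-unique M (width c)) f⊆ g⊆
        (λ (x , y , z) → cong₂ (λ y z → x , y , z) (cancel x y) (cancel x z))
        (λ (x , a , b) → cong₂ (λ a b → x , a , b) (cancel′ x a) (cancel′ x b))
        (λ (x , y , z) → cong₂ (λ v w → term (+ 3 * x + i) v w c) (e x y i) (e′ x z i d)))
      where
      cancel : ∀ x y → x + (y - x) ≡ y
      cancel = solve-∀
      cancel′ : ∀ x a → x + a - x ≡ a
      cancel′ = solve-∀
      e : ∀ x y i → + 3 * x + i + + 3 * (y - x) ≡ + 3 * y + i
      e = solve-∀
      e′ : ∀ x z i d → + 3 * x + i + d + + 3 * (z - x) ≡ + 3 * z + (i + d)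
      e′ = solve-∀
      i≤2 : ∣ i ∣ ≤ 2
      i≤2 = ℕ.m≤n⇒m≤1+n i≤1
      i+d≤2 : ∣ i + d ∣ ≤ 2
      i+d≤2 = ℕ.≤-trans (ℤ.∣i+j∣≤∣i∣+∣j∣ i d) (ℕ.+-mono-≤ i≤1 d≤1)
      f⊆ : ∀ ((x , y , z) : ℤ × ℤ × ℤ) → term (+ 3 * x + i) (+ 3 * y + i) (+ 3 * z + (i + d)) c ≢ 0ℤ → (x , y , z) ∈ range M M
      f⊆ (x , y , z) ≢0 with size-bounds _ _ _ (*≢0⇒mono≢0 (sgn (+ 3 * x + i) * sgn (+ 3 * y + i) * sgn (+ 3 * z + (i + d))) ≢0)
      ... | u , v , w = ∈-range x y z (shifted-bound x i i≤2 c≤M u) (shifted-bound y i i≤2 c≤M v) (shifted-bound z (i + d) i+d≤2 c≤M w)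
      g⊆ : ∀ ((x , a , b) : ℤ × ℤ × ℤ) → progression d (+ 3 * x + i , a , b) c ≢ 0ℤ → (x , a , b) ∈ range M (width c)
      g⊆ (x , a , b) ≢0 with progression-bounds (+ 3 * x + i) a b d≤1 ≢0
      ... | k≤ , a≤ , b≤ = ∈-range x a b (shifted-bound x i i≤2 c≤M k≤) a≤ b≤

    -- For `d` equal to 1 and to -1 these are the two cyclic sums, such as P₀² P₁ + P₁² P₂ + P₂² P₀.
    -- The residue `i + d` is left unreduced, so the classes 2 and -2 occur and are later identified
    -- with -1 and 1.
    trilinear : ℤ → ℕ → Series
    trilinear d M = coset (+ 0) M ⊛ coset (+ 0) M ⊛ coset (+ 0 + d) M
                  ⊕ coset (+ 1) M ⊛ coset (+ 1) M ⊛ coset (+ 1 + d) M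
                  ⊕ coset -1ℤ M ⊛ coset -1ℤ M ⊛ coset (-1ℤ + d) M

    -- The triples (k , l , m) with k ≡ l and m ≡ k + d modulo 3.
    trilinear-progression : ∀ {d M c} → ∣ d ∣ ≤ 1 → 3 ℕ.+ c ≤ M →
      trilinear d M c ≡ Σ (range (suc (M ℕ.* 3)) (width c)) λ t → progression d t c
    trilinear-progression {d} {M} {c} d≤1 c≤M = begin
      trilinear d M c
        ≡⟨ trans (⊕-coeff _ (C -1ℤ) c) (cong (_+ C -1ℤ c) (⊕-coeff (C (+ 0)) (C (+ 1)) c)) ⟩
      C (+ 0) c + C (+ 1) c + C -1ℤ c
        ≡⟨ cong₂ _+_ (cong₂ _+_ (e (+ 0) z≤n) (e (+ 1) (s≤s z≤n))) (e -1ℤ (s≤s z≤n)) ⟩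
      Σ (box M) (λ x → f (+ 3 * x + + 0)) + Σ (box M) (λ x → f (+ 3 * x + + 1)) + Σ (box M) (λ x → f (+ 3 * x + -1ℤ))
        ≡⟨ Σ-box-mod3 M f ⟨
      Σ (box (suc (M ℕ.* 3))) f
        ≡⟨ Σ-cartesianProduct (box (suc (M ℕ.* 3))) (cartesianProduct (box (width c)) (box (width c))) (λ t → progression d t c) ⟨
      Σ (range (suc (M ℕ.* 3)) (width c)) (λ t → progression d t c) ∎
      where
      open ≡-Reasoning
      C : ℤ → Series
      C i = coset i M ⊛ coset i M ⊛ coset (i + d) M
      f : ℤ → ℤ
      f k = Σ (cartesianProduct (box (width c)) (box (width c))) λ (a , b) → progression d (k , a , b) c
      e : ∀ i → ∣ i ∣ ≤ 1 → C i c ≡ Σ (box M) (λ x → f (+ 3 * x + i))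
      e i i≤1 = trans (cosets-progression {i} {d} i≤1 d≤1 c≤M)
        (Σ-cartesianProduct (box M) (cartesianProduct (box (width c)) (box (width c))) (λ (x , a , b) → progression d (+ 3 * x + i , a , b) c))

    sgn-progression : ∀ d k a b → sgn k * sgn (k + + 3 * a) * sgn (k + d + + 3 * b) ≡ sgn (k + (k + + 3 * a) + (k + d + + 3 * b))
    sgn-progression d k a b = sym (trans (sgn-+ (k + (k + + 3 * a)) _) (cong (_* sgn (k + d + + 3 * b)) (sgn-+ k _)))

    coset-support : ∀ {M c} → 3 ℕ.+ c ≤ M → ∀ i → ∣ i ∣ ≤ 2 → ∀ x → signed (+ 3 * x + i) (ε (+ 3 * x + i)) c ≢ 0ℤ → x ∈ box M
    coset-support {M} {c} c≤M i i≤2 x ≢0 = ∈-box⁺ x (shifted-bound x i i≤2 c≤M (subst (λ n → ∣ k ∣ ≤ suc n)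
      (*≢0⇒mono≢0 (sgn k) (subst (_≢ 0ℤ) (signed-coeff k (ε k) c) ≢0)) (ε-bound k)))
      where k = + 3 * x + i

    -- The substitution `x ↦ x + j` moves the box, so the equality is claimed only at exponents too
    -- small for indices near either boundary to contribute.
    coset-translate : ∀ {i i′ j M c} → i ≡ i′ + + 3 * j → ∣ i ∣ ≤ 2 → ∣ i′ ∣ ≤ 2 → 3 ℕ.+ c ≤ M → coset i M c ≡ coset i′ M c
    coset-translate {i} {i′} {j} {M} {c} eq i≤2 i′≤2 c≤M = begin
      coset i M c                   ≡⟨ sumOver-coeff (box M) (F i) c ⟩
      Σ (box M) (λ x → F i x c)     ≡⟨ Σ-bijection (_+ j) (_- j) (box-unique M) (box-unique M) (coset-support c≤M i i≤2) (coset-support c≤M i′ i′≤2)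
                                        (λ x → cancel x j) (λ x → cancel′ x j)
                                        (λ x → cong (λ k → signed k (ε k) c) (trans (lemma x j i′) (cong (_+_ (+ 3 * x)) (sym eq)))) ⟩
      Σ (box M) (λ x → F i′ x c)    ≡⟨ sumOver-coeff (box M) (F i′) c ⟨
      coset i′ M c                  ∎
      where
      open ≡-Reasoning
      F : ℤ → ℤ → Series
      F i x = signed (+ 3 * x + i) (ε (+ 3 * x + i))
      cancel : ∀ x j → x + j - j ≡ x
      cancel = solve-∀
      cancel′ : ∀ x j → x - j + j ≡ x
      cancel′ = solve-∀
      lemma : ∀ x j i → + 3 * (x + j) + i ≡ + 3 * x + (i + + 3 * j)
      lemma = solve-∀

  -- The exponents `pent` and `trig` as quadratic polynomials.

  tri-double : ∀ n → + tri n * + 2 ≡ + n * (+ 1 + + n)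
  tri-double zero    = refl
  tri-double (suc n) = begin
    + (tri n ℕ.+ suc n) * + 2          ≡⟨ cong (_* + 2) (ℤ.pos-+ (tri n) (suc n)) ⟩
    (+ tri n + + suc n) * + 2          ≡⟨ ℤ.*-distribʳ-+ (+ 2) (+ tri n) (+ suc n) ⟩
    + tri n * + 2 + + suc n * + 2      ≡⟨ cong (_+ + suc n * + 2) (tri-double n) ⟩
    + n * (+ 1 + + n) + + suc n * + 2  ≡⟨ lemma (+ n) ⟩
    + suc n * (+ 1 + + suc n)          ∎
    where
    open ≡-Reasoning
    lemma : ∀ x → x * (+ 1 + x) + (+ 1 + x) * + 2 ≡ (+ 1 + x) * (+ 1 + (+ 1 + x))
    lemma = solve-∀

  pent-double : ∀ k → + pent k * + 2 ≡ + 3 * k * k - k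
  pent-double (+ zero)  = refl
  pent-double (+ suc n) = begin
    + (suc n ℕ.* n ℕ.+ tri (suc n)) * + 2      ≡⟨ cong (_* + 2) (ℤ.pos-+ (suc n ℕ.* n) (tri (suc n))) ⟩
    (+ (suc n ℕ.* n) + + tri (suc n)) * + 2    ≡⟨ ℤ.*-distribʳ-+ (+ 2) (+ (suc n ℕ.* n)) (+ tri (suc n)) ⟩
    + (suc n ℕ.* n) * + 2 + + tri (suc n) * + 2 ≡⟨ cong₂ (λ x y → x * + 2 + y) (ℤ.pos-* (suc n) n) (tri-double (suc n)) ⟩
    + suc n * + n * + 2 + + suc n * (+ 1 + + suc n) ≡⟨ lemma (+ n) ⟩
    + 3 * + suc n * + suc n - + suc n          ∎
    where
    open ≡-Reasoning
    lemma : ∀ x → (+ 1 + x) * x * + 2 + (+ 1 + x) * (+ 1 + (+ 1 + x)) ≡ + 3 * (+ 1 + x) * (+ 1 + x) - (+ 1 + x)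
    lemma = solve-∀
  pent-double -[1+ n ]  = begin
    + (suc n ℕ.* suc n ℕ.+ tri (suc n)) * + 2      ≡⟨ cong (_* + 2) (ℤ.pos-+ (suc n ℕ.* suc n) (tri (suc n))) ⟩
    (+ (suc n ℕ.* suc n) + + tri (suc n)) * + 2    ≡⟨ ℤ.*-distribʳ-+ (+ 2) (+ (suc n ℕ.* suc n)) (+ tri (suc n)) ⟩
    + (suc n ℕ.* suc n) * + 2 + + tri (suc n) * + 2 ≡⟨ cong₂ (λ x y → x * + 2 + y) (ℤ.pos-* (suc n) (suc n)) (tri-double (suc n)) ⟩
    + suc n * + suc n * + 2 + + suc n * (+ 1 + + suc n) ≡⟨ lemma (+ suc n) ⟩
    + 3 * -[1+ n ] * -[1+ n ] - -[1+ n ]          ∎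
    where
    open ≡-Reasoning
    lemma : ∀ x → x * x * + 2 + x * (+ 1 + x) ≡ + 3 * - x * - x - - x
    lemma = solve-∀

  -- 3 u (u - 1) / 2
  trig : ℤ → ℕ
  trig (+ zero)  = 0
  trig (+ suc n) = 3 ℕ.* tri n
  trig -[1+ n ]  = 3 ℕ.* tri (suc n)

  trig-double : ∀ u → + trig u * + 2 ≡ + 3 * (u * u - u)
  trig-double (+ zero)  = refl
  trig-double (+ suc n) = begin
    + (3 ℕ.* tri n) * + 2    ≡⟨ cong (_* + 2) (ℤ.pos-* 3 (tri n)) ⟩
    + 3 * + tri n * + 2      ≡⟨ ℤ.*-assoc (+ 3) (+ tri n) (+ 2) ⟩
    + 3 * (+ tri n * + 2)    ≡⟨ cong (+ 3 *_) (tri-double n) ⟩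
    + 3 * (+ n * (+ 1 + + n)) ≡⟨ lemma (+ n) ⟩
    + 3 * (+ suc n * + suc n - + suc n) ∎
    where
    open ≡-Reasoning
    lemma : ∀ x → + 3 * (x * (+ 1 + x)) ≡ + 3 * ((+ 1 + x) * (+ 1 + x) - (+ 1 + x))
    lemma = solve-∀
  trig-double -[1+ n ]  = begin
    + (3 ℕ.* tri (suc n)) * + 2    ≡⟨ cong (_* + 2) (ℤ.pos-* 3 (tri (suc n))) ⟩
    + 3 * + tri (suc n) * + 2      ≡⟨ ℤ.*-assoc (+ 3) (+ tri (suc n)) (+ 2) ⟩
    + 3 * (+ tri (suc n) * + 2)    ≡⟨ cong (+ 3 *_) (tri-double (suc n)) ⟩
    + 3 * (+ suc n * (+ 1 + + suc n)) ≡⟨ lemma (+ suc n) ⟩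
    + 3 * (-[1+ n ] * -[1+ n ] - -[1+ n ]) ∎
    where
    open ≡-Reasoning
    lemma : ∀ x → + 3 * (x * (+ 1 + x)) ≡ + 3 * (- x * - x - - x)
    lemma = solve-∀

  n≤tri : ∀ n → n ≤ tri n
  n≤tri zero    = z≤n
  n≤tri (suc n) = ℕ.m≤n+m (suc n) (tri n)

  pent-bound : ∀ k → ∣ k ∣ ≤ suc (pent k)
  pent-bound (+ zero)  = z≤n
  pent-bound (+ suc n) = ℕ.m≤n⇒m≤1+n (ℕ.≤-trans (n≤tri (suc n)) (ℕ.m≤n+m _ (suc n ℕ.* n)))
  pent-bound -[1+ n ]  = ℕ.m≤n⇒m≤1+n (ℕ.≤-trans (n≤tri (suc n)) (ℕ.m≤n+m _ (suc n ℕ.* suc n)))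

  trig-bound : ∀ u → ∣ u ∣ ≤ suc (trig u)
  trig-bound (+ zero)  = z≤n
  trig-bound (+ suc n) = s≤s (ℕ.≤-trans (n≤tri n) (ℕ.m≤n*m (tri n) 3))
  trig-bound -[1+ n ]  = ℕ.m≤n⇒m≤1+n (ℕ.≤-trans (n≤tri (suc n)) (ℕ.m≤n*m (tri (suc n)) 3))

  -- Doubled exponents are integer polynomials in the index, so every comparison of exponents
  -- becomes a polynomial identity for the ring solver.
  half-injective : ∀ {m n} → + m * + 2 ≡ + n * + 2 → m ≡ n
  half-injective {m} {n} eq = ℤ.+-injective (ℤ.*-cancelʳ-≡ (+ m) (+ n) (+ 2) eq)

  trig-sym : ∀ u → trig (+ 1 - u) ≡ trig u
  trig-sym u = half-injective (trans (trig-double (+ 1 - u)) (trans (lemma u) (sym (trig-double u))))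
    where
    lemma : ∀ u → + 3 * ((+ 1 - u) * (+ 1 - u) - (+ 1 - u)) ≡ + 3 * (u * u - u)
    lemma = solve-∀

  -- At `u = 3 x` the exponent is 3 (3 x) (3 x - 1) / 2, that is 9 times x (3 x - 1) / 2; this is
  -- how P(q⁹) arises.
  trig-triple : ∀ x → trig (+ 3 * x) ≡ 9 ℕ.* pent x
  trig-triple x = half-injective (begin
    + trig (+ 3 * x) * + 2           ≡⟨ trig-double (+ 3 * x) ⟩
    + 3 * (+ 3 * x * (+ 3 * x) - + 3 * x) ≡⟨ lemma x ⟩
    + 9 * (+ 3 * x * x - x)          ≡⟨ cong (+ 9 *_) (pent-double x) ⟨
    + 9 * (+ pent x * + 2)           ≡⟨ ℤ.*-assoc (+ 9) (+ pent x) (+ 2) ⟨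
    + 9 * + pent x * + 2             ≡⟨ cong (_* + 2) (ℤ.pos-* 9 (pent x)) ⟨
    + (9 ℕ.* pent x) * + 2           ∎)
    where
    open ≡-Reasoning
    lemma : ∀ x → + 3 * (+ 3 * x * (+ 3 * x) - + 3 * x) ≡ + 9 * (+ 3 * x * x - x)
    lemma = solve-∀

  module Pent = Theta pent pent-bound
  module Trig = Theta trig trig-bound

  double-+³ : ∀ (l m n : ℕ) → + (l ℕ.+ m ℕ.+ n) * + 2 ≡ + l * + 2 + + m * + 2 + + n * + 2
  double-+³ l m n = trans (cong (_* + 2) (trans (ℤ.pos-+ (l ℕ.+ m) n) (cong (_+ + n) (ℤ.pos-+ l m)))) (lemma (+ l) (+ m) (+ n))
    where
    lemma : ∀ x y z → (x + y + z) * + 2 ≡ x * + 2 + y * + 2 + z * + 2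
    lemma = solve-∀

  Pent-size : ∀ u v w → + Pent.size u v w * + 2 ≡ + 3 * u * u - u + (+ 3 * v * v - v) + (+ 3 * w * w - w)
  Pent-size u v w = trans (double-+³ (pent u) (pent v) (pent w)) (cong₂ _+_ (cong₂ _+_ (pent-double u) (pent-double v)) (pent-double w))

  Trig-size : ∀ u v w → + Trig.size u v w * + 2 ≡ + 3 * (u * u - u) + + 3 * (v * v - v) + + 3 * (w * w - w)
  Trig-size u v w = trans (double-+³ (trig u) (trig v) (trig w)) (cong₂ _+_ (cong₂ _+_ (trig-double u) (trig-double v)) (trig-double w))

  x≡-x⇒x≡0 : ∀ {x} → x ≡ - x → x ≡ 0ℤ
  x≡-x⇒x≡0 {+ zero} _ = refl

  neg≢0 : ∀ {x} → - x ≢ 0ℤ → x ≢ 0ℤ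
  neg≢0 -x≢0 refl = -x≢0 refl

  -- The reflection of (k , l , m) that changes the sign of (6 k - 1) + (6 l - 1) + (6 m - 1) preserves the
  -- exponent and reverses the sign of the term.
  trilinear-vanishes : ∀ {M c} → 3 ℕ.+ c ≤ M → Pent.trilinear -1ℤ M c ≡ 0ℤ
  trilinear-vanishes {M} {c} c≤M = x≡-x⇒x≡0 (begin
    Pent.trilinear -1ℤ M c                ≡⟨ Pent.trilinear-progression (s≤s z≤n) c≤M ⟩
    Σ R (λ t → f t c)                     ≡⟨ Σ-bijection τ τ R! R! f⊆ (λ t → f⊆ t ∘ neg≢0) ττ ττ fτ ⟩
    Σ R (λ t → - f t c)                   ≡⟨ Σ-neg R (λ t → f t c) ⟩
    - Σ R (λ t → f t c)                   ≡⟨ cong -_ (Pent.trilinear-progression (s≤s z≤n) c≤M) ⟨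
    - Pent.trilinear -1ℤ M c              ∎)
    where
    open ≡-Reasoning
    R  = Pent.range (suc (M ℕ.* 3)) (Pent.width c)
    R! = Pent.range-unique (suc (M ℕ.* 3)) (Pent.width c)
    f  = Pent.progression -1ℤ
    -- The indices add up to 3 (k + a + b) - 1, so two thirds of the sum of the entries s is 12 (k +
    -- a + b) - 6, and subtracting this from 6 k - 1 gives 6 (1 - k - 2 a - 2 b) - 1.
    τ₁ : ℤ → ℤ → ℤ → ℤ
    τ₁ k a b = + 1 - k - + 2 * a - + 2 * b
    τ : ℤ × ℤ × ℤ → ℤ × ℤ × ℤ
    τ (k , a , b) = τ₁ k a b , a , b
    ττ : ∀ t → τ (τ t) ≡ t
    ττ (k , a , b) = cong (_, a , b) (lemma k a b)
      where
      lemma : ∀ k a b → + 1 - (+ 1 - k - + 2 * a - + 2 * b) - + 2 * a - + 2 * b ≡ k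
      lemma = solve-∀
    f⊆ : ∀ t → f t c ≢ 0ℤ → t ∈ R
    f⊆ (k , a , b) ≢0 with Pent.progression-bounds k a b (s≤s z≤n) ≢0
    ... | k≤ , a≤ , b≤ = Pent.∈-range k a b (ℕ.≤-trans k≤ (s≤s (ℕ.≤-trans (ℕ.m≤n+m c 3) (ℕ.≤-trans c≤M (ℕ.m≤m*n M 3))))) a≤ b≤
    fτ : ∀ t → - f (τ t) c ≡ f t c
    fτ (k , a , b) = trans (ℤ.neg-distribˡ-* (S k′) (mono (E k′) c)) (cong₂ (λ s e → s * mono e c) signs sizes)
      where
      k′ = τ₁ k a b
      S : ℤ → ℤ
      S k = sgn k * sgn (k + + 3 * a) * sgn (k + -1ℤ + + 3 * b)
      E : ℤ → ℕ
      E k = Pent.size k (k + + 3 * a) (k + -1ℤ + + 3 * b)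
      -- The sum of the three indices goes to one minus itself, which has the opposite parity.
      signs : - S k′ ≡ S k
      signs = begin
        - S k′                                             ≡⟨ cong -_ (Pent.sgn-progression -1ℤ k′ a b) ⟩
        - sgn (k′ + (k′ + + 3 * a) + (k′ + -1ℤ + + 3 * b)) ≡⟨ sgn-flip (k′ + (k′ + + 3 * a) + (k′ + -1ℤ + + 3 * b)) ⟨
        sgn (+ 1 - (k′ + (k′ + + 3 * a) + (k′ + -1ℤ + + 3 * b))) ≡⟨ cong sgn (lemma k a b) ⟩
        sgn (k + (k + + 3 * a) + (k + -1ℤ + + 3 * b))      ≡⟨ Pent.sgn-progression -1ℤ k a b ⟨
        S k                                                ∎
        where
        lemma : ∀ k a b → let k′ = + 1 - k - + 2 * a - + 2 * b in
          + 1 - (k′ + (k′ + + 3 * a) + (k′ + -1ℤ + + 3 * b)) ≡ k + (k + + 3 * a) + (k + -1ℤ + + 3 * b)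
        lemma = solve-∀
      sizes : E k′ ≡ E k
      sizes = half-injective (trans (Pent-size k′ (k′ + + 3 * a) (k′ + -1ℤ + + 3 * b)) (trans (lemma k a b)
                (sym (Pent-size k (k + + 3 * a) (k + -1ℤ + + 3 * b)))))
        where
        lemma : ∀ k a b → let k′ = + 1 - k - + 2 * a - + 2 * b ; l = k + + 3 * a ; m = k + -1ℤ + + 3 * b
                              l′ = k′ + + 3 * a ; m′ = k′ + -1ℤ + + 3 * b in
          + 3 * k′ * k′ - k′ + (+ 3 * l′ * l′ - l′) + (+ 3 * m′ * m′ - m′) ≡ + 3 * k * k - k + (+ 3 * l * l - l) + (+ 3 * m * m - m)
        lemma = solve-∀

  -- For k + l + m ≡ 1 modulo 3 the same reflection turns (6 k - 1 , 6 l - 1 , 6 m - 1) into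
  -- 3 (2 u - 1 , 2 v - 1 , 2 w - 1).
  reflected-size : ∀ k a b → let u = - k - + 2 * a - + 2 * b in
    Pent.size k (k + + 3 * a) (k + + 1 + + 3 * b) ≡ suc (Trig.size u (u + + 3 * a) (u + + 1 + + 3 * b))
  -- In terms of s the pentagonal exponent is (s² - 1) / 24; at s = 3 (2 u - 1) this equals `trig u`
  -- plus one third. The three thirds make up the `suc`, and thereby the lone factor q in front of
  -- P(q⁹)³.
  reflected-size k a b = half-injective (trans (Pent-size k (k + + 3 * a) (k + + 1 + + 3 * b)) (trans (lemma k a b)
      (trans (cong (_+_ (+ 2)) (sym (Trig-size u (u + + 3 * a) (u + + 1 + + 3 * b)))) (sym (ℤ.*-distribʳ-+ (+ 2) (+ 1) (+ s))))))
    where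
    u = - k - + 2 * a - + 2 * b
    s = Trig.size u (u + + 3 * a) (u + + 1 + + 3 * b)
    lemma : ∀ k a b → let u = - k - + 2 * a - + 2 * b ; l = k + + 3 * a ; m = k + + 1 + + 3 * b
                          v = u + + 3 * a ; w = u + + 1 + + 3 * b in
      + 3 * k * k - k + (+ 3 * l * l - l) + (+ 3 * m * m - m) ≡
      + 2 + (+ 3 * (u * u - u) + + 3 * (v * v - v) + + 3 * (w * w - w))
    lemma = solve-∀

  -- The reflection lowers the exponent by one, by `reflected-size`, and changes the sum of the
  -- indices by an even number, so it matches the terms at `suc c` with terms of equal sign at `c`.
  trilinear-reflects : ∀ {M M′ c} → 4 ℕ.+ c ≤ M → 3 ℕ.+ c ≤ M′ → Pent.trilinear (+ 1) M (suc c) ≡ Trig.trilinear (+ 1) M′ c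
  trilinear-reflects {M} {M′} {c} c≤M c≤M′ = begin
    Pent.trilinear (+ 1) M (suc c)         ≡⟨ Pent.trilinear-progression (s≤s z≤n) c≤M ⟩
    Σ R (λ t → f t (suc c))                ≡⟨ Σ-bijection τ τ R! R′! f⊆ g⊆ ττ ττ gτ ⟩
    Σ R′ (λ t → g t c)                     ≡⟨ Trig.trilinear-progression (s≤s z≤n) c≤M′ ⟨
    Trig.trilinear (+ 1) M′ c              ∎
    where
    open ≡-Reasoning
    R   = Pent.range (suc (M ℕ.* 3)) (Pent.width (suc c))
    R!  = Pent.range-unique (suc (M ℕ.* 3)) (Pent.width (suc c))
    R′  = Trig.range (suc (M′ ℕ.* 3)) (Trig.width c)
    R′! = Trig.range-unique (suc (M′ ℕ.* 3)) (Trig.width c)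
    f   = Pent.progression (+ 1)
    g   = Trig.progression (+ 1)
    τ₁ : ℤ → ℤ → ℤ → ℤ
    τ₁ k a b = - k - + 2 * a - + 2 * b
    τ : ℤ × ℤ × ℤ → ℤ × ℤ × ℤ
    τ (k , a , b) = τ₁ k a b , a , b
    ττ : ∀ t → τ (τ t) ≡ t
    ττ (k , a , b) = cong (_, a , b) (lemma k a b)
      where
      lemma : ∀ k a b → - (- k - + 2 * a - + 2 * b) - + 2 * a - + 2 * b ≡ k
      lemma = solve-∀
    f⊆ : ∀ t → f t (suc c) ≢ 0ℤ → t ∈ R
    f⊆ (k , a , b) ≢0 with Pent.progression-bounds k a b (s≤s z≤n) ≢0
    ... | k≤ , a≤ , b≤ = Pent.∈-range k a b (ℕ.≤-trans k≤ (s≤s (ℕ.≤-trans (ℕ.m≤n+m (suc c) 3) (ℕ.≤-trans c≤M (ℕ.m≤m*n M 3))))) a≤ b≤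
    g⊆ : ∀ t → g t c ≢ 0ℤ → t ∈ R′
    g⊆ (k , a , b) ≢0 with Trig.progression-bounds k a b (s≤s z≤n) ≢0
    ... | k≤ , a≤ , b≤ = Trig.∈-range k a b (ℕ.≤-trans k≤ (s≤s (ℕ.≤-trans (ℕ.m≤n+m c 3) (ℕ.≤-trans c≤M′ (ℕ.m≤m*n M′ 3))))) a≤ b≤
    gτ : ∀ t → g (τ t) c ≡ f t (suc c)
    gτ (k , a , b) = cong₂ (λ s e → s * mono e (suc c)) signs (sym (reflected-size k a b))
      where
      k′ = τ₁ k a b
      S : ℤ → ℤ
      S k = sgn k * sgn (k + + 3 * a) * sgn (k + + 1 + + 3 * b)
      signs : S k′ ≡ S k
      signs = begin
        S k′                                             ≡⟨ Trig.sgn-progression (+ 1) k′ a b ⟩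
        sgn (k′ + (k′ + + 3 * a) + (k′ + + 1 + + 3 * b)) ≡⟨ cong sgn (lemma k a b) ⟩
        sgn ((k + (k + + 3 * a) + (k + + 1 + + 3 * b)) + (j + j)) ≡⟨ sgn-double (k + (k + + 3 * a) + (k + + 1 + + 3 * b)) j ⟩
        sgn (k + (k + + 3 * a) + (k + + 1 + + 3 * b))    ≡⟨ Pent.sgn-progression (+ 1) k a b ⟨
        S k                                              ∎
        where
        j = - (+ 3 * k) - + 3 * a - + 3 * b
        lemma : ∀ k a b → let k′ = - k - + 2 * a - + 2 * b ; j = - (+ 3 * k) - + 3 * a - + 3 * b in
          k′ + (k′ + + 3 * a) + (k′ + + 1 + + 3 * b) ≡ (k + (k + + 3 * a) + (k + + 1 + + 3 * b)) + (j + j)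
        lemma = solve-∀

  -- By `reflected-size` every exponent in the sum is a successor, so nothing contributes at 0.
  trilinear-zero : ∀ {M} → 3 ≤ M → Pent.trilinear (+ 1) M 0 ≡ 0ℤ
  trilinear-zero {M} 3≤M = begin
    Pent.trilinear (+ 1) M 0             ≡⟨ Pent.trilinear-progression {d = + 1} {c = 0} (s≤s z≤n) 3≤M ⟩
    Σ R (λ t → Pent.progression (+ 1) t 0) ≡⟨ Σ-cong R (λ (k , a , b) → vanish k a b) ⟩
    Σ R (λ _ → 0ℤ)                       ≡⟨ Σ-zero R ⟩
    0ℤ                                   ∎
    where
    open ≡-Reasoning
    R = Pent.range (suc (M ℕ.* 3)) (Pent.width 0)
    vanish : ∀ k a b → Pent.progression (+ 1) (k , a , b) 0 ≡ 0ℤ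
    vanish k a b = trans (cong (λ e → sgn k * sgn (k + + 3 * a) * sgn (k + + 1 + + 3 * b) * mono e 0) (reflected-size k a b))
      (ℤ.*-zeroʳ (sgn k * sgn (k + + 3 * a) * sgn (k + + 1 + + 3 * b)))

  -- The symmetry `u ↦ 1 - u` preserves `trig` and reverses the sign; on `u = 3 x + i` it becomes
  -- `x ↦ j - x`, landing in the class of `i′`.
  Trig-coset-reflect : ∀ {i i′ j M c} → + 1 - i ≡ i′ + + 3 * j → ∣ i ∣ ≤ 2 → ∣ i′ ∣ ≤ 2 → 3 ℕ.+ c ≤ M →
    Trig.coset i M c ≡ - Trig.coset i′ M c
  Trig-coset-reflect {i} {i′} {j} {M} {c} eq i≤2 i′≤2 c≤M = begin
    Trig.coset i M c                ≡⟨ sumOver-coeff (box M) (F i) c ⟩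
    Σ (box M) (λ x → F i x c)       ≡⟨ Σ-bijection (λ x → j - x) (λ x → j - x) (box-unique M) (box-unique M) (⊆ i i≤2) (λ x → ⊆ i′ i′≤2 x ∘ neg≢0)
                                         (involutive j) (involutive j) gτ ⟩
    Σ (box M) (λ x → - F i′ x c)    ≡⟨ Σ-neg (box M) (λ x → F i′ x c) ⟩
    - Σ (box M) (λ x → F i′ x c)    ≡⟨ cong -_ (sumOver-coeff (box M) (F i′) c) ⟨
    - Trig.coset i′ M c             ∎
    where
    open ≡-Reasoning
    F : ℤ → ℤ → Series
    F i x = signed (+ 3 * x + i) (trig (+ 3 * x + i))
    involutive : ∀ j x → j - (j - x) ≡ x
    involutive = solve-∀
    ⊆ : ∀ i → ∣ i ∣ ≤ 2 → ∀ x → F i x c ≢ 0ℤ → x ∈ box M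
    ⊆ = Trig.coset-support c≤M
    gτ : ∀ x → - F i′ (j - x) c ≡ F i x c
    gτ x = begin
      - signed (+ 3 * (j - x) + i′) (trig (+ 3 * (j - x) + i′)) c ≡⟨ cong (λ k → - signed k (trig k) c) (trans (lemma x j i′) (trans (cong (_- + 3 * x) (sym eq)) (lemma′ x i))) ⟩
      - signed (+ 1 - u) (trig (+ 1 - u)) c        ≡⟨ cong -_ (signed-coeff (+ 1 - u) (trig (+ 1 - u)) c) ⟩
      - (sgn (+ 1 - u) * mono (trig (+ 1 - u)) c)  ≡⟨ ℤ.neg-distribˡ-* (sgn (+ 1 - u)) _ ⟩
      - sgn (+ 1 - u) * mono (trig (+ 1 - u)) c    ≡⟨ cong₂ (λ s e → s * mono e c) (trans (cong -_ (sgn-flip u)) (ℤ.neg-involutive (sgn u))) (trig-sym u) ⟩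
      sgn u * mono (trig u) c                      ≡⟨ signed-coeff u (trig u) c ⟨
      signed u (trig u) c                          ∎
      where
      u = + 3 * x + i
      lemma : ∀ x j i → + 3 * (j - x) + i ≡ i + + 3 * j - + 3 * x
      lemma = solve-∀
      lemma′ : ∀ x i → + 1 - i - + 3 * x ≡ + 1 - (+ 3 * x + i)
      lemma′ = solve-∀

  Trig-coset-self-opposite : ∀ {i j M c} → + 1 - i ≡ i + + 3 * j → ∣ i ∣ ≤ 2 → 3 ℕ.+ c ≤ M → Trig.coset i M c ≡ 0ℤ
  Trig-coset-self-opposite {j = j} eq i≤2 c≤M = x≡-x⇒x≡0 (Trig-coset-reflect {j = j} eq i≤2 i≤2 c≤M)

  Trig-coset-zero : ∀ M → Trig.coset (+ 0) M ≗ sumOver (box M) (λ k → signed k (9 ℕ.* pent k))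
  Trig-coset-zero M c = trans (sumOver-coeff (box M) (λ x → signed (+ 3 * x + + 0) (trig (+ 3 * x + + 0))) c)
    (trans (Σ-cong (box M) e) (sym (sumOver-coeff (box M) (λ k → signed k (9 ℕ.* pent k)) c)))
    where
    e : ∀ x → signed (+ 3 * x + + 0) (trig (+ 3 * x + + 0)) c ≡ signed x (9 ℕ.* pent x) c
    e x = trans (cong (λ k → signed k (trig k) c) (ℤ.+-identityʳ (+ 3 * x)))
      (trans (signed-coeff (+ 3 * x) (trig (+ 3 * x)) c) (trans (cong₂ (λ s e → s * mono e c) sgn-triple (trig-triple x))
        (sym (signed-coeff x (9 ℕ.* pent x) c))))
      where
      sgn-triple : sgn (+ 3 * x) ≡ sgn x
      sgn-triple = trans (cong sgn (lemma x)) (sgn-double x x)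
        where
        lemma : ∀ x → + 3 * x ≡ x + (x + x)
        lemma = solve-∀

-- Recurrences for regular partitions with bounded parts.

module RegularPartitions where

  open import Data.List using (List; []; _∷_; length; map; _++_)
  open import Data.List.Membership.Propositional using (_∈_)
  open import Data.List.Membership.Propositional.Properties using (∈-map⁺; ∈-map⁻; ∈-++⁺ˡ; ∈-++⁺ʳ; ∈-++⁻)
  open import Data.List.Membership.Propositional.Properties.WithK using (unique∧set⇒bag)
  open import Data.List.Properties using (length-map; length-++; ∷-injectiveʳ)
  open import Data.List.Relation.Binary.BagAndSetEquality using (∼bag⇒↭)
  open import Data.List.Relation.Binary.Permutation.Propositional.Properties using (↭-length)
  open import Data.List.Relation.Unary.All as All using (All; []; _∷_)
  open import Data.List.Relation.Unary.Any using (here)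
  open import Data.List.Relation.Unary.Linked as Linked using (Linked; []; [-]; _∷_)
  open import Data.List.Relation.Unary.Linked.Properties using (Linked⇒All)
  import Data.List.Relation.Unary.Unique.Propositional.Properties as Unique
  open import Data.Nat
  open import Data.Nat.Divisibility using (_∣_)
  open import Data.Nat.Properties
  open import Data.Product using (_×_; _,_; ∃-syntax; proj₁)
  open import Data.Sum using (_⊎_; inj₁; inj₂)
  open import Function using (_∘_)
  open import Function.Bundles using (mk⇔; Equivalence)
  open import Relation.Binary.PropositionalEquality
  open import Relation.Nullary using (¬_; contradiction)
  open import Relation.Nullary.Decidable using (_×-dec_)
  open import Defs

  open Equivalence using (to; from)

  #-⊎ : ∀ {A B : Set} {P Q : A → Set} {R : B → Set} (p : Finite P) (q : Finite Q) (r : Finite R) (f : B → A) →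
    (∀ {y z} → f y ≡ f z → y ≡ z) → (∀ {y} → ¬ Q (f y)) →
    (∀ {x} → P x → Q x ⊎ ∃[ y ] R y × x ≡ f y) → (∀ {x} → Q x → P x) → (∀ {y} → R y → P (f y)) →
    # P p ≡ # Q q + # R r
  #-⊎ {P = P} {Q} {R} p q r f f-injective Q∌f split Q⊆P fR⊆P = begin
    length (elements p)                               ≡⟨ ↭-length (∼bag⇒↭ (unique∧set⇒bag (unique p) !++ (mk⇔ there back))) ⟩
    length (elements q ++ map f (elements r))         ≡⟨ length-++ (elements q) ⟩
    length (elements q) + length (map f (elements r)) ≡⟨ cong (length (elements q) +_) (length-map f (elements r)) ⟩
    length (elements q) + length (elements r)         ∎
    where
    open ≡-Reasoning
    open Finite
    !++ = Unique.++⁺ (unique q) (Unique.map⁺ f-injective (unique r)) λ (x∈q , x∈fr) → case x∈q (∈-map⁻ f x∈fr)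
      where
      case : ∀ {x} → x ∈ elements q → ∃[ y ] y ∈ elements r × x ≡ f y → _
      case x∈q (y , _ , refl) = Q∌f (to (complete q) x∈q)
    there : ∀ {x} → x ∈ elements p → x ∈ elements q ++ map f (elements r)
    there x∈p with split (to (complete p) x∈p)
    ... | inj₁ qx              = ∈-++⁺ˡ (from (complete q) qx)
    ... | inj₂ (y , ry , refl) = ∈-++⁺ʳ (elements q) (∈-map⁺ f (from (complete r) ry))
    back : ∀ {x} → x ∈ elements q ++ map f (elements r) → x ∈ elements p
    back x∈ with ∈-++⁻ (elements q) x∈
    ... | inj₁ x∈q = from (complete p) (Q⊆P (to (complete q) x∈q))
    ... | inj₂ x∈fr with ∈-map⁻ f x∈fr
    ...   | y , y∈ , refl = from (complete p) (fR⊆P (to (complete r) y∈))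

  #-cong : ∀ {A : Set} {P Q : A → Set} (p : Finite P) (q : Finite Q) → (∀ {x} → P x → Q x) → (∀ {x} → Q x → P x) → # P p ≡ # Q q
  #-cong p q P⊆Q Q⊆P = ↭-length (∼bag⇒↭ (unique∧set⇒bag (unique p) (unique q)
    (mk⇔ (from (complete q) ∘ P⊆Q ∘ to (complete p)) (from (complete p) ∘ Q⊆P ∘ to (complete q)))))
    where open Finite

  #-empty : ∀ {A : Set} {P : A → Set} (p : Finite P) → (∀ {x} → ¬ P x) → # P p ≡ 0
  #-empty record { elements = [] }                       ¬P = refl
  #-empty record { elements = x ∷ _ ; complete = complete } ¬P = contradiction (to complete (here refl)) ¬P

  module _ (l : ℕ) where

    -- Parts are bounded by `m` so that the factors of the generating function can be treated one at
    -- a time; for `n ≤ m` the bound says nothing, by `count-b`.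
    Bounded : ℕ → ℕ → List ℕ → Set
    Bounded m n xs = IsRegularPartition l n xs × All (_≤ m) xs

    finite-bounded : ∀ m n → Finite (Bounded m n)
    finite-bounded m n = finite (λ xs → isRegularPartition? l n xs ×-dec All.all? (_≤? m) xs)
      (Finite.elements regular) (Finite.unique regular) (from (Finite.complete regular) ∘ proj₁)
      where regular = finite-regularPartitions l n

    count : ℕ → ℕ → ℕ
    count m n = # (Bounded m n) (finite-bounded m n)

    head-bounds : ∀ {m y ys} → Linked _≥_ (y ∷ ys) → y ≤ m → All (_≤ m) (y ∷ ys)
    head-bounds linked y≤m = Linked⇒All (λ {i} {j} {k} i≥j j≥k → ≤-trans j≥k i≥j) y≤m linked

    weaken : ∀ {m n xs} → Bounded m n xs → Bounded (suc m) n xs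
    weaken (p , xs≤m) = p , All.map m≤n⇒m≤1+n xs≤m

    count-b : ∀ {m n} → n ≤ m → count m n ≡ b l n
    count-b {m} {n} n≤m = #-cong (finite-bounded m n) (finite-regularPartitions l n) proj₁
      λ { {xs} p@((_ , _ , refl) , _) → p , All.map (λ x≤ → ≤-trans x≤ n≤m) (all≤sum xs) }

    count-zero-zero : count 0 0 ≡ 1
    count-zero-zero = refl

    count-zero-suc : ∀ n → count 0 (suc n) ≡ 0
    count-zero-suc n = #-empty (finite-bounded 0 (suc n)) ¬bounded
      where
      ¬bounded : ∀ {xs} → ¬ Bounded 0 (suc n) xs
      ¬bounded {[]}    (((_ , _ , ()) , _) , _)
      ¬bounded {x ∷ _} (((_ , x>0 ∷ _ , _) , _) , x≤0 ∷ _) = <⇒≱ x>0 x≤0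

    count-multiple : ∀ {m} n → l ∣ suc m → count (suc m) n ≡ count m n
    count-multiple {m} n l∣m = #-cong (finite-bounded (suc m) n) (finite-bounded m n)
      (λ ((p , regular) , xs≤) → (p , regular) , All.zipWith (λ (l∤x , x≤) → ≤-pred (≤∧≢⇒< x≤ λ { refl → l∤x l∣m })) (regular , xs≤))
      weaken

    count-small : ∀ {m n} → n < suc m → count (suc m) n ≡ count m n
    count-small {m} {n} (s≤s n≤m) = trans (count-b (m≤n⇒m≤1+n n≤m)) (sym (count-b n≤m))

    -- Either all parts are at most `m`, or the first part is `m + 1`; removing it leaves a
    -- partition of `n` under the same bound, since further parts `m + 1` may remain.
    count-suc : ∀ {m} n → ¬ l ∣ suc m → count (suc m) (suc m + n) ≡ count m (suc m + n) + count (suc m) n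
    count-suc {m} n l∤m = #-⊎ (finite-bounded (suc m) (suc m + n)) (finite-bounded m (suc m + n)) (finite-bounded (suc m) n)
      (suc m ∷_) ∷-injectiveʳ (λ { (_ , m<m ∷ _) → n≮n m m<m }) split weaken
      (λ { {ys} (((linked , ys>0 , sum≡n) , regular) , ys≤) →
           ((cons linked ys≤ , z<s ∷ ys>0 , cong (suc m +_) sum≡n) , l∤m ∷ regular) , ≤-refl ∷ ys≤ })
      where
      cons : ∀ {ys} → Linked _≥_ ys → All (_≤ suc m) ys → Linked _≥_ (suc m ∷ ys)
      cons []           _          = [-]
      cons [-]          (y≤ ∷ _)   = y≤ ∷ [-]
      cons (p ∷ linked) (y≤ ∷ _)   = y≤ ∷ p ∷ linked
      split : ∀ {xs} → Bounded (suc m) (suc m + n) xs → Bounded m (suc m + n) xs ⊎ ∃[ ys ] Bounded (suc m) n ys × xs ≡ suc m ∷ ys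
      split {[]} (p , []) = inj₁ (p , [])
      split {y ∷ ys} (((linked , y>0 ∷ ys>0 , sum≡n) , l∤y ∷ regular) , y≤ ∷ ys≤) with m≤n⇒m<n∨m≡n y≤
      ... | inj₁ (s≤s y≤m) = inj₁ (((linked , y>0 ∷ ys>0 , sum≡n) , l∤y ∷ regular) , head-bounds linked y≤m)
      ... | inj₂ refl      = inj₂ (ys , (((Linked.tail linked , ys>0 , +-cancelˡ-≡ (suc m) _ _ sum≡n) , regular) , ys≤) , refl)

-- Divisibility of σ by 3 in terms of prime exponents.

module SumOfDivisors where

  open import Data.List using (List; []; _∷_; map; filter; applyDownFrom; _++_)
  open import Data.List.Membership.Propositional using (_∈_)
  open import Data.List.Membership.Propositional.Properties using (∈-map⁺; ∈-map⁻; ∈-++⁺ˡ; ∈-++⁺ʳ; ∈-++⁻; ∈-filter⁺; ∈-filter⁻; ∈-applyDownFrom⁺)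
  open import Data.List.Membership.Propositional.Properties.WithK using (unique∧set⇒bag)
  open import Data.List.Relation.Binary.BagAndSetEquality using (∼bag⇒↭)
  open import Data.List.Relation.Unary.All using ([]; _∷_)
  open import Data.List.Relation.Unary.Unique.Propositional using (Unique)
  import Data.List.Relation.Unary.Unique.Propositional.Properties as Unique
  open import Data.Nat
  open import Data.Nat.Coprimality using (Coprime; coprime-divisor)
  open import Data.Nat.Divisibility
  open import Data.Nat.DivMod using (_%_; %-distribˡ-+; %-distribˡ-*; m%n<n)
  open import Data.Nat.Induction using (<-rec)
  open import Data.Nat.ListAction using (sum; product)
  open import Data.Nat.ListAction.Properties using (sum-++; sum-↭)
  open import Data.Nat.Primality using (Prime; euclidsLemma; prime⇒irreducible; prime⇒nonZero; prime⇒nonTrivial; prime?; ¬prime[1])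
  open import Data.Nat.Primality.Factorisation using (factorise)
  open import Data.Nat.Properties
  open import Data.Nat.Tactic.RingSolver using (solve-∀)
  open import Data.Product using (_×_; _,_; ∃-syntax; proj₂)
  open import Data.Sum using (_⊎_; inj₁; inj₂; [_,_])
  open import Function using (_∘_)
  open import Function.Bundles using (_⇔_; mk⇔; Equivalence)
  open import Relation.Binary.PropositionalEquality hiding ([_])
  open import Relation.Nullary using (¬_; yes; no; contradiction)
  open import Relation.Nullary.Decidable using (toWitness)
  open import Defs using (ord; p^ord∣; p^k∣⇒k≤ord; ord≢0⇒p∣N)

  open Equivalence using (to; from)

  -- The cutoff `K` is separate from `n` because the generating series of σ uses one cutoff for all
  -- its coefficients.
  divisors : ℕ → ℕ → List ℕ
  divisors K n = filter (_∣? n) (applyDownFrom suc K)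

  σ : ℕ → ℕ
  σ n = sum (divisors n n)

  divisors-unique : ∀ K n → Unique (divisors K n)
  divisors-unique K n = Unique.filter⁺ (_∣? n) (Unique.applyDownFrom⁺₁ suc K λ j<i _ eq → <⇒≢ j<i (sym (suc-injective eq)))

  ∈-divisors⁻ : ∀ {K n d} → d ∈ divisors K n → d ∣ n
  ∈-divisors⁻ {K} {n} = proj₂ ∘ ∈-filter⁻ (_∣? n) {xs = applyDownFrom suc K}

  ∈-divisors⁺ : ∀ {K n d} .{{_ : NonZero n}} → n ≤ K → d ∣ n → d ∈ divisors K n
  ∈-divisors⁺ {K} {n} {zero}  n≤K d∣n = contradiction (0∣⇒≡0 d∣n) (≢-nonZero⁻¹ n)
  ∈-divisors⁺ {K} {n} {suc d} n≤K d∣n = ∈-filter⁺ (_∣? n) (∈-applyDownFrom⁺ suc (≤-trans (∣⇒≤ d∣n) n≤K)) d∣n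

  sum-divisors : ∀ {K n} .{{_ : NonZero n}} → n ≤ K → sum (divisors K n) ≡ σ n
  sum-divisors {K} {n} n≤K = sum-↭ (∼bag⇒↭ (unique∧set⇒bag (divisors-unique K n) (divisors-unique n n)
    (mk⇔ (∈-divisors⁺ ≤-refl ∘ ∈-divisors⁻ {K}) (∈-divisors⁺ n≤K ∘ ∈-divisors⁻ {n}))))

  sum-map-* : ∀ c xs → sum (map (c *_) xs) ≡ c * sum xs
  sum-map-* c []       = sym (*-zeroʳ c)
  sum-map-* c (x ∷ xs) = trans (cong (c * x +_) (sum-map-* c xs)) (sym (*-distribˡ-+ c x (sum xs)))

  module _ {p} (prime-p : Prime p) where

    private instance
      _ = prime⇒nonZero prime-p

    ∤⇒coprime : ∀ {d} → ¬ p ∣ d → Coprime d p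
    ∤⇒coprime p∤d {c} (c∣d , c∣p) with prime⇒irreducible prime-p c∣p
    ... | inj₁ c≡1  = c≡1
    ... | inj₂ refl = contradiction c∣d p∤d

    ∣-strip : ∀ {d m} k → ¬ p ∣ d → d ∣ p ^ k * m → d ∣ m
    ∣-strip {d} {m} zero    p∤d d∣m = subst (d ∣_) (+-identityʳ m) d∣m
    ∣-strip {d} {m} (suc k) p∤d d∣m = ∣-strip k p∤d (coprime-divisor (∤⇒coprime p∤d) (subst (d ∣_) (*-assoc p (p ^ k) m) d∣m))

    module _ {m} .{{_ : NonZero m}} (p∤m : ¬ p ∣ m) where

      private instance
        p^k*m≢0 : ∀ {k} → NonZero (p ^ k * m)
        p^k*m≢0 {k} = m*n≢0 (p ^ k) m {{m^n≢0 p k}}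

      -- The divisors of `p ^ suc k * m` that are multiples of `p` are `p` times the divisors of
      -- `p ^ k * m`; the remaining ones are coprime to `p`, hence divide `m`.
      σ-suc : ∀ k → σ (p ^ suc k * m) ≡ p * σ (p ^ k * m) + σ m
      σ-suc k = begin
        sum (divisors n n)                                     ≡⟨ sum-↭ (∼bag⇒↭ (unique∧set⇒bag (divisors-unique n n) !++ (mk⇔ there back))) ⟩
        sum (map (p *_) (divisors n′ n′) ++ divisors m m)      ≡⟨ sum-++ (map (p *_) (divisors n′ n′)) (divisors m m) ⟩
        sum (map (p *_) (divisors n′ n′)) + σ m                ≡⟨ cong (_+ σ m) (sum-map-* p (divisors n′ n′)) ⟩
        p * σ n′ + σ m                                         ∎
        where
        open ≡-Reasoning
        n  = p ^ suc k * m
        n′ = p ^ k * m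
        n≡p*n′ : n ≡ p * n′
        n≡p*n′ = *-assoc p (p ^ k) m
        !++ = Unique.++⁺ (Unique.map⁺ (*-cancelˡ-≡ _ _ p) (divisors-unique n′ n′)) (divisors-unique m m)
          λ (x∈pn′ , x∈m) → disjoint (∈-map⁻ (p *_) x∈pn′) (∈-divisors⁻ {m} x∈m)
          where
          disjoint : ∀ {x} → ∃[ y ] y ∈ divisors n′ n′ × x ≡ p * y → x ∣ m → _
          disjoint (y , _ , refl) py∣m = p∤m (∣-trans (m∣m*n y) py∣m)
        there : ∀ {d} → d ∈ divisors n n → d ∈ map (p *_) (divisors n′ n′) ++ divisors m m
        there {d} d∈ with p ∣? d
        ... | no  p∤d               = ∈-++⁺ʳ (map (p *_) (divisors n′ n′)) (∈-divisors⁺ ≤-refl (∣-strip (suc k) p∤d (∈-divisors⁻ {n} d∈)))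
        ... | yes (divides e refl)  = ∈-++⁺ˡ (subst (_∈ map (p *_) (divisors n′ n′)) (*-comm p e) (∈-map⁺ (p *_) (∈-divisors⁺ {n′} {n′} {{p^k*m≢0 {k}}} ≤-refl
                (*-cancelˡ-∣ p (subst₂ _∣_ (*-comm e p) n≡p*n′ (∈-divisors⁻ {n} d∈))))))
        back : ∀ {d} → d ∈ map (p *_) (divisors n′ n′) ++ divisors m m → d ∈ divisors n n
        back d∈ with ∈-++⁻ (map (p *_) (divisors n′ n′)) d∈
        ... | inj₂ d∈m = ∈-divisors⁺ {n} {n} {{p^k*m≢0 {suc k}}} ≤-refl (∣-trans (∈-divisors⁻ {m} d∈m) (n∣m*n (p ^ suc k)))
        ... | inj₁ d∈pn′ with ∈-map⁻ (p *_) d∈pn′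
        ...   | e , e∈ , refl = ∈-divisors⁺ {n} {n} {{p^k*m≢0 {suc k}}} ≤-refl (subst (p * e ∣_) (sym n≡p*n′) (*-monoʳ-∣ p (∈-divisors⁻ {n′} e∈)))

  -- The sum 1 + p + ... + p ^ k, which is σ(p ^ k) for prime `p`, in Horner form to match the
  -- recursion of `σ-suc`.
  geometric : ℕ → ℕ → ℕ
  geometric p zero    = 1
  geometric p (suc k) = p * geometric p k + 1

  σ-multiplicative : ∀ {p m} .{{_ : NonZero m}} (prime-p : Prime p) (p∤m : ¬ p ∣ m) k → σ (p ^ k * m) ≡ geometric p k * σ m
  σ-multiplicative {p} {m} prime-p p∤m zero    = trans (cong σ (+-identityʳ m)) (sym (+-identityʳ (σ m)))
  σ-multiplicative {p} {m} prime-p p∤m (suc k) = begin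
    σ (p ^ suc k * m)              ≡⟨ σ-suc prime-p p∤m k ⟩
    p * σ (p ^ k * m) + σ m        ≡⟨ cong (λ x → p * x + σ m) (σ-multiplicative prime-p p∤m k) ⟩
    p * (geometric p k * σ m) + σ m ≡⟨ lemma p (geometric p k) (σ m) ⟩
    (p * geometric p k + 1) * σ m  ∎
    where
    open ≡-Reasoning
    lemma : ∀ p g s → p * (g * s) + s ≡ (p * g + 1) * s
    lemma = solve-∀

  geometric-suc-% : ∀ p k → geometric p (suc k) % 3 ≡ ((p % 3) * (geometric p k % 3) + 1) % 3
  geometric-suc-% p k = begin
    (p * g + 1) % 3                        ≡⟨ %-distribˡ-+ (p * g) 1 3 ⟩
    ((p * g) % 3 + 1 % 3) % 3              ≡⟨ cong (λ x → (x + 1) % 3) (%-distribˡ-* p g 3) ⟩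
    (((p % 3) * (g % 3)) % 3 + 1 % 3) % 3  ≡⟨ %-distribˡ-+ ((p % 3) * (g % 3)) 1 3 ⟨
    ((p % 3) * (g % 3) + 1) % 3            ∎
    where
    open ≡-Reasoning
    g = geometric p k

  geometric-%₁ : ∀ {p} k → p % 3 ≡ 1 → geometric p k % 3 ≡ suc k % 3
  geometric-%₁ zero p≡1 = refl
  geometric-%₁ {p} (suc k) p≡1 = trans (geometric-suc-% p k) (trans
    (cong₂ (λ x y → (x * y + 1) % 3) p≡1 (geometric-%₁ k p≡1)) (trans (cong (λ x → (x + 1) % 3) (+-identityʳ (suc k % 3))) (suc-% k)))
    where
    suc-% : ∀ k → (suc k % 3 + 1) % 3 ≡ suc (suc k) % 3
    suc-% 0 = refl
    suc-% 1 = refl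
    suc-% 2 = refl
    suc-% (suc (suc (suc k))) = suc-% k

  -- Here p ≡ -1 modulo 3, so the sum alternates between 1 and 0; the right-hand side is this parity
  -- and not a residue modulo 3.
  geometric-%₂ : ∀ {p} k → p % 3 ≡ 2 → geometric p k % 3 ≡ suc k % 2
  geometric-%₂ zero p≡2 = refl
  geometric-%₂ {p} (suc k) p≡2 = trans (geometric-suc-% p k) (trans
    (cong₂ (λ x y → (x * y + 1) % 3) p≡2 (geometric-%₂ k p≡2)) (suc-% k))
    where
    suc-% : ∀ k → (2 * (suc k % 2) + 1) % 3 ≡ suc (suc k) % 2
    suc-% 0 = refl
    suc-% 1 = refl
    suc-% (suc (suc k)) = suc-% k

  Obstruction : ℕ → ℕ → Set
  Obstruction p k = (p % 3 ≡ 2 × k % 2 ≡ 1) ⊎ (p % 3 ≡ 1 × k % 3 ≡ 2)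

  3∣geometric⇔ : ∀ {p} k → ¬ 3 ∣ p → 3 ∣ geometric p k ⇔ Obstruction p k
  3∣geometric⇔ {p} k 3∤p = helper (p % 3) refl (m%n<n p 3)
    where
    even-suc : ∀ k → suc k % 2 ≡ 0 → k % 2 ≡ 1
    even-suc 1 _ = refl
    even-suc (suc (suc k)) = even-suc k
    even-suc′ : ∀ k → k % 2 ≡ 1 → suc k % 2 ≡ 0
    even-suc′ 1 _ = refl
    even-suc′ (suc (suc k)) = even-suc′ k
    residue : ∀ k → suc k % 3 ≡ 0 → k % 3 ≡ 2
    residue 2 _ = refl
    residue (suc (suc (suc k))) = residue k
    residue′ : ∀ k → k % 3 ≡ 2 → suc k % 3 ≡ 0
    residue′ 2 _ = refl
    residue′ (suc (suc (suc k))) = residue′ k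
    helper : ∀ r → p % 3 ≡ r → r < 3 → 3 ∣ geometric p k ⇔ Obstruction p k
    helper 0 p≡0 _ = contradiction (m%n≡0⇒n∣m p 3 p≡0) 3∤p
    helper 1 p≡1 _ = mk⇔
      (λ 3∣g → inj₂ (p≡1 , residue k (trans (sym (geometric-%₁ k p≡1)) (n∣m⇒m%n≡0 (geometric p k) 3 3∣g))))
      [ (λ (p≡2 , _) → contradiction (trans (sym p≡1) p≡2) λ ())
      , (λ (_ , k≡2) → m%n≡0⇒n∣m (geometric p k) 3 (trans (geometric-%₁ k p≡1) (residue′ k k≡2))) ]
    helper 2 p≡2 _ = mk⇔
      (λ 3∣g → inj₁ (p≡2 , even-suc k (trans (sym (geometric-%₂ k p≡2)) (n∣m⇒m%n≡0 (geometric p k) 3 3∣g))))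
      [ (λ (_ , k≡1) → m%n≡0⇒n∣m (geometric p k) 3 (trans (geometric-%₂ k p≡2) (even-suc′ k k≡1)))
      , (λ (p≡1 , _) → contradiction (trans (sym p≡1) p≡2) λ ()) ]
    helper (suc (suc (suc r))) _ (s≤s (s≤s (s≤s ())))

  prime[3] : Prime 3
  prime[3] = toWitness {a? = prime? 3} _

  prime∣^⇒∣ : ∀ {p n} k → Prime p → p ∣ n ^ k → p ∣ n
  prime∣^⇒∣ {p} zero prime-p p∣1 = contradiction (subst Prime (∣1⇒≡1 p∣1) prime-p) ¬prime[1]
  prime∣^⇒∣ {p} {n} (suc k) prime-p p∣ with euclidsLemma n (n ^ k) prime-p p∣
  ... | inj₁ p∣n  = p∣n
  ... | inj₂ p∣n^ = prime∣^⇒∣ k prime-p p∣n^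

  2≤prime-p : ∀ {p} → Prime p → 2 ≤ p
  2≤prime-p prime-p = nonTrivial⇒n>1 _ {{prime⇒nonTrivial prime-p}}

  ord-∤ : ∀ {p n} → ¬ p ∣ n → ord p n ≡ 0
  ord-∤ {p} {n} p∤n with ord p n ≟ 0
  ... | yes ord≡0 = ord≡0
  ... | no  ord≢0 = contradiction (ord≢0⇒p∣N p n ord≢0) p∤n

  ord-other : ∀ {p q m} .{{_ : NonZero m}} → Prime p → Prime q → p ≢ q → ∀ k → ord q (p ^ k * m) ≡ ord q m
  ord-other {p} {q} {m} prime-p prime-q p≢q k = ≤-antisym
    (p^k∣⇒k≤ord q m (2≤prime-p prime-q) (∣-strip prime-p k (p∤q^ (ord q (p ^ k * m))) (p^ord∣ q (p ^ k * m))))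
    (p^k∣⇒k≤ord q (p ^ k * m) {{m*n≢0 (p ^ k) m {{m^n≢0 p k {{prime⇒nonZero prime-p}}}}}} (2≤prime-p prime-q) (∣-trans (p^ord∣ q m) (n∣m*n (p ^ k))))
    where
    p∤q^ : ∀ j → ¬ p ∣ q ^ j
    p∤q^ j p∣q^ with prime⇒irreducible prime-q (prime∣^⇒∣ j prime-p p∣q^)
    ... | inj₁ p≡1 = contradiction (subst Prime p≡1 prime-p) ¬prime[1]
    ... | inj₂ p≡q = p≢q p≡q

  prime-divisor : ∀ {n} → 2 ≤ n → ∃[ p ] Prime p × p ∣ n
  prime-divisor {n} 2≤n with factorise n {{>-nonZero (≤-trans (s≤s z≤n) 2≤n)}}
  ... | record { factors = [] ; isFactorisation = refl } = contradiction 2≤n (<⇒≱ (s≤s (s≤s z≤n)))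
  ... | record { factors = p ∷ ps ; isFactorisation = refl ; factorsPrime = prime-p ∷ _ } = p , prime-p , m∣m*n (product ps)

  prime-power-split : ∀ {n} → 2 ≤ n → ∃[ p ] ∃[ m ] Prime p × NonZero m × n ≡ p ^ ord p n * m × ¬ p ∣ m × m < n
  prime-power-split {n} 2≤n with prime-divisor 2≤n
  ... | p , prime-p , p∣n with p^ord∣ p n
  ...   | divides m n≡m*p^a = p , m , prime-p , m≢0 , n≡p^a*m , p∤m , m<n
    where
    a = ord p n
    instance
      n≢0 : NonZero n
      n≢0 = >-nonZero (≤-trans (s≤s z≤n) 2≤n)
    n≡p^a*m : n ≡ p ^ a * m
    n≡p^a*m = trans n≡m*p^a (*-comm m (p ^ a))
    m≢0 : NonZero m
    m≢0 = ≢-nonZero λ { refl → ≢-nonZero⁻¹ n n≡m*p^a }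
    p∤m : ¬ p ∣ m
    p∤m p∣m = n≮n a (p^k∣⇒k≤ord p n (2≤prime-p prime-p) (subst (p ^ suc a ∣_) (sym n≡m*p^a) (*-monoˡ-∣ (p ^ a) p∣m)))
    1≤a : 1 ≤ a
    1≤a = p^k∣⇒k≤ord p n (2≤prime-p prime-p) (subst (_∣ n) (sym (*-identityʳ p)) p∣n)
    m<n : m < n
    m<n = subst (m <_) (sym n≡m*p^a) (m<m*n m (p ^ a) {{m≢0}} (≤-trans (2≤prime-p prime-p)
            (subst (_≤ p ^ a) (*-identityʳ p) (^-monoʳ-≤ p {{prime⇒nonZero prime-p}} 1≤a))))

  Obstructed : ℕ → Set
  Obstructed n = ∃[ p ] Prime p × Obstruction p (ord p n)

  ¬obstruction-0 : ∀ p → ¬ Obstruction p 0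
  ¬obstruction-0 _ (inj₁ (_ , ()))
  ¬obstruction-0 _ (inj₂ (_ , ()))

  module _ where
    private
      -- As 3 is prime, it divides `σ n`, the product of `geometric p a` and `σ m`, exactly if it
      -- divides a factor. The first factor accounts for the obstruction at `p`, the second for
      -- those at the other primes, whose exponents in `n` and `m` agree.
      step : ∀ n → (∀ {m} → m < n → NonZero m → ¬ 3 ∣ m → 3 ∣ σ m ⇔ Obstructed m) → 2 ≤ n → ¬ 3 ∣ n → 3 ∣ σ n ⇔ Obstructed n
      step n rec 2≤n 3∤n with prime-power-split 2≤n
      ... | p , m , prime-p , m≢0 , n≡p^a*m , p∤m , m<n = mk⇔ forward backward
        where
        instance _ = m≢0
        a = ord p n
        σn≡ : σ n ≡ geometric p a * σ m
        σn≡ = trans (cong σ n≡p^a*m) (σ-multiplicative prime-p p∤m a)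
        IH = rec m<n m≢0 λ 3∣m → 3∤n (subst (3 ∣_) (sym n≡p^a*m) (∣-trans 3∣m (n∣m*n (p ^ a))))
        p∣n : a ≢ 0 → p ∣ n
        p∣n = ord≢0⇒p∣N p n
        at-p : 3 ∣ geometric p a ⇔ Obstruction p a
        -- For `a = 0` both sides are false; otherwise `p` divides `n`, so it is not 3 and the
        -- residue computation applies.
        at-p with a ≟ 0
        ... | yes a≡0 = mk⇔ (λ 3∣g → contradiction (∣⇒≤ (subst (λ k → 3 ∣ geometric p k) a≡0 3∣g)) λ { (s≤s ()) })
                            (λ o → contradiction (subst (Obstruction p) a≡0 o) (¬obstruction-0 p))
        ... | no  a≢0 = 3∣geometric⇔ a λ 3∣p → 3∤n (∣-trans 3∣p (p∣n a≢0))
        ord-q : ∀ {q} → Prime q → p ≢ q → ord q n ≡ ord q m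
        ord-q {q} prime-q p≢q = trans (cong (ord q) n≡p^a*m) (ord-other prime-p prime-q p≢q a)
        forward : 3 ∣ σ n → Obstructed n
        forward 3∣σn with euclidsLemma (geometric p a) (σ m) prime[3] (subst (3 ∣_) σn≡ 3∣σn)
        ... | inj₁ 3∣g  = p , prime-p , to at-p 3∣g
        ... | inj₂ 3∣σm with to IH 3∣σm
        ...   | q , prime-q , o with p ≟ q
        ...     | yes refl = contradiction (subst (Obstruction p) (ord-∤ p∤m) o) (¬obstruction-0 p)
        ...     | no  p≢q  = q , prime-q , subst (Obstruction q) (sym (ord-q prime-q p≢q)) o
        backward : Obstructed n → 3 ∣ σ n
        backward (q , prime-q , o) with p ≟ q
        ... | yes refl = subst (3 ∣_) (sym σn≡) (∣m⇒∣m*n (σ m) (from at-p o))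
        ... | no  p≢q  = subst (3 ∣_) (sym σn≡) (∣n⇒∣m*n (geometric p a) (from IH (q , prime-q , subst (Obstruction q) (ord-q prime-q p≢q) o)))

    3∣σ⇔obstructed : ∀ n → NonZero n → ¬ 3 ∣ n → 3 ∣ σ n ⇔ Obstructed n
    3∣σ⇔obstructed = <-rec (λ n → NonZero n → ¬ 3 ∣ n → 3 ∣ σ n ⇔ Obstructed n) λ where
      (suc zero) _ _ _ → mk⇔ (λ 3∣1 → contradiction (∣⇒≤ 3∣1) λ { (s≤s ()) })
        (λ (p , prime-p , o) → contradiction (subst (Obstruction p) (ord-∤ λ p∣1 → ¬prime[1] (subst Prime (∣1⇒≡1 p∣1) prime-p)) o) (¬obstruction-0 p))
      n@(suc (suc _)) rec _ 3∤n → step n rec (s≤s (s≤s z≤n)) 3∤n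

-- The congruence between 9-regular partitions and sums of divisors.

module PartitionCongruence where

  open import Data.Integer using (ℤ; +_; -[1+_]; 0ℤ; 1ℤ; -1ℤ; ∣_∣; _+_; _*_; -_; _-_)
  open import Data.Integer.Divisibility.Signed using (divides)
  import Data.Integer.Properties as ℤ
  open import Data.Integer.Tactic.RingSolver using (solve-∀)
  open import Data.List using (List; []; _∷_; applyDownFrom)
  open import Data.List.Properties using (filter-accept; filter-reject)
  open import Data.Nat as ℕ using (ℕ; zero; suc; z≤n; s≤s; _≤_; NonZero)
  import Data.Nat.Divisibility as ℕ
  import Data.Nat.DivMod as ℕ
  open import Data.Nat.ListAction using (sum)
  import Data.Nat.Properties as ℕ
  import Data.Nat.Tactic.RingSolver as ℕ-Solver
  open import Data.Product using (_,_)
  open import Data.Sum using (inj₁; inj₂)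
  open import Function using (_∘_; _∘′_)
  open import Relation.Binary.PropositionalEquality hiding (J)
  open import Relation.Nullary using (¬_; Dec; yes; no; contradiction)
  open import Defs using (b)
  open PowerSeries
  open PentagonalNumbers
  open ThetaSeries
  open RegularPartitions
  open SumOfDivisors

  mono-⊛-shift : ∀ k f n → (mono k ⊛ f) (k ℕ.+ n) ≡ f n
  mono-⊛-shift zero    f n = trans (const-⊛ 1ℤ f n) (ℤ.*-identityˡ (f n))
  mono-⊛-shift (suc k) f n = trans (ℤ.+-identityˡ _) (mono-⊛-shift k f n)

  mono-⊛-below : ∀ {k n} f → n ℕ.< k → (mono k ⊛ f) n ≡ 0ℤ
  mono-⊛-below {suc k} {zero}  f _         = refl
  mono-⊛-below {suc k} {suc n} f (s≤s n<k) = trans (ℤ.+-identityˡ _) (mono-⊛-below f n<k)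

  -- m q ^ m / (1 - q ^ m)
  multiples : ℕ → Series
  multiples m zero    = 0ℤ
  multiples m (suc n) with m ℕ.∣? suc n
  ... | yes _ = + m
  ... | no  _ = 0ℤ

  multiples-∣ : ∀ {m n} .{{_ : NonZero n}} → m ℕ.∣ n → multiples m n ≡ + m
  multiples-∣ {m} {suc n} m∣n with m ℕ.∣? suc n
  ... | yes _   = refl
  ... | no  m∤n = contradiction m∣n m∤n

  multiples-∤ : ∀ {m n} → ¬ m ℕ.∣ n → multiples m n ≡ 0ℤ
  multiples-∤ {m} {zero}  _   = refl
  multiples-∤ {m} {suc n} m∤n with m ℕ.∣? suc n
  ... | yes m∣n = contradiction m∣n m∤n
  ... | no  _   = refl

  multiples-recurrence : ∀ m .{{_ : NonZero m}} n → multiples m n ≡ + m * mono m n + (mono m ⊛ multiples m) n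
  multiples-recurrence m n with m ℕ.≤? n
  ... | no m≰n = begin
    multiples m n                                  ≡⟨ below n m≰n ⟩
    0ℤ                                             ≡⟨ cong₂ _+_ (trans (cong (+ m *_) (mono-≢ λ m≡n → m≰n (ℕ.≤-reflexive m≡n))) (ℤ.*-zeroʳ (+ m))) (mono-⊛-below (multiples m) (ℕ.≰⇒> m≰n)) ⟨
    + m * mono m n + (mono m ⊛ multiples m) n      ∎
    where
    open ≡-Reasoning
    below : ∀ n → ¬ m ≤ n → multiples m n ≡ 0ℤ
    below zero    _   = refl
    below (suc n) m≰n = multiples-∤ (m≰n ∘ ℕ.∣⇒≤)
  ... | yes m≤n with ℕ.m≤n⇒∃[o]m+o≡n m≤n
  ...   | zero , refl = begin
    multiples m (m ℕ.+ 0)                          ≡⟨ cong (multiples m) (ℕ.+-identityʳ m) ⟩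
    multiples m m                                  ≡⟨ multiples-∣ ℕ.∣-refl ⟩
    + m                                            ≡⟨ lemma (+ m) ⟩
    + m * 1ℤ + 0ℤ                                  ≡⟨ cong₂ (λ x y → + m * x + y) (sym (trans (cong (mono m) (ℕ.+-identityʳ m)) (mono-≡ m))) (sym (mono-⊛-shift m (multiples m) 0)) ⟩
    + m * mono m (m ℕ.+ 0) + (mono m ⊛ multiples m) (m ℕ.+ 0) ∎
    where
    open ≡-Reasoning
    lemma : ∀ x → x ≡ x * 1ℤ + 0ℤ
    lemma = solve-∀
  ...   | suc j , refl = begin
    multiples m (m ℕ.+ suc j)                      ≡⟨ shift (m ℕ.∣? suc j) ⟩
    multiples m (suc j)                            ≡⟨ lemma (+ m) (multiples m (suc j)) ⟩
    + m * 0ℤ + multiples m (suc j)                 ≡⟨ cong₂ (λ x y → + m * x + y) (sym (mono-≢ (ℕ.<⇒≢ (ℕ.m<m+n m ℕ.z<s)))) (sym (mono-⊛-shift m (multiples m) (suc j))) ⟩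
    + m * mono m (m ℕ.+ suc j) + (mono m ⊛ multiples m) (m ℕ.+ suc j) ∎
    where
    open ≡-Reasoning
    lemma : ∀ x y → y ≡ x * 0ℤ + y
    lemma = solve-∀
    shift : Dec (m ℕ.∣ suc j) → multiples m (m ℕ.+ suc j) ≡ multiples m (suc j)
    shift (yes m∣j) = trans (multiples-∣ {{ℕ.>-nonZero (ℕ.≤-trans ℕ.z<s (ℕ.m≤n+m (suc j) m))}} (ℕ.∣m∣n⇒∣m+n ℕ.∣-refl m∣j)) (sym (multiples-∣ m∣j))
    shift (no  m∤j) = trans (multiples-∤ {m} {m ℕ.+ suc j} (λ m∣ → m∤j (ℕ.∣m+n∣m⇒∣n m∣ ℕ.∣-refl))) (sym (multiples-∤ m∤j))

  -- A partial sum of the Lambert series of σ; its positive-index coefficients up to `K` are already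
  -- those of σ.
  divisorSums : ℕ → Series
  divisorSums zero    = const 0ℤ
  divisorSums (suc K) = divisorSums K ⊕ multiples (suc K)

  divisorSums-coeff : ∀ K n → divisorSums K (suc n) ≡ + sum (divisors K (suc n))
  divisorSums-coeff zero    n = refl
  divisorSums-coeff (suc K) n = trans (⊕-coeff (divisorSums K) (multiples (suc K)) (suc n))
    (trans (cong (_+ multiples (suc K) (suc n)) (divisorSums-coeff K n)) step)
    where
    step : + sum (divisors K (suc n)) + multiples (suc K) (suc n) ≡ + sum (divisors (suc K) (suc n))
    step with suc K ℕ.∣? suc n
    ... | yes d = trans (ℤ.+-comm (+ sum (divisors K (suc n))) (+ suc K)) (sym (cong (+_ ∘ sum) (filter-accept (ℕ._∣? suc n) {xs = applyDownFrom suc K} d)))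
    ... | no  d = trans (ℤ.+-identityʳ _) (sym (cong (+_ ∘ sum) (filter-reject (ℕ._∣? suc n) {xs = applyDownFrom suc K} d)))

  module _ (l : ℕ) where

    boundedSeries : ℕ → Series
    boundedSeries m n = + count l m n

    boundedSeries-recurrence : ∀ {m} → ¬ l ℕ.∣ suc m →
      ∀ n → boundedSeries (suc m) n ≡ boundedSeries m n + (mono (suc m) ⊛ boundedSeries (suc m)) n
    boundedSeries-recurrence {m} l∤m n with suc m ℕ.≤? n
    ... | no m≰n = trans (cong +_ (count-small l (ℕ.≰⇒> m≰n))) (trans (sym (ℤ.+-identityʳ _))
                     (cong (_+_ (boundedSeries m n)) (sym (mono-⊛-below (boundedSeries (suc m)) (ℕ.≰⇒> m≰n)))))
    ... | yes m≤n with ℕ.m≤n⇒∃[o]m+o≡n m≤n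
    ...   | j , refl = trans (cong +_ (count-suc l j l∤m)) (trans (ℤ.pos-+ (count l m (suc m ℕ.+ j)) _)
                         (cong (_+_ (boundedSeries m (suc m ℕ.+ j))) (sym (mono-⊛-shift (suc m) (boundedSeries (suc m)) j))))

    boundedSeries-zero : boundedSeries 0 ≗ const 1ℤ
    boundedSeries-zero zero    = cong +_ (count-zero-zero l)
    boundedSeries-zero (suc n) = cong +_ (count-zero-suc l n)

  -- The substitution of q ^ 3 for q.
  dilate : Series → Series
  dilate f zero                = f 0
  dilate f 1                   = 0ℤ
  dilate f 2                   = 0ℤ
  dilate f (suc (suc (suc n))) = dilate (f ∘′ suc) n

  dilate-coeff : ∀ f n → dilate f (3 ℕ.* n) ≡ f n
  dilate-coeff f zero    = refl
  dilate-coeff f (suc n) = trans (cong (dilate f) (ℕ.*-suc 3 n)) (dilate-coeff (f ∘′ suc) n)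

  dilate-cong-≗ : ∀ {f g} → f ≗ g → dilate f ≗ dilate g
  dilate-cong-≗ p zero                = p 0
  dilate-cong-≗ p 1                   = refl
  dilate-cong-≗ p 2                   = refl
  dilate-cong-≗ p (suc (suc (suc n))) = dilate-cong-≗ (p ∘ suc) n

  dilate-+ : ∀ f g n → dilate (λ i → f i + g i) n ≡ dilate f n + dilate g n
  dilate-+ f g zero                = refl
  dilate-+ f g 1                   = refl
  dilate-+ f g 2                   = refl
  dilate-+ f g (suc (suc (suc n))) = dilate-+ (f ∘′ suc) (g ∘′ suc) n

  dilate-* : ∀ c f n → dilate (λ i → c * f i) n ≡ c * dilate f n
  dilate-* c f zero                = refl
  dilate-* c f 1                   = sym (ℤ.*-zeroʳ c)
  dilate-* c f 2                   = sym (ℤ.*-zeroʳ c)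
  dilate-* c f (suc (suc (suc n))) = dilate-* c (f ∘′ suc) n

  dilate-⊛ : ∀ f g → dilate (f ⊛ g) ≗ dilate f ⊛ dilate g
  dilate-⊛ f g zero = refl
  dilate-⊛ f g 1    = lemma (f 0) (g 0)
    where
    lemma : ∀ a b → 0ℤ ≡ a * 0ℤ + 0ℤ * b
    lemma = solve-∀
  dilate-⊛ f g 2    = lemma (f 0) (g 0)
    where
    lemma : ∀ a b → 0ℤ ≡ a * 0ℤ + (0ℤ * 0ℤ + 0ℤ * b)
    lemma = solve-∀
  dilate-⊛ f g (suc (suc (suc n))) = begin
    dilate (λ i → f 0 * g (suc i) + (f⁺ ⊛ g) i) n  ≡⟨ dilate-+ (λ i → f 0 * g (suc i)) (f⁺ ⊛ g) n ⟩
    dilate (λ i → f 0 * g (suc i)) n + dilate (f⁺ ⊛ g) n ≡⟨ cong₂ _+_ (dilate-* (f 0) (g ∘′ suc) n) (dilate-⊛ f⁺ g n) ⟩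
    f 0 * dilate (g ∘′ suc) n + X                  ≡⟨ lemma (f 0 * dilate (g ∘′ suc) n) (dilate g (2 ℕ.+ n)) (dilate g (1 ℕ.+ n)) X ⟩
    f 0 * dilate (g ∘′ suc) n + (0ℤ * dilate g (2 ℕ.+ n) + (0ℤ * dilate g (1 ℕ.+ n) + X)) ∎
    where
    open ≡-Reasoning
    f⁺ = f ∘′ suc
    X = (dilate f⁺ ⊛ dilate g) n
    lemma : ∀ a b c x → a + x ≡ a + (0ℤ * b + (0ℤ * c + x))
    lemma = solve-∀

  dilate-mono : ∀ m → dilate (mono m) ≗ mono (3 ℕ.* m)
  dilate-mono zero zero = refl
  dilate-mono zero 1 = refl
  dilate-mono zero 2 = refl
  dilate-mono zero (suc (suc (suc n))) = trans (dilate-* 0ℤ (λ _ → 0ℤ) n) (ℤ.*-zeroˡ (dilate (λ _ → 0ℤ) n))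
  dilate-mono (suc m) n = trans (go n) (cong (λ k → mono k n) (sym (ℕ.*-suc 3 m)))
    where
    go : ∀ n → dilate (mono (suc m)) n ≡ mono (3 ℕ.+ 3 ℕ.* m) n
    go zero = refl
    go 1    = refl
    go 2    = refl
    go (suc (suc (suc n))) = dilate-mono m n

  dilate-cong₃ : ∀ {f g} n → (∀ {j} → j ≤ n → f j ≡₃ g j) → dilate f n ≡₃ dilate g n
  dilate-cong₃ zero p = p z≤n
  dilate-cong₃ 1 p = ≡₃-reflexive {0ℤ} refl
  dilate-cong₃ 2 p = ≡₃-reflexive {0ℤ} refl
  dilate-cong₃ {f} {g} (suc (suc (suc n))) p = dilate-cong₃ {f ∘′ suc} {g ∘′ suc} n (λ j≤n → p (s≤s (ℕ.≤-trans j≤n (ℕ.≤-trans (ℕ.n≤1+n n) (ℕ.n≤1+n (suc n))))))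

  opaque
    unfolding _⊕_

    ϑ-⊕ : ∀ f g → ϑ (f ⊕ g) ≗ ϑ f ⊕ ϑ g
    ϑ-⊕ f g n = ℤ.*-distribˡ-+ (+ n) (f n) (g n)

    ϑ-⊝ : ∀ f → ϑ (⊝ f) ≗ ⊝ ϑ f
    ϑ-⊝ f n = sym (ℤ.neg-distribʳ-* (+ n) (f n))

    dilate-1-mono : ∀ m → dilate (const 1ℤ ⊕ ⊝ mono m) ≗ const 1ℤ ⊕ ⊝ mono (3 ℕ.* m)
    dilate-1-mono m n = begin
      dilate (λ i → const 1ℤ i + - mono m i) n       ≡⟨ dilate-+ (const 1ℤ) (λ i → - mono m i) n ⟩
      dilate (const 1ℤ) n + dilate (λ i → - mono m i) n ≡⟨ cong₂ _+_ (dilate-mono 0 n) (trans (dilate-cong-≗ (λ i → sym (ℤ.-1*i≡-i (mono m i))) n)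
                                                        (trans (dilate-* -1ℤ (mono m) n) (trans (ℤ.-1*i≡-i (dilate (mono m) n)) (cong -_ (dilate-mono m n))))) ⟩
      const 1ℤ n + - mono (3 ℕ.* m) n                ∎
      where open ≡-Reasoning

  dilate-eulerProduct : ∀ r K → dilate (eulerProduct r K) ≗ eulerProduct (3 ℕ.* r) K
  dilate-eulerProduct r zero    = dilate-mono 0
  dilate-eulerProduct r (suc K) n = trans (dilate-⊛ (eulerProduct r K) (const 1ℤ ⊕ ⊝ mono (r ℕ.* suc K)) n)
    (⊛-cong-≗ (dilate-eulerProduct r K) (λ i → trans (dilate-1-mono (r ℕ.* suc K) i)
      (cong (λ k → (const 1ℤ ⊕ ⊝ mono k) i) (sym (ℕ.*-assoc 3 r (suc K))))) n)

  -- Congruences among Euler products, divisor sums and regular partitions.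

  module Congruences (N : ℕ) where

    open Truncated N
    open ≈-Reasoning

    ϑ-cong : ∀ {f g} → f ≈ g → ϑ f ≈ ϑ g
    ϑ-cong {f} {g} p = coefficients λ {i} i≤N → *-cong₃ {+ i} {+ i} {f i} {g i} (≡₃-reflexive {+ i} refl) (at p i≤N)

    dilate-cong : ∀ {f g} → f ≈ g → dilate f ≈ dilate g
    dilate-cong {f} {g} p = coefficients λ {i} i≤N → dilate-cong₃ {f} {g} i λ j≤i → at p (ℕ.≤-trans j≤i i≤N)

    3≈0 : ∀ f → const (+ 3) ⊛ f ≈ const 0ℤ
    3≈0 f = coefficients λ {i} _ → divides (f i) (lemma i)
      where
      lemma′ : ∀ x → + 3 * x - 0ℤ ≡ x * + 3
      lemma′ = solve-∀
      lemma : ∀ i → (const (+ 3) ⊛ f) i - const 0ℤ i ≡ f i * + 3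
      lemma i = trans (cong₂ _-_ (const-⊛ (+ 3) f i) (const-0 i)) (lemma′ (f i))

    -- Freshman's dream, factor by factor.
    eulerProduct-cube : ∀ r K → eulerProduct r K ⊛ eulerProduct r K ⊛ eulerProduct r K ≈ eulerProduct (3 ℕ.* r) K
    eulerProduct-cube r zero    = solve 0 (con 1ℤ :* con 1ℤ :* con 1ℤ := con 1ℤ) ≈-refl
    eulerProduct-cube r (suc K) = begin
      E ⊛ (const 1ℤ ⊕ ⊝ y) ⊛ (E ⊛ (const 1ℤ ⊕ ⊝ y)) ⊛ (E ⊛ (const 1ℤ ⊕ ⊝ y))
        ≈⟨ solve 2 (λ e y → e :* (con 1ℤ :- y) :* (e :* (con 1ℤ :- y)) :* (e :* (con 1ℤ :- y)) :=
             e :* e :* e :* (con 1ℤ :- y :* y :* y) :+ con (+ 3) :* (e :* e :* e :* (y :* y :- y))) ≈-refl E y ⟩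
      E ⊛ E ⊛ E ⊛ (const 1ℤ ⊕ ⊝ (y ⊛ y ⊛ y)) ⊕ const (+ 3) ⊛ (E ⊛ E ⊛ E ⊛ (y ⊛ y ⊕ ⊝ y))
        ≈⟨ ⊕-cong (⊛-cong (eulerProduct-cube r K) (⊕-cong ≈-refl (⊝-cong y³))) (3≈0 _) ⟩
      eulerProduct (3 ℕ.* r) K ⊛ (const 1ℤ ⊕ ⊝ mono (3 ℕ.* r ℕ.* suc K)) ⊕ const 0ℤ
        ≈⟨ ⊕-identityʳ _ ⟩
      eulerProduct (3 ℕ.* r) (suc K) ∎
      where
      E = eulerProduct r K
      y = mono (r ℕ.* suc K)
      lemma : ∀ r k → r ℕ.* k ℕ.+ r ℕ.* k ℕ.+ r ℕ.* k ≡ 3 ℕ.* r ℕ.* k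
      lemma = ℕ-Solver.solve-∀
      y³ : y ⊛ y ⊛ y ≈ mono (3 ℕ.* r ℕ.* suc K)
      y³ = from-≗ λ i → trans (⊛-cong-≗ (mono-⊛-mono (r ℕ.* suc K) (r ℕ.* suc K)) (λ _ → refl) i)
        (trans (mono-⊛-mono (r ℕ.* suc K ℕ.+ r ℕ.* suc K) (r ℕ.* suc K) i) (cong (λ k → mono k i) (lemma r (suc K))))

    -- A series with constant term 1 is a unit. In `h ⊛ d` for `d = f - g` the coefficient at `i` is
    -- `h 0 * d i` plus terms in lower coefficients of `d`, so those of `d` vanish modulo 3 one
    -- after the other, up to `N`.
    ⊛-cancel : ∀ {f g h} → h 0 ≡ 1ℤ → f ⊛ h ≈ g ⊛ h → f ≈ g
    ⊛-cancel {f} {g} {h} h0≡1 fh≈gh = begin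
      f             ≈⟨ solve 2 (λ f g → f := g :+ (f :- g)) ≈-refl f g ⟩
      g ⊕ d         ≈⟨ ⊕-cong ≈-refl (coefficients λ {i} i≤N → go i i≤N ℕ.≤-refl) ⟩
      g ⊕ const 0ℤ  ≈⟨ ⊕-identityʳ g ⟩
      g             ∎
      where
      d = f ⊕ ⊝ g
      dh≈0 : h ⊛ d ≈ const 0ℤ
      dh≈0 = begin
        h ⊛ (f ⊕ ⊝ g)      ≈⟨ solve 3 (λ f g h → h :* (f :- g) := f :* h :- g :* h) ≈-refl f g h ⟩
        f ⊛ h ⊕ ⊝ (g ⊛ h)  ≈⟨ ⊕-cong fh≈gh ≈-refl ⟩
        g ⊛ h ⊕ ⊝ (g ⊛ h)  ≈⟨ solve 1 (λ x → x :- x := con 0ℤ) ≈-refl (g ⊛ h) ⟩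
        const 0ℤ           ∎
      low : ∀ i {f} → (∀ {j} → j ≤ i → d j ≡₃ const 0ℤ j) → (f ⊛ d) i ≡₃ 0ℤ
      low zero    {f} p = subst (f 0 * d 0 ≡₃_) (ℤ.*-zeroʳ (f 0)) (*-cong₃ {f 0} (≡₃-reflexive {f 0} refl) (p z≤n))
      low (suc i) {f} p = +-cong₃ {f 0 * d (suc i)} {0ℤ} {((f ∘′ suc) ⊛ d) i} {0ℤ} (subst (f 0 * d (suc i) ≡₃_) (ℤ.*-zeroʳ (f 0)) (*-cong₃ {f 0} (≡₃-reflexive {f 0} refl) (p ℕ.≤-refl)))
                            (low i (p ∘ ℕ.m≤n⇒m≤1+n))
      unit : ∀ x y → h 0 * x + y ≡₃ 0ℤ → y ≡₃ 0ℤ → x ≡₃ 0ℤ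
      unit x y p q = subst (_≡₃ 0ℤ) (trans (cong (λ z → z * x + y + - y) h0≡1) (lemma x y))
        (+-cong₃ {h 0 * x + y} {0ℤ} { - y} {0ℤ} p (neg-cong₃ {y} {0ℤ} q))
        where
        lemma : ∀ x y → 1ℤ * x + y + - y ≡ x
        lemma = solve-∀
      go : ∀ i → i ≤ N → ∀ {j} → j ≤ i → d j ≡₃ const 0ℤ j
      go zero    i≤N z≤n = unit (d 0) 0ℤ (subst (_≡₃ 0ℤ) (sym (ℤ.+-identityʳ (h 0 * d 0))) (at dh≈0 z≤n)) (≡₃-reflexive {0ℤ} refl)
      go (suc i) i≤N j≤ with ℕ.m≤n⇒m<n∨m≡n j≤
      ... | inj₁ (s≤s j≤i) = go i (ℕ.≤-trans (ℕ.n≤1+n i) i≤N) j≤i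
      ... | inj₂ refl      = unit (d (suc i)) _ (at dh≈0 i≤N) (low i (go i (ℕ.≤-trans (ℕ.n≤1+n i) i≤N)))

    -- Logarithmic differentiation, one factor at a time: the factor `1 - q ^ m` contributes
    -- `- m q ^ m / (1 - q ^ m)`, the negative of `multiples m`.
    euler-divisorSums : ∀ K → eulerProduct 1 K ⊛ divisorSums K ≈ ⊝ ϑ (eulerProduct 1 K)
    euler-divisorSums zero    = ≈-trans (⊛-zeroʳ (const 1ℤ)) (from-≗ λ i → sym (trans (⊝-coeff (ϑ (const 1ℤ)) i) (trans (cong -_ (ϑ-mono 0 i)) (zero≗ i))))
      where
      zero≗ : ∀ i → - (0ℤ * mono 0 i) ≡ const 0ℤ i
      zero≗ zero    = refl
      zero≗ (suc i) = refl
    euler-divisorSums (suc K) = begin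
      E ⊛ (const 1ℤ ⊕ ⊝ y) ⊛ (S ⊕ L)
        ≈⟨ solve 4 (λ e y s l → e :* (con 1ℤ :- y) :* (s :+ l) := e :* s :* (con 1ℤ :- y) :+ e :* (l :- y :* l)) ≈-refl E y S L ⟩
      E ⊛ S ⊛ (const 1ℤ ⊕ ⊝ y) ⊕ E ⊛ (L ⊕ ⊝ (y ⊛ L))
        ≈⟨ ⊕-cong (⊛-cong (euler-divisorSums K) ≈-refl) (⊛-cong ≈-refl L-eq) ⟩
      ⊝ ϑ E ⊛ (const 1ℤ ⊕ ⊝ y) ⊕ E ⊛ ϑ y
        ≈⟨ solve 4 (λ e′ y e y′ → :- e′ :* (con 1ℤ :- y) :+ e :* y′ := :- (e′ :* (con 1ℤ :- y) :+ e :* (con 0ℤ :- y′))) ≈-refl (ϑ E) y E (ϑ y) ⟩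
      ⊝ (ϑ E ⊛ (const 1ℤ ⊕ ⊝ y) ⊕ E ⊛ (const 0ℤ ⊕ ⊝ ϑ y))
        ≈⟨ ⊝-cong (⊕-cong ≈-refl (⊛-cong ≈-refl (≈-sym ϑ1-y))) ⟩
      ⊝ (ϑ E ⊛ (const 1ℤ ⊕ ⊝ y) ⊕ E ⊛ ϑ (const 1ℤ ⊕ ⊝ y))
        ≈⟨ ⊝-cong (≈-sym (from-≗ (ϑ-⊛-⊕ E (const 1ℤ ⊕ ⊝ y)))) ⟩
      ⊝ ϑ (E ⊛ (const 1ℤ ⊕ ⊝ y)) ∎
      where
      m = 1 ℕ.* suc K
      E = eulerProduct 1 K
      y = mono m
      S = divisorSums K
      L = multiples (suc K)
      m≡ : m ≡ suc K
      m≡ = ℕ.*-identityˡ (suc K)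
      L-eq : L ⊕ ⊝ (y ⊛ L) ≈ ϑ y
      L-eq = begin
        L ⊕ ⊝ (y ⊛ L)             ≈⟨ ⊕-cong recurrence ≈-refl ⟩
        ϑ y ⊕ y ⊛ L ⊕ ⊝ (y ⊛ L)   ≈⟨ solve 2 (λ x z → x :+ z :- z := x) ≈-refl (ϑ y) (y ⊛ L) ⟩
        ϑ y                       ∎
        where
        recurrence : L ≈ ϑ y ⊕ y ⊛ L
        recurrence = from-≗ λ i → trans (multiples-recurrence (suc K) i)
          (trans (cong₂ _+_ (trans (sym (ϑ-mono (suc K) i)) (cong (λ k → ϑ (mono k) i) (sym m≡))) (cong (λ k → (mono k ⊛ L) i) (sym m≡)))
                 (sym (⊕-coeff (ϑ y) (y ⊛ L) i)))
      ϑ1-y : ϑ (const 1ℤ ⊕ ⊝ y) ≈ const 0ℤ ⊕ ⊝ ϑ y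
      ϑ1-y = ≈-trans (from-≗ (ϑ-⊕ (const 1ℤ) (⊝ y))) (⊕-cong (from-≗ ϑ-1) (from-≗ (ϑ-⊝ y)))
        where
        ϑ-1 : ϑ (const 1ℤ) ≗ const 0ℤ
        ϑ-1 zero    = refl
        ϑ-1 (suc i) = ℤ.*-zeroʳ (+ suc i)

    -- Admitting the part `m + 1` divides the generating series by `1 - q ^ (m + 1)`, which cancels
    -- the new factor of Euler's product.
    bounded-euler-∤ : ∀ {l m} → ¬ l ℕ.∣ suc m →
      boundedSeries l (suc m) ⊛ eulerProduct 1 (suc m) ≈ boundedSeries l m ⊛ eulerProduct 1 m
    bounded-euler-∤ {l} {m} l∤m = begin
      B′ ⊛ (E ⊛ (const 1ℤ ⊕ ⊝ y))       ≈⟨ solve 3 (λ b e y → b :* (e :* (con 1ℤ :- y)) := (b :- y :* b) :* e) ≈-refl B′ E y ⟩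
      (B′ ⊕ ⊝ (y ⊛ B′)) ⊛ E             ≈⟨ ⊛-cong (⊕-cong recurrence ≈-refl) ≈-refl ⟩
      (B ⊕ y ⊛ B′ ⊕ ⊝ (y ⊛ B′)) ⊛ E     ≈⟨ solve 3 (λ b z e → (b :+ z :- z) :* e := b :* e) ≈-refl B (y ⊛ B′) E ⟩
      B ⊛ E                             ∎
      where
      B  = boundedSeries l m
      B′ = boundedSeries l (suc m)
      E  = eulerProduct 1 m
      y  = mono (1 ℕ.* suc m)
      recurrence : B′ ≈ B ⊕ y ⊛ B′
      recurrence = from-≗ λ i → trans (boundedSeries-recurrence l l∤m i)
        (trans (cong (λ k → B i + (mono k ⊛ B′) i) (sym (ℕ.*-identityˡ (suc m)))) (sym (⊕-coeff B (y ⊛ B′) i)))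

    -- A multiple of `l` is never a part, so here the new Euler factor survives; the surviving
    -- factors build up `eulerProduct l`.
    bounded-euler-∣ : ∀ {l m} → l ℕ.∣ suc m →
      boundedSeries l (suc m) ⊛ eulerProduct 1 (suc m) ≈ boundedSeries l m ⊛ eulerProduct 1 m ⊛ (const 1ℤ ⊕ ⊝ mono (suc m))
    bounded-euler-∣ {l} {m} l∣m = begin
      B′ ⊛ (E ⊛ (const 1ℤ ⊕ ⊝ mono (1 ℕ.* suc m))) ≈⟨ ⊛-cong (from-≗ λ i → cong +_ (count-multiple l i l∣m)) (⊛-cong ≈-refl (⊕-cong ≈-refl (⊝-cong (≈-reflexive (cong mono (ℕ.*-identityˡ (suc m))))))) ⟩
      B ⊛ (E ⊛ (const 1ℤ ⊕ ⊝ mono (suc m)))        ≈⟨ solve 3 (λ b e x → b :* (e :* x) := b :* e :* x) ≈-refl B E _ ⟩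
      B ⊛ E ⊛ (const 1ℤ ⊕ ⊝ mono (suc m))          ∎
      where
      B  = boundedSeries l m
      B′ = boundedSeries l (suc m)
      E  = eulerProduct 1 m

    bounded-euler-below : ∀ {l} q k → k ℕ.< l →
      boundedSeries l (k ℕ.+ q ℕ.* l) ⊛ eulerProduct 1 (k ℕ.+ q ℕ.* l) ≈ boundedSeries l (q ℕ.* l) ⊛ eulerProduct 1 (q ℕ.* l)
    bounded-euler-below q zero    _     = ≈-refl
    bounded-euler-below {l} q (suc k) k<l = ≈-trans
      (bounded-euler-∤ λ l∣ → ℕ.<⇒≱ k<l (ℕ.∣⇒≤ (ℕ.∣m+n∣m⇒∣n (subst (l ℕ.∣_) (ℕ.+-comm (suc k) (q ℕ.* l)) l∣) (ℕ.n∣m*n q))))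
      (bounded-euler-below q k (ℕ.≤-trans (ℕ.n≤1+n (suc k)) k<l))

    bounded-euler : ∀ l q → boundedSeries (suc l) (q ℕ.* suc l) ⊛ eulerProduct 1 (q ℕ.* suc l) ≈ eulerProduct (suc l) q
    bounded-euler l zero    = ≈-trans (⊛-cong (from-≗ (boundedSeries-zero (suc l))) ≈-refl) (⊛-identityʳ (const 1ℤ))
    bounded-euler l (suc q) = begin
      boundedSeries (suc l) (suc (l ℕ.+ q ℕ.* suc l)) ⊛ eulerProduct 1 (suc (l ℕ.+ q ℕ.* suc l))
        ≈⟨ bounded-euler-∣ (ℕ.n∣m*n (suc q)) ⟩
      boundedSeries (suc l) (l ℕ.+ q ℕ.* suc l) ⊛ eulerProduct 1 (l ℕ.+ q ℕ.* suc l) ⊛ (const 1ℤ ⊕ ⊝ mono (suc q ℕ.* suc l))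
        ≈⟨ ⊛-cong (≈-trans (bounded-euler-below q l ℕ.≤-refl) (bounded-euler l q)) (⊕-cong ≈-refl (⊝-cong (≈-reflexive (cong mono (ℕ.*-comm (suc q) (suc l)))))) ⟩
      eulerProduct (suc l) q ⊛ (const 1ℤ ⊕ ⊝ mono (suc l ℕ.* suc q)) ∎

    Σ-cong₃ : ∀ {A : Set} (xs : List A) {f g : A → ℤ} → (∀ x → f x ≡₃ g x) → Σ xs f ≡₃ Σ xs g
    Σ-cong₃ []       p = ≡₃-reflexive {0ℤ} refl
    Σ-cong₃ (x ∷ xs) {f} {g} p = +-cong₃ {f x} {g x} {Σ xs f} {Σ xs g} (p x) (Σ-cong₃ xs p)

    -- For p = `pent k`, p = 3 p - 2 p and 2 p = 3 k² - k give p ≡ k ≡ i modulo 3; the witness is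
    -- the resulting quotient.
    pent≡₃ : ∀ x i → + pent (+ 3 * x + i) ≡₃ i
    pent≡₃ x i = divides (+ pent k - k * k + x) (trans (lemma (+ pent k) x i) (trans (cong (λ y → + pent k * + 3 - y - i) (pent-double k)) (lemma′ (+ pent k) x i)))
      where
      k = + 3 * x + i
      lemma : ∀ p x i → p - i ≡ p * + 3 - p * + 2 - i
      lemma = solve-∀
      lemma′ : ∀ p x i → let k = + 3 * x + i in p * + 3 - (+ 3 * k * k - k) - i ≡ (p - k * k + x) * + 3
      lemma′ = solve-∀

    ϑ-coset : ∀ i M → ϑ (Pent.coset i M) ≈ const i ⊛ Pent.coset i M
    ϑ-coset i M = coefficients λ {c} _ → subst₂ _≡₃_ (lhs c) (rhs c) (Σ-cong₃ (box M) {λ x → + c * F x c} {λ x → i * F x c} (termwise c))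
      where
      F : ℤ → Series
      F x = signed (+ 3 * x + i) (pent (+ 3 * x + i))
      lhs : ∀ c → Σ (box M) (λ x → + c * F x c) ≡ + c * Pent.coset i M c
      lhs c = trans (Σ-*ˡ (box M) (λ x → F x c) (+ c)) (cong (+ c *_) (sym (sumOver-coeff (box M) F c)))
      rhs : ∀ c → Σ (box M) (λ x → i * F x c) ≡ (const i ⊛ Pent.coset i M) c
      rhs c = trans (Σ-*ˡ (box M) (λ x → F x c) i) (trans (cong (i *_) (sym (sumOver-coeff (box M) F c))) (sym (const-⊛ i (Pent.coset i M) c)))
      termwise : ∀ c x → + c * F x c ≡₃ i * F x c
      termwise c x with pent (+ 3 * x + i) ℕ.≟ c
      ... | yes refl = *-cong₃ {+ c} {i} {F x c} {F x c} (pent≡₃ x i) (≡₃-reflexive {F x c} refl)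
      ... | no  ≢c   = ≡₃-reflexive (trans (cong (+ c *_) F≡0) (trans (ℤ.*-zeroʳ (+ c)) (sym (trans (cong (i *_) F≡0) (ℤ.*-zeroʳ i)))))
        where
        F≡0 : F x c ≡ 0ℤ
        F≡0 = trans (signed-coeff (+ 3 * x + i) (pent (+ 3 * x + i)) c) (trans (cong (sgn (+ 3 * x + i) *_) (mono-≢ ≢c)) (ℤ.*-zeroʳ (sgn (+ 3 * x + i))))

    eulerProduct-theta : ∀ {K} → N ≤ K → eulerProduct 1 K ≈ Pent.theta K
    eulerProduct-theta {K} N≤K = ≈-trans (Shanks.pentagonal N 1 N≤K) (from-≗ λ c →
      trans (sumOver-coeff (box K) (λ k → signed k (1 ℕ.* pent k)) c)
      (trans (Σ-cong (box K) λ k → cong (λ m → signed k m c) (ℕ.*-identityˡ (pent k)))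
      (sym (sumOver-coeff (box K) (λ k → signed k (pent k)) c))))

    within : ∀ {f g} → (∀ {c} → c ≤ N → f c ≡ g c) → f ≈ g
    within p = coefficients (≡₃-reflexive ∘ p)

    -- After the reflection, `u ↦ 1 - u` exchanges the classes 0 and 1 with a change of sign and
    -- maps the class of 2 to itself, so the latter vanishes. Of the three products only the square
    -- of `J` times `- J` remains.
    eulerProduct-trilinear : ∀ {M} → 3 ℕ.+ N ≤ M → Pent.trilinear (+ 1) (M ℕ.* 3) ≈ ⊝ (mono 1 ⊛ (eulerProduct 9 M ⊛ eulerProduct 9 M ⊛ eulerProduct 9 M))
    eulerProduct-trilinear {M} N≤M = begin
      Pent.trilinear (+ 1) (M ℕ.* 3)                   ≈⟨ within shift ⟩
      mono 1 ⊛ Trig.trilinear (+ 1) M                  ≈⟨ ⊛-cong {mono 1} ≈-refl trig-cube ⟩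
      mono 1 ⊛ ⊝ (J ⊛ J ⊛ J)                           ≈⟨ solve 2 (λ x y → x :* :- y := :- (x :* y)) ≈-refl (mono 1) (J ⊛ J ⊛ J) ⟩
      ⊝ (mono 1 ⊛ (J ⊛ J ⊛ J))                         ≈⟨ ⊝-cong (⊛-cong {mono 1} ≈-refl (⊛-cong (⊛-cong J≈E J≈E) J≈E)) ⟩
      ⊝ (mono 1 ⊛ (eulerProduct 9 M ⊛ eulerProduct 9 M ⊛ eulerProduct 9 M)) ∎
      where
      J = Trig.coset (+ 0) M
      M≤3M : M ≤ M ℕ.* 3
      M≤3M = ℕ.m≤m*n M 3
      3+≤M : ∀ {c} → c ≤ N → 3 ℕ.+ c ≤ M
      3+≤M c≤N = ℕ.≤-trans (ℕ.+-monoʳ-≤ 3 c≤N) N≤M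
      shift : ∀ {c} → c ≤ N → Pent.trilinear (+ 1) (M ℕ.* 3) c ≡ (mono 1 ⊛ Trig.trilinear (+ 1) M) c
      shift {zero}  c≤N = trilinear-zero (ℕ.≤-trans (3+≤M c≤N) M≤3M)
      shift {suc c} c≤N = trans (trilinear-reflects {M ℕ.* 3} {M} (ℕ.≤-trans (3+≤M c≤N) M≤3M) (ℕ.≤-trans (ℕ.n≤1+n _) (3+≤M c≤N)))
        (sym (mono-⊛-shift 1 (Trig.trilinear (+ 1) M) c))
      J≈E : J ≈ eulerProduct 9 M
      J≈E = ≈-trans (from-≗ (Trig-coset-zero M)) (≈-sym (Shanks.pentagonal N 9 (ℕ.≤-trans (ℕ.m≤n+m N 3) N≤M)))
      J₁ : Trig.coset (+ 1) M ≈ ⊝ J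
      J₁ = within λ {c} c≤N → trans (Trig-coset-reflect {+ 1} {+ 0} {+ 0} refl (s≤s z≤n) z≤n (3+≤M c≤N)) (sym (⊝-coeff J c))
      J₂ : Trig.coset (+ 2) M ≈ const 0ℤ
      J₂ = within λ {c} c≤N → trans (Trig-coset-self-opposite {+ 2} { -1ℤ} refl ℕ.≤-refl (3+≤M c≤N)) (sym (const-0 c))
      J₋₁ : Trig.coset -1ℤ M ≈ const 0ℤ
      J₋₁ = within λ {c} c≤N → trans (Trig-coset-self-opposite { -1ℤ} {+ 1} refl (s≤s z≤n) (3+≤M c≤N)) (sym (const-0 c))
      trig-cube : Trig.trilinear (+ 1) M ≈ ⊝ (J ⊛ J ⊛ J)
      trig-cube = begin
        J ⊛ J ⊛ Trig.coset (+ 1) M ⊕ X ⊛ X ⊛ Trig.coset (+ 2) M ⊕ Trig.coset -1ℤ M ⊛ Y ⊛ J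
          ≈⟨ ⊕-cong (⊕-cong (⊛-cong (≈-refl {J ⊛ J}) J₁) (⊛-cong (≈-refl {X ⊛ X}) J₂)) (⊛-cong (⊛-cong J₋₁ (≈-refl {Y})) (≈-refl {J})) ⟩
        J ⊛ J ⊛ ⊝ J ⊕ X ⊛ X ⊛ const 0ℤ ⊕ const 0ℤ ⊛ Y ⊛ J
          ≈⟨ solve 3 (λ j x y → j :* j :* :- j :+ x :* x :* con 0ℤ :+ con 0ℤ :* y :* j := :- (j :* j :* j)) ≈-refl J X Y ⟩
        ⊝ (J ⊛ J ⊛ J) ∎
        where
        X = Trig.coset (+ 1) M
        Y = Trig.coset -1ℤ M

    -- The logarithmic derivative of E is - S, hence E³ ϑ S = E ((ϑ E)² - E ϑ² E); splitting E by exponents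
    -- modulo 3 turns the right-hand side into - trilinear 1 - trilinear (-1).
    cube-ϑ-divisorSums : ∀ {M} → 3 ℕ.+ N ≤ M → let E = eulerProduct 1 (suc (M ℕ.* 3 ℕ.* 3)) in
      ϑ (divisorSums (suc (M ℕ.* 3 ℕ.* 3))) ⊛ (E ⊛ E ⊛ E) ≈ mono 1 ⊛ (eulerProduct 9 M ⊛ eulerProduct 9 M ⊛ eulerProduct 9 M)
    cube-ϑ-divisorSums {M} N≤M = begin
      ϑ S ⊛ (E ⊛ E ⊛ E)
        ≈⟨ solve 4 (λ s′ e e′ s → s′ :* (e :* e :* e) := e :* e :* (e′ :* s :+ e :* s′) :- e :* e′ :* (e :* s)) ≈-refl (ϑ S) E (ϑ E) S ⟩
      E ⊛ E ⊛ (ϑ E ⊛ S ⊕ E ⊛ ϑ S) ⊕ ⊝ (E ⊛ ϑ E ⊛ (E ⊛ S))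
        ≈⟨ ⊕-cong (⊛-cong (≈-refl {E ⊛ E}) derivative) (⊝-cong (⊛-cong (≈-refl {E ⊛ ϑ E}) (euler-divisorSums K))) ⟩
      E ⊛ E ⊛ ⊝ ϑ (ϑ E) ⊕ ⊝ (E ⊛ ϑ E ⊛ ⊝ ϑ E)
        -- `ϑ` acts on the three classes as 0, 1 and -1, so it sends `E` to `y - z` and then to
        -- `y + z`.
        ≈⟨ ⊕-cong (⊛-cong (⊛-cong E≈ E≈) (⊝-cong ϑ²E≈)) (⊝-cong (⊛-cong (⊛-cong E≈ ϑE≈) (⊝-cong ϑE≈))) ⟩
      (a ⊕ y ⊕ z) ⊛ (a ⊕ y ⊕ z) ⊛ ⊝ (y ⊕ z) ⊕ ⊝ ((a ⊕ y ⊕ z) ⊛ (y ⊕ ⊝ z) ⊛ ⊝ (y ⊕ ⊝ z))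
        -- Over the integers the left-hand side is (a + y + z) (- a y - a z - 4 y z); replacing -4
        -- by -1 and dropping 3 a y z leaves minus the two cyclic sums.
        ≈⟨ solve 3 (λ a y z → (a :+ y :+ z) :* (a :+ y :+ z) :* :- (y :+ z) :- (a :+ y :+ z) :* (y :- z) :* :- (y :- z) :=
             :- (a :* a :* y :+ y :* y :* z :+ z :* z :* a) :- (a :* a :* z :+ y :* y :* a :+ z :* z :* y)
             :+ con (+ 3) :* (:- (a :* y :* z) :- y :* z :* (a :+ y :+ z))) ≈-refl a y z ⟩
      ⊝ (a ⊛ a ⊛ y ⊕ y ⊛ y ⊛ z ⊕ z ⊛ z ⊛ a) ⊕ ⊝ (a ⊛ a ⊛ z ⊕ y ⊛ y ⊛ a ⊕ z ⊛ z ⊛ y) ⊕ const (+ 3) ⊛ (⊝ (a ⊛ y ⊛ z) ⊕ ⊝ (y ⊛ z ⊛ (a ⊕ y ⊕ z)))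
        ≈⟨ ⊕-cong (⊕-cong (⊝-cong T₁) (⊝-cong T₋₁)) (3≈0 _) ⟩
      ⊝ ⊝ R ⊕ ⊝ const 0ℤ ⊕ const 0ℤ
        ≈⟨ solve 1 (λ r → :- (:- r) :- con 0ℤ :+ con 0ℤ := r) ≈-refl R ⟩
      R ∎
      where
      -- One cutoff for two purposes: 3 (3 M) + 1 for the exact splitting into classes modulo 3, and
      -- 9 M + 1 for the comparison with the `M` factors of `eulerProduct 9 M`.
      K = suc (M ℕ.* 3 ℕ.* 3)
      E = eulerProduct 1 K
      S = divisorSums K
      R = mono 1 ⊛ (eulerProduct 9 M ⊛ eulerProduct 9 M ⊛ eulerProduct 9 M)
      a = Pent.coset (+ 0) (M ℕ.* 3)
      y = Pent.coset (+ 1) (M ℕ.* 3)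
      z = Pent.coset -1ℤ (M ℕ.* 3)
      M≤3M : M ≤ M ℕ.* 3
      M≤3M = ℕ.m≤m*n M 3
      3+≤3M : ∀ {c} → c ≤ N → 3 ℕ.+ c ≤ M ℕ.* 3
      3+≤3M c≤N = ℕ.≤-trans (ℕ.≤-trans (ℕ.+-monoʳ-≤ 3 c≤N) N≤M) M≤3M
      N≤K : N ≤ K
      N≤K = ℕ.≤-trans (3+≤3M′ ℕ.≤-refl) (ℕ.≤-trans (ℕ.m≤m*n (M ℕ.* 3) 3) (ℕ.n≤1+n _))
        where
        3+≤3M′ : ∀ {c} → c ≤ N → c ≤ M ℕ.* 3
        3+≤3M′ {c} c≤N = ℕ.≤-trans (ℕ.m≤n+m c 3) (3+≤3M c≤N)
      derivative : ϑ E ⊛ S ⊕ E ⊛ ϑ S ≈ ⊝ ϑ (ϑ E)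
      derivative = begin
        ϑ E ⊛ S ⊕ E ⊛ ϑ S ≈⟨ from-≗ (ϑ-⊛-⊕ E S) ⟨
        ϑ (E ⊛ S)         ≈⟨ ϑ-cong (euler-divisorSums K) ⟩
        ϑ (⊝ ϑ E)         ≈⟨ from-≗ (ϑ-⊝ (ϑ E)) ⟩
        ⊝ ϑ (ϑ E)         ∎
      E≈ : E ≈ a ⊕ y ⊕ z
      E≈ = ≈-trans (eulerProduct-theta N≤K) (from-≗ (Pent.theta-cosets (M ℕ.* 3)))
      ϑy≈ : ϑ y ≈ y
      ϑy≈ = ≈-trans (ϑ-coset (+ 1) (M ℕ.* 3)) (⊛-identityˡ y)
      ϑz≈ : ϑ z ≈ ⊝ z
      ϑz≈ = ≈-trans (ϑ-coset -1ℤ (M ℕ.* 3)) (solve 1 (λ z → con -1ℤ :* z := :- z) ≈-refl z)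
      ϑE≈ : ϑ E ≈ y ⊕ ⊝ z
      ϑE≈ = begin
        ϑ E                       ≈⟨ ϑ-cong E≈ ⟩
        ϑ (a ⊕ y ⊕ z)             ≈⟨ ≈-trans (from-≗ (ϑ-⊕ (a ⊕ y) z)) (⊕-cong (from-≗ (ϑ-⊕ a y)) ≈-refl) ⟩
        ϑ a ⊕ ϑ y ⊕ ϑ z           ≈⟨ ⊕-cong (⊕-cong (ϑ-coset (+ 0) (M ℕ.* 3)) ϑy≈) ϑz≈ ⟩
        const 0ℤ ⊛ a ⊕ y ⊕ ⊝ z    ≈⟨ solve 3 (λ a y z → con 0ℤ :* a :+ y :- z := y :- z) ≈-refl a y z ⟩
        y ⊕ ⊝ z                   ∎
      ϑ²E≈ : ϑ (ϑ E) ≈ y ⊕ z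
      ϑ²E≈ = begin
        ϑ (ϑ E)        ≈⟨ ϑ-cong ϑE≈ ⟩
        ϑ (y ⊕ ⊝ z)    ≈⟨ ≈-trans (from-≗ (ϑ-⊕ y (⊝ z))) (⊕-cong ϑy≈ (≈-trans (from-≗ (ϑ-⊝ z)) (⊝-cong ϑz≈))) ⟩
        y ⊕ ⊝ ⊝ z      ≈⟨ solve 2 (λ y z → y :- :- z := y :+ z) ≈-refl y z ⟩
        y ⊕ z          ∎
      T₁ : a ⊛ a ⊛ y ⊕ y ⊛ y ⊛ z ⊕ z ⊛ z ⊛ a ≈ ⊝ R
      T₁ = ≈-trans (⊕-cong (⊕-cong (≈-refl {a ⊛ a ⊛ y}) (⊛-cong (≈-refl {y ⊛ y}) (≈-sym coset₂))) (≈-refl {z ⊛ z ⊛ a})) (eulerProduct-trilinear N≤M)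
        where
        coset₂ : Pent.coset (+ 2) (M ℕ.* 3) ≈ z
        coset₂ = within λ c≤N → Pent.coset-translate {+ 2} { -1ℤ} {+ 1} refl ℕ.≤-refl (s≤s z≤n) (3+≤3M c≤N)
      T₋₁ : a ⊛ a ⊛ z ⊕ y ⊛ y ⊛ a ⊕ z ⊛ z ⊛ y ≈ const 0ℤ
      T₋₁ = ≈-trans (⊕-cong (≈-refl {a ⊛ a ⊛ z ⊕ y ⊛ y ⊛ a}) (⊛-cong (≈-refl {z ⊛ z}) (≈-sym coset₋₂)))
                    (within λ {c} c≤N → trans (trilinear-vanishes (3+≤3M c≤N)) (sym (const-0 c)))
        where
        coset₋₂ : Pent.coset -[1+ 1 ] (M ℕ.* 3) ≈ y
        coset₋₂ = within λ c≤N → Pent.coset-translate { -[1+ 1 ]} {+ 1} { -1ℤ} refl ℕ.≤-refl (s≤s z≤n) (3+≤3M c≤N)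

    eulerProduct-constant : ∀ r .{{_ : NonZero r}} K → eulerProduct r K 0 ≡ 1ℤ
    eulerProduct-constant r       zero    = refl
    eulerProduct-constant (suc r) (suc K) = trans (cong₂ _*_ (eulerProduct-constant (suc r) K)
      (trans (⊕-coeff (const 1ℤ) (⊝ mono (suc r ℕ.* suc K)) 0) (cong (_+_ 1ℤ) (⊝-coeff (mono (suc r ℕ.* suc K)) 0)))) refl

    ϑ-divisorSums : ∀ {M} → 3 ℕ.+ N ≤ M →
      ϑ (divisorSums (suc (M ℕ.* 3 ℕ.* 3))) ≈ mono 1 ⊛ dilate (boundedSeries 9 (suc (M ℕ.* 3 ℕ.* 3)))
    ϑ-divisorSums {M} N≤M = ⊛-cancel {h = E ⊛ E ⊛ E} (cong (λ x → x * x * x) (eulerProduct-constant 1 K)) (begin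
      ϑ (divisorSums K) ⊛ (E ⊛ E ⊛ E)                ≈⟨ cube-ϑ-divisorSums N≤M ⟩
      mono 1 ⊛ (E₉ ⊛ E₉ ⊛ E₉)                        ≈⟨ ⊛-cong (≈-refl {mono 1}) (eulerProduct-cube 9 M) ⟩
      mono 1 ⊛ eulerProduct 27 M                     ≈⟨ ⊛-cong (≈-refl {mono 1}) (from-≗ (dilate-eulerProduct 9 M)) ⟨
      mono 1 ⊛ dilate E₉                             ≈⟨ ⊛-cong (≈-refl {mono 1}) (dilate-cong generating) ⟨
      mono 1 ⊛ dilate (B ⊛ E)                        ≈⟨ ⊛-cong (≈-refl {mono 1}) (from-≗ (dilate-⊛ B E)) ⟩
      mono 1 ⊛ (dilate B ⊛ dilate E)                 ≈⟨ ⊛-cong (≈-refl {mono 1}) (⊛-cong (≈-refl {dilate B}) (≈-trans (from-≗ (dilate-eulerProduct 1 K)) (≈-sym (eulerProduct-cube 1 K)))) ⟩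
      mono 1 ⊛ (dilate B ⊛ (E ⊛ E ⊛ E))              ≈⟨ solve 3 (λ x b e → x :* (b :* e) := x :* b :* e) ≈-refl (mono 1) (dilate B) (E ⊛ E ⊛ E) ⟩
      mono 1 ⊛ dilate B ⊛ (E ⊛ E ⊛ E)                ∎)
      where
      K  = suc (M ℕ.* 3 ℕ.* 3)
      E  = eulerProduct 1 K
      E₉ = eulerProduct 9 M
      B  = boundedSeries 9 K
      generating : B ⊛ E ≈ E₉
      generating = subst (λ k → boundedSeries 9 (suc k) ⊛ eulerProduct 1 (suc k) ≈ E₉) (sym (ℕ.*-assoc M 3 3))
        (≈-trans (bounded-euler-below M 1 (s≤s (s≤s z≤n))) (bounded-euler 8 M))

  -- The congruence of series is read off at the single exponent `N = 3 n + 1`: there `ϑ` multiplies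
  -- by `N`, which is ≡ 1, and q B(q³) has the coefficient `b 9 n`.
  b₉≡₃σ : ∀ n → + b 9 n ≡₃ + σ (suc (3 ℕ.* n))
  b₉≡₃σ n = ≡₃-sym {+ σ N} {+ b 9 n} (≡₃-trans {+ σ N} {+ N * + σ N} residue (subst₂ _≡₃_ lhs rhs (at (ϑ-divisorSums {M} ℕ.≤-refl) ℕ.≤-refl)))
    where
    N = suc (3 ℕ.* n)
    M = 3 ℕ.+ N
    K = suc (M ℕ.* 3 ℕ.* 3)
    open Truncated N using (at)
    open Congruences N
    N≤K : N ≤ K
    N≤K = ℕ.≤-trans (ℕ.m≤n+m N 3) (ℕ.≤-trans (ℕ.m≤m*n M 3) (ℕ.≤-trans (ℕ.m≤m*n (M ℕ.* 3) 3) (ℕ.n≤1+n _)))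
    n≤K : n ≤ K
    n≤K = ℕ.≤-trans (ℕ.≤-trans (ℕ.m≤n*m n 3) (ℕ.n≤1+n _)) N≤K
    lhs : ϑ (divisorSums K) N ≡ + N * + σ N
    lhs = cong (+ N *_) (trans (divisorSums-coeff K (3 ℕ.* n)) (cong +_ (sum-divisors {K} {N} N≤K)))
    rhs : (mono 1 ⊛ dilate (boundedSeries 9 K)) N ≡ + b 9 n
    rhs = trans (mono-⊛-shift 1 (dilate (boundedSeries 9 K)) (3 ℕ.* n)) (trans (dilate-coeff (boundedSeries 9 K) n) (cong +_ (count-b 9 n≤K)))
    residue : + σ N ≡₃ + N * + σ N
    residue = divides (- (+ n * + σ N)) (trans (cong (λ m → + σ N - (1ℤ + m) * + σ N) (ℤ.pos-* 3 n)) (lemma (+ n) (+ σ N)))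
      where
      lemma : ∀ n s → s - (1ℤ + + 3 * n) * s ≡ - (n * s) * + 3
      lemma = solve-∀

-- From the congruence to the criterion on primes.

open import Data.Nat using (ℕ; s≤s; _+_; _*_)
open import Data.Nat.DivMod using (_%_)
open import Data.Nat.Divisibility using (_∣_)
open import Data.Nat.Primality using (Prime)
open import Data.Product using (_×_)
open import Data.Sum using (_⊎_)
open import Function.Bundles using (_⇔_)
open import Relation.Binary.PropositionalEquality using (_≡_; _≢_)
open import Defs
open import Data.Integer using (+_) renaming (_+_ to _+ᶻ_; _-_ to _-ᶻ_)
open import Data.Integer.Divisibility.Signed using (∣⇒∣ᵤ; ∣ᵤ⇒∣; ∣m∣n⇒∣m+n) renaming (_∣_ to _∣ᶻ_)
import Data.Integer.Tactic.RingSolver as ℤ-Solver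
open import Data.List using ([]; _∷_)
open import Data.List.Relation.Unary.Any using (here)
open import Data.Nat.Divisibility using (∣⇒≤; ∣m+n∣m⇒∣n; m∣m*n)
open import Data.Nat.Properties using (+-comm)
open import Data.Product using (_,_; ∃-syntax)
open import Data.Sum using (inj₁; inj₂)
open import Function using (_∘_)
open import Function.Bundles using (mk⇔; Equivalence)
open import Relation.Binary.PropositionalEquality using (refl; subst)
open import Relation.Nullary using (¬_; contradiction)
open PowerSeries
open SumOfDivisors
open PartitionCongruence
open Equivalence using (to; from)

#≢0⇔∃ : {A : Set} {P : A → Set} (fin : Finite P) → # P fin ≢ 0 ⇔ (∃[ x ] P x)
#≢0⇔∃ record { elements = [] ; complete = complete } =
  mk⇔ (λ ≢0 → contradiction refl ≢0) (λ (_ , px) → contradiction (from complete px) λ ())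
#≢0⇔∃ record { elements = x ∷ _ ; complete = complete } =
  mk⇔ (λ _ → x , to complete (here refl)) (λ _ ())

≡₃⇒∣ : ∀ {m n} → + m ≡₃ + n → 3 ∣ n → 3 ∣ m
≡₃⇒∣ {m} {n} m≡n 3∣n = ∣⇒∣ᵤ (subst (+ 3 ∣ᶻ_) (lemma (+ m) (+ n)) (∣m∣n⇒∣m+n m≡n (∣ᵤ⇒∣ 3∣n)))
  where
  lemma : ∀ m n → (m -ᶻ n) +ᶻ n ≡ m
  lemma = ℤ-Solver.solve-∀

3∣b₉⇔3∣σ : ∀ n → 3 ∣ b 9 n ⇔ 3 ∣ σ (3 * n + 1)
3∣b₉⇔3∣σ n = subst (λ N → 3 ∣ b 9 n ⇔ 3 ∣ σ N) (+-comm 1 (3 * n))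
  (mk⇔ (≡₃⇒∣ (≡₃-sym {+ b 9 n} {+ σ (1 + 3 * n)} (b₉≡₃σ n))) (≡₃⇒∣ (b₉≡₃σ n)))

3∤3n+1 : ∀ n → ¬ 3 ∣ 3 * n + 1
3∤3n+1 n 3∣ with ∣⇒≤ (∣m+n∣m⇒∣n 3∣ (m∣m*n n))
... | s≤s ()

theorem1p1 : (n : ℕ) →
    (3 ∣ b 9 n) ⇔
    ( # (λ p → Prime p × p % 3 ≡ 2 × ord p (3 * n + 1) % 2 ≡ 1) (finite₂ n) ≢ 0
    ⊎ # (λ p → Prime p × p % 3 ≡ 1 × ord p (3 * n + 1) % 3 ≡ 2) (finite₁ n) ≢ 0 )
theorem1p1 n = mk⇔ (distribute ∘ to obstructed ∘ to (3∣b₉⇔3∣σ n)) (from (3∣b₉⇔3∣σ n) ∘ from obstructed ∘ collect)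
  where
  obstructed = 3∣σ⇔obstructed (3 * n + 1) (3n+1≢0 n) (3∤3n+1 n)
  distribute : Obstructed (3 * n + 1) → _ ⊎ _
  distribute (p , prime-p , inj₁ (p≡2 , odd)) = inj₁ (from (#≢0⇔∃ (finite₂ n)) (p , prime-p , p≡2 , odd))
  distribute (p , prime-p , inj₂ (p≡1 , ≡2))  = inj₂ (from (#≢0⇔∃ (finite₁ n)) (p , prime-p , p≡1 , ≡2))
  collect : _ ⊎ _ → Obstructed (3 * n + 1)
  collect (inj₁ ≢0) with to (#≢0⇔∃ (finite₂ n)) ≢0
  ... | p , prime-p , p≡2 , odd = p , prime-p , inj₁ (p≡2 , odd)
  collect (inj₂ ≢0) with to (#≢0⇔∃ (finite₁ n)) ≢0
  ... | p , prime-p , p≡1 , ≡2 = p , prime-p , inj₂ (p≡1 , ≡2)
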